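{- There exists a universal constant $K''$ such that for any finite set $X$, any increasing family $\mathcal F\subseteq 2^X$, and any integer $k\ge \ell(\mathcal F)$, we have \[ q(\mathcal F)\le p_c^k(\mathcal F)\le K''\, q(\mathcal F)\,\log^2 \ell(\mathcal F). \]
   Context: A family $\mathcal F\subseteq 2^X$ is increasing if $B\supseteq A\in\mathcal F$ (with $B\subseteq X$) implies $B\in\mathcal F$. $\mathcal H_{\mathcal F}$ denotes the family of inclusion-minimal members of $\mathcal F$, and $\ell(\mathcal F)$ is the maximum size of a member of $\mathcal H_{\mathcal F}$. $\mathcal F$ is $p$-small if there is $\mathcal G\subseteq 2^X$ such that every member of $\mathcal F$ contains some member of $\mathcal G$ and $\sum_{S\in\mathcal G}p^{|S|}\le\frac12$. The expectation-threshold is $q(\mathcal F):=\max\{p:\mathcal F\text{ is }p\text{ -small}\}$. Let $[k]=\{1,\dots,k\}$ and $X'=X\times[k]$. For $S=\{(x_1,i_1),\dots,(x_t,i_t)\}\subseteq X'$ (with $|S|=t$), let $\mu_p^k(S)=(p/k)^t(1-p)^{|X|-t}$ if $x_1,\dots,x_t$ are distinct, and $\mu_p^k(S)=0$ otherwise; for $\mathcal F'\subseteq 2^{X'}$ let $\mu_p^k(\mathcal F')=\sum_{S\in\mathcal F'}\mu_p^k(S)$. (This is the law of the random colored subset obtained by giving each $x\in X$ an independent uniformly random color in $[k]$ and including each $x$ independently with probability $p$.) A rainbow edge of $\mathcal H_{\mathcal F}$ is a set $\{(x_1,i_1),\dots,(x_t,i_t)\}\subseteq X'$ with $x_1,\dots,x_t$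 distinct, $\{x_1,\dots,x_t\}\in\mathcal H_{\mathcal F}$, and $i_1,\dots,i_t$ distinct. $\mathcal F^{\mathrm{rb}}\subseteq 2^{X'}$ is the increasing family generated by all rainbow edges of $\mathcal H_{\mathcal F}$, i.e. the family of all subsets of $X'$ that contain some rainbow edge of $\mathcal H_{\mathcal F}$. The $k$-color rainbow threshold $p_c^k(\mathcal F)$, for $k\ge\ell(\mathcal F)$, is the value of $p$ such that $\mu_p^k(\mathcal F^{\mathrm{rb}})=\frac12$.
   Formalization: Inside the logarithm ℓ(F) is replaced by max(ℓ(F),2): for ℓ(F)=1 the stated bound would give p_c ≤ 0, which is false (e.g. all sets containing a fixed point, where q = p_c = 1/2); for ℓ(F) ≥ 2 nothing changes. -}

module Defs where

open import Algebra.Bundles using (CommutativeMonoid)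
import Algebra.Properties.CommutativeSemigroup as CommutativeSemigroupProperties
import Algebra.Properties.Group as GroupProperties
open import Data.Bool.Base using (if_then_else_)
open import Data.Fin.Base using (Fin; quotient; remainder)
import Data.Fin.Properties as Fin
open import Data.Fin.Subset using (Subset; inside; outside; _∈_; _⊆_; _⊂_; ∣_∣)
open import Data.Fin.Subset.Properties using (_∈?_; _⊆?_; _⊂?_; anySubset?)
open import Data.Integer.Base as ℤ using (+_; +[1+_])
import Data.Integer.Properties as ℤ
open import Data.List.Base using (List; []; _∷_; _++_; map; filter; foldr)
open import Data.List.Extrema.Nat using (max)
open import Data.Nat.Base as ℕ using (ℕ; zero; suc; _∸_)
import Data.Nat.Properties as ℕ
open import Data.Product.Base using (∃-syntax; _×_; _,_)
open import Data.Rational.Base as ℚ using (ℚ; mkℚ; 0ℚ; 1ℚ; ½; toℚᵘ)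
import Data.Rational.Properties as ℚ
open import Data.Rational.Unnormalised.Base as ℚᵘ using (mkℚᵘ)
import Data.Rational.Unnormalised.Properties as ℚᵘ
open import Data.Sum.Base using (inj₁; inj₂)
open import Data.Vec.Base as Vec using (tabulate)
open import Level using (0ℓ)
open import Relation.Binary.PropositionalEquality using (_≡_; refl; sym; trans; cong; cong₂; subst; subst₂; module ≡-Reasoning)
open import Relation.Nullary using (does; ¬_)
open import Relation.Nullary.Decidable using (_×-dec_; _→-dec_; ¬?)
open import Relation.Unary using (Pred; Decidable)

Cauchy : (ℕ → ℚ) → Set
Cauchy x = ∀ ε → 0ℚ ℚ.< ε → ∃[ N ] (∀ m n → N ℕ.≤ m → N ℕ.≤ n → ℚ.∣ x m ℚ.- x n ∣ ℚ.< ε)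

record ℝ : Set where
  constructor mkℝ
  field
    seq    : ℕ → ℚ
    cauchy : Cauchy seq

open ℝ public

module CauchyLemmas where
  module +ℚ = GroupProperties ℚ.+-0-group
  open CommutativeSemigroupProperties (CommutativeMonoid.commutativeSemigroup ℚ.+-0-commutativeMonoid) using (interchange)

  sub-+ : ∀ a b c d → (a ℚ.+ b) ℚ.- (c ℚ.+ d) ≡ (a ℚ.- c) ℚ.+ (b ℚ.- d)
  sub-+ a b c d = trans (cong (a ℚ.+ b ℚ.+_) (ℚ.neg-distrib-+ c d)) (interchange a b (ℚ.- c) (ℚ.- d))

  sub-* : ∀ a b c d → a ℚ.* b ℚ.- c ℚ.* d ≡ a ℚ.* (b ℚ.- d) ℚ.+ d ℚ.* (a ℚ.- c)
  sub-* a b c d = sym (begin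
    a ℚ.* (b ℚ.- d) ℚ.+ d ℚ.* (a ℚ.- c)
      ≡⟨ cong₂ ℚ._+_ (distrib a b d) (distrib d a c) ⟩
    (a ℚ.* b ℚ.- a ℚ.* d) ℚ.+ (d ℚ.* a ℚ.- d ℚ.* c)
      ≡⟨ cong₂ (λ u v → (a ℚ.* b ℚ.- a ℚ.* d) ℚ.+ (u ℚ.- v)) (ℚ.*-comm d a) (ℚ.*-comm d c) ⟩
    (a ℚ.* b ℚ.- a ℚ.* d) ℚ.+ (a ℚ.* d ℚ.- c ℚ.* d)
      ≡⟨ sym (ℚ.+-assoc (a ℚ.* b ℚ.- a ℚ.* d) (a ℚ.* d) (ℚ.- (c ℚ.* d))) ⟩
    (a ℚ.* b ℚ.- a ℚ.* d) ℚ.+ a ℚ.* d ℚ.- c ℚ.* d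
      ≡⟨ cong (ℚ._- c ℚ.* d) (+ℚ.//-rightDividesˡ (a ℚ.* d) (a ℚ.* b)) ⟩
    a ℚ.* b ℚ.- c ℚ.* d ∎)
    where
    open ≡-Reasoning
    distrib : ∀ x y z → x ℚ.* (y ℚ.- z) ≡ x ℚ.* y ℚ.- x ℚ.* z
    distrib x y z = trans (ℚ.*-distribˡ-+ x y (ℚ.- z)) (cong (x ℚ.* y ℚ.+_) (sym (ℚ.neg-distribʳ-* x z)))

  half-pos : ∀ {ε} → 0ℚ ℚ.< ε → 0ℚ ℚ.< ½ ℚ.* ε
  half-pos {ε} 0<ε = subst (ℚ._< ½ ℚ.* ε) (ℚ.*-zeroʳ ½) (ℚ.*-monoʳ-<-pos ½ 0<ε)

  half+half : ∀ ε → ½ ℚ.* ε ℚ.+ ½ ℚ.* ε ≡ ε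
  half+half ε = trans (sym (ℚ.*-distribʳ-+ ε ½ ½)) (ℚ.*-identityˡ ε)

  cauchy-const : ∀ q → Cauchy (λ _ → q)
  cauchy-const q ε 0<ε = 0 , λ _ _ _ _ → subst (λ z → ℚ.∣ z ∣ ℚ.< ε) (sym (ℚ.+-inverseʳ q)) 0<ε

  cauchy-+ : ∀ {x y} → Cauchy x → Cauchy y → Cauchy (λ n → x n ℚ.+ y n)
  cauchy-+ {x} {y} cx cy ε 0<ε with cx (½ ℚ.* ε) (half-pos 0<ε) | cy (½ ℚ.* ε) (half-pos 0<ε)
  ... | M , hx | N , hy = M ℕ.⊔ N , λ m n m≥ n≥ → begin-strict
    ℚ.∣ (x m ℚ.+ y m) ℚ.- (x n ℚ.+ y n) ∣
      ≡⟨ cong ℚ.∣_∣ (sub-+ (x m) (y m) (x n) (y n)) ⟩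
    ℚ.∣ (x m ℚ.- x n) ℚ.+ (y m ℚ.- y n) ∣
      ≤⟨ ℚ.∣p+q∣≤∣p∣+∣q∣ (x m ℚ.- x n) (y m ℚ.- y n) ⟩
    ℚ.∣ x m ℚ.- x n ∣ ℚ.+ ℚ.∣ y m ℚ.- y n ∣
      <⟨ ℚ.+-mono-< (hx m n (ℕ.m⊔n≤o⇒m≤o M N m≥) (ℕ.m⊔n≤o⇒m≤o M N n≥))
                    (hy m n (ℕ.m⊔n≤o⇒n≤o M N m≥) (ℕ.m⊔n≤o⇒n≤o M N n≥)) ⟩
    ½ ℚ.* ε ℚ.+ ½ ℚ.* ε ≡⟨ half+half ε ⟩
    ε ∎
    where
    open ℚ.≤-Reasoning

  cauchy-neg : ∀ {x} → Cauchy x → Cauchy (λ n → ℚ.- x n)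
  cauchy-neg {x} cx ε 0<ε with cx ε 0<ε
  ... | N , hx = N , λ m n m≥ n≥ → subst (ℚ._< ε)
    (trans (sym (ℚ.∣-p∣≡∣p∣ (x m ℚ.- x n))) (cong ℚ.∣_∣ (ℚ.neg-distrib-+ (x m) (ℚ.- x n))))
    (hx m n m≥ n≥)

  bound : ∀ {x} → Cauchy x →
    ∃[ B ] ∃[ N ] (0ℚ ℚ.< B × ∀ n → N ℕ.≤ n → ℚ.∣ x n ∣ ℚ.≤ B)
  bound {x} cx with cx 1ℚ (ℚ.positive⁻¹ 1ℚ)
  ... | N , hx = 1ℚ ℚ.+ ℚ.∣ x N ∣ , N , pos , λ n n≥ → begin
    ℚ.∣ x n ∣ ≡⟨ cong ℚ.∣_∣ (sym (+ℚ.//-rightDividesˡ (x N) (x n))) ⟩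
    ℚ.∣ (x n ℚ.- x N) ℚ.+ x N ∣ ≤⟨ ℚ.∣p+q∣≤∣p∣+∣q∣ (x n ℚ.- x N) (x N) ⟩
    ℚ.∣ x n ℚ.- x N ∣ ℚ.+ ℚ.∣ x N ∣ ≤⟨ ℚ.+-monoˡ-≤ ℚ.∣ x N ∣ (ℚ.<⇒≤ (hx n N n≥ ℕ.≤-refl)) ⟩
    1ℚ ℚ.+ ℚ.∣ x N ∣ ∎
    where
    open ℚ.≤-Reasoning
    pos : 0ℚ ℚ.< 1ℚ ℚ.+ ℚ.∣ x N ∣
    pos = ℚ.+-mono-<-≤ {0ℚ} {1ℚ} {0ℚ} (ℚ.positive⁻¹ 1ℚ) (ℚ.0≤∣p∣ (x N))

  quot : ∀ B ε → 0ℚ ℚ.< B → 0ℚ ℚ.< ε → ∃[ δ ] (0ℚ ℚ.< δ × B ℚ.* δ ≡ ε)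
  quot B ε 0<B 0<ε = 1/B ℚ.* ε , pos ,
    trans (sym (ℚ.*-assoc B 1/B ε)) (trans (cong (ℚ._* ε) (ℚ.*-inverseʳ B)) (ℚ.*-identityˡ ε))
    where
    instance
      B-pos = ℚ.positive 0<B
      B-nz  = ℚ.pos⇒nonZero B
      ε-pos = ℚ.positive 0<ε
    1/B = ℚ.1/ B
    instance
      1/B-pos = ℚ.1/pos⇒pos B
    pos : 0ℚ ℚ.< 1/B ℚ.* ε
    pos = ℚ.positive⁻¹ _ {{ℚ.pos*pos⇒pos 1/B ε}}

  *-bound : ∀ {p q} {B δ} → 0ℚ ℚ.< B → ℚ.∣ p ∣ ℚ.≤ B → ℚ.∣ q ∣ ℚ.< δ → ℚ.∣ p ℚ.* q ∣ ℚ.< B ℚ.* δ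
  *-bound {p} {q} {B} {δ} 0<B p≤ q< = begin-strict
    ℚ.∣ p ℚ.* q ∣ ≡⟨ ℚ.∣p*q∣≡∣p∣*∣q∣ p q ⟩
    ℚ.∣ p ∣ ℚ.* ℚ.∣ q ∣ ≤⟨ ℚ.*-monoʳ-≤-nonNeg ℚ.∣ q ∣ {{ℚ.∣-∣-nonNeg q}} p≤ ⟩
    B ℚ.* ℚ.∣ q ∣ <⟨ ℚ.*-monoʳ-<-pos B {{ℚ.positive 0<B}} q< ⟩
    B ℚ.* δ ∎
    where open ℚ.≤-Reasoning

  cauchy-* : ∀ {x y} → Cauchy x → Cauchy y → Cauchy (λ n → x n ℚ.* y n)
  cauchy-* {x} {y} cx cy ε 0<ε with bound {x} cx | bound {y} cy
  ... | A , M₁ , 0<A , x≤A | B , N₁ , 0<B , y≤B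
    with quot A (½ ℚ.* ε) 0<A (half-pos 0<ε) | quot B (½ ℚ.* ε) 0<B (half-pos 0<ε)
  ... | α , 0<α , Aα | β , 0<β , Bβ with cy α 0<α | cx β 0<β
  ... | N₂ , hy | M₂ , hx = (M₁ ℕ.⊔ N₁) ℕ.⊔ (M₂ ℕ.⊔ N₂) , λ m n m≥ n≥ → begin-strict
    ℚ.∣ x m ℚ.* y m ℚ.- x n ℚ.* y n ∣
      ≡⟨ cong ℚ.∣_∣ (sub-* (x m) (y m) (x n) (y n)) ⟩
    ℚ.∣ x m ℚ.* (y m ℚ.- y n) ℚ.+ y n ℚ.* (x m ℚ.- x n) ∣
      ≤⟨ ℚ.∣p+q∣≤∣p∣+∣q∣ (x m ℚ.* (y m ℚ.- y n)) (y n ℚ.* (x m ℚ.- x n)) ⟩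
    ℚ.∣ x m ℚ.* (y m ℚ.- y n) ∣ ℚ.+ ℚ.∣ y n ℚ.* (x m ℚ.- x n) ∣
      <⟨ ℚ.+-mono-<
           (*-bound {x m} {y m ℚ.- y n} 0<A (x≤A m (i₁ m≥)) (hy m n (j₂ m≥) (j₂ n≥)))
           (*-bound {y n} {x m ℚ.- x n} 0<B (y≤B n (i₂ n≥)) (hx m n (j₁ m≥) (j₁ n≥))) ⟩
    A ℚ.* α ℚ.+ B ℚ.* β ≡⟨ cong₂ ℚ._+_ Aα Bβ ⟩
    ½ ℚ.* ε ℚ.+ ½ ℚ.* ε ≡⟨ half+half ε ⟩
    ε ∎
    where
    open ℚ.≤-Reasoning
    I = M₁ ℕ.⊔ N₁
    J = M₂ ℕ.⊔ N₂
    i₁ : ∀ {n} → I ℕ.⊔ J ℕ.≤ n → M₁ ℕ.≤ n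
    i₁ h = ℕ.m⊔n≤o⇒m≤o M₁ N₁ (ℕ.m⊔n≤o⇒m≤o I J h)
    i₂ : ∀ {n} → I ℕ.⊔ J ℕ.≤ n → N₁ ℕ.≤ n
    i₂ h = ℕ.m⊔n≤o⇒n≤o M₁ N₁ (ℕ.m⊔n≤o⇒m≤o I J h)
    j₁ : ∀ {n} → I ℕ.⊔ J ℕ.≤ n → M₂ ℕ.≤ n
    j₁ h = ℕ.m⊔n≤o⇒m≤o M₂ N₂ (ℕ.m⊔n≤o⇒n≤o I J h)
    j₂ : ∀ {n} → I ℕ.⊔ J ℕ.≤ n → N₂ ℕ.≤ n
    j₂ h = ℕ.m⊔n≤o⇒n≤o M₂ N₂ (ℕ.m⊔n≤o⇒n≤o I J h)

open CauchyLemmas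

fromℚ : ℚ → ℝ
fromℚ q = mkℝ (λ _ → q) (cauchy-const q)

0ℝ 1ℝ ½ℝ : ℝ
0ℝ = fromℚ 0ℚ
1ℝ = fromℚ 1ℚ
½ℝ = fromℚ ½

infixr 8 _^ℝ_
infixl 7 _*ℝ_
infixl 6 _+ℝ_ _-ℝ_
infix  4 _≤ℝ_ _≈ℝ_

_+ℝ_ _-ℝ_ _*ℝ_ : ℝ → ℝ → ℝ
x +ℝ y = mkℝ (λ n → seq x n ℚ.+ seq y n) (cauchy-+ {seq x} {seq y} (cauchy x) (cauchy y))
x -ℝ y = mkℝ (λ n → seq x n ℚ.- seq y n) (cauchy-+ {seq x} {λ n → ℚ.- seq y n} (cauchy x) (cauchy-neg {seq y} (cauchy y)))
x *ℝ y = mkℝ (λ n → seq x n ℚ.* seq y n) (cauchy-* {seq x} {seq y} (cauchy x) (cauchy y))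

_^ℝ_ : ℝ → ℕ → ℝ
x ^ℝ zero  = 1ℝ
x ^ℝ suc t = x *ℝ x ^ℝ t

_≈ℝ_ : ℝ → ℝ → Set
x ≈ℝ y = ∀ ε → 0ℚ ℚ.< ε → ∃[ N ] (∀ n → N ℕ.≤ n → ℚ.∣ seq x n ℚ.- seq y n ∣ ℚ.< ε)

_≤ℝ_ : ℝ → ℝ → Set
x ≤ℝ y = ∀ ε → 0ℚ ℚ.< ε → ∃[ N ] (∀ n → N ℕ.≤ n → seq x n ℚ.< seq y n ℚ.+ ε)

sumℝ : List ℝ → ℝ
sumℝ = foldr _+ℝ_ 0ℝ

1/1+ : ℕ → ℚ
1/1+ a = + 1 ℚ./ suc a

-- 1/(a+1) + ⋯ + 1/(a+c)
harmonic : ℕ → ℕ → ℚ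
harmonic a zero    = 0ℚ
harmonic a (suc c) = 1/1+ a ℚ.+ harmonic (suc a) c

module HarmonicLemmas where
  fromℕ : ℕ → ℚ
  fromℕ m = + m ℚ./ 1

  1/1+-ᵘ : ∀ a → toℚᵘ (1/1+ a) ℚᵘ.≃ mkℚᵘ (+ 1) a
  1/1+-ᵘ a = ℚ.toℚᵘ-fromℚᵘ (mkℚᵘ (+ 1) a)

  fromℕ-ᵘ : ∀ m → toℚᵘ (fromℕ m) ℚᵘ.≃ mkℚᵘ (+ m) 0
  fromℕ-ᵘ m = ℚ.toℚᵘ-fromℚᵘ (mkℚᵘ (+ m) 0)

  prod-ᵘ : ∀ m b → toℚᵘ (fromℕ m ℚ.* 1/1+ b) ℚᵘ.≃ mkℚᵘ (+ m) b
  prod-ᵘ m b = ℚᵘ.≃-trans (ℚ.toℚᵘ-homo-* (fromℕ m) (1/1+ b))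
    (ℚᵘ.≃-trans (ℚᵘ.*-cong (fromℕ-ᵘ m) (1/1+-ᵘ b))
      (ℚᵘ.*≡* (cong₂ ℤ._*_ (ℤ.*-identityʳ (+ m)) (cong (λ z → + suc z) (sym (ℕ.+-identityʳ b))))))

  cross-≤ : ∀ m b a → m ℕ.* suc a ℕ.≤ suc b → fromℕ m ℚ.* 1/1+ b ℚ.≤ 1/1+ a
  cross-≤ m b a h = ℚ.toℚᵘ-cancel-≤
    (ℚᵘ.≤-respˡ-≃ (ℚᵘ.≃-sym (prod-ᵘ m b)) (ℚᵘ.≤-respʳ-≃ (ℚᵘ.≃-sym (1/1+-ᵘ a))
      (ℚᵘ.*≤* (subst₂ ℤ._≤_ (ℤ.pos-* m (suc a)) (sym (ℤ.*-identityˡ (+ suc b))) (ℤ.+≤+ h)))))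

  cross-≥ : ∀ m b a → suc b ℕ.≤ m ℕ.* suc a → 1/1+ a ℚ.≤ fromℕ m ℚ.* 1/1+ b
  cross-≥ m b a h = ℚ.toℚᵘ-cancel-≤
    (ℚᵘ.≤-respʳ-≃ (ℚᵘ.≃-sym (prod-ᵘ m b)) (ℚᵘ.≤-respˡ-≃ (ℚᵘ.≃-sym (1/1+-ᵘ a))
      (ℚᵘ.*≤* (subst₂ ℤ._≤_ (sym (ℤ.*-identityˡ (+ suc b))) (ℤ.pos-* m (suc a)) (ℤ.+≤+ h)))))

  1/1+-anti : ∀ {a b} → a ℕ.≤ b → 1/1+ b ℚ.≤ 1/1+ a
  1/1+-anti {a} {b} a≤b = subst (ℚ._≤ 1/1+ a) (ℚ.*-identityˡ (1/1+ b))
    (cross-≤ 1 b a (ℕ.≤-trans (ℕ.≤-reflexive (ℕ.*-identityˡ (suc a))) (ℕ.s≤s a≤b)))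

  1/1+-nonNeg : ∀ a → 0ℚ ℚ.≤ 1/1+ a
  1/1+-nonNeg a = ℚ.nonNegative⁻¹ (1/1+ a) {{ℚ.normalize-nonNeg 1 (suc a)}}

  fromℕ-suc : ∀ m → fromℕ (suc m) ≡ 1ℚ ℚ.+ fromℕ m
  fromℕ-suc m = ℚ.toℚᵘ-injective (ℚᵘ.≃-trans (fromℕ-ᵘ (suc m)) (ℚᵘ.≃-sym
    (ℚᵘ.≃-trans (ℚ.toℚᵘ-homo-+ 1ℚ (fromℕ m)) (ℚᵘ.≃-trans (ℚᵘ.+-congʳ (toℚᵘ 1ℚ) (fromℕ-ᵘ m))
      (ℚᵘ.*≡* (cong (λ z → (+ 1 ℤ.+ z) ℤ.* + 1) (ℤ.*-identityʳ (+ m))))))))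

  fromℕ-suc-* : ∀ m q → fromℕ (suc m) ℚ.* q ≡ q ℚ.+ fromℕ m ℚ.* q
  fromℕ-suc-* m q = trans (cong (ℚ._* q) (fromℕ-suc m))
    (trans (ℚ.*-distribʳ-+ q 1ℚ (fromℕ m)) (cong (ℚ._+ fromℕ m ℚ.* q) (ℚ.*-identityˡ q)))

  harmonic-≤ : ∀ a₀ a c → a₀ ℕ.≤ a → harmonic a c ℚ.≤ fromℕ c ℚ.* 1/1+ a₀
  harmonic-≤ a₀ a zero    h = ℚ.≤-reflexive (sym (ℚ.*-zeroˡ (1/1+ a₀)))
  harmonic-≤ a₀ a (suc c) h = subst (harmonic a (suc c) ℚ.≤_) (sym (fromℕ-suc-* c (1/1+ a₀)))
    (ℚ.+-mono-≤ (1/1+-anti h) (harmonic-≤ a₀ (suc a) c (ℕ.m≤n⇒m≤1+n h)))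

  harmonic-≥ : ∀ b a c → a ℕ.+ c ℕ.≤ suc b → fromℕ c ℚ.* 1/1+ b ℚ.≤ harmonic a c
  harmonic-≥ b a zero    h = ℚ.≤-reflexive (ℚ.*-zeroˡ (1/1+ b))
  harmonic-≥ b a (suc c) h = subst (ℚ._≤ harmonic a (suc c)) (sym (fromℕ-suc-* c (1/1+ b)))
    (ℚ.+-mono-≤ (1/1+-anti (ℕ.≤-trans (ℕ.m≤m+n a c) (ℕ.s≤s⁻¹ h′))) (harmonic-≥ b (suc a) c h′))
    where h′ = subst (ℕ._≤ suc b) (ℕ.+-suc a c) h

  harmonic-++ : ∀ a c d → harmonic a (c ℕ.+ d) ≡ harmonic a c ℚ.+ harmonic (a ℕ.+ c) d
  harmonic-++ a zero    d = trans (cong (λ z → harmonic z d) (sym (ℕ.+-identityʳ a))) (sym (ℚ.+-identityˡ _))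
  harmonic-++ a (suc c) d = trans (cong (1/1+ a ℚ.+_) (trans (harmonic-++ (suc a) c d)
      (cong (λ z → harmonic (suc a) c ℚ.+ harmonic z d) (sym (ℕ.+-suc a c)))))
    (sym (ℚ.+-assoc (1/1+ a) _ _))

  blocks : ∀ M N c → harmonic (N ℕ.* M) (suc c ℕ.* M) ≡
                     harmonic (N ℕ.* M) M ℚ.+ harmonic (suc N ℕ.* M) (c ℕ.* M)
  blocks M N c = trans (harmonic-++ (N ℕ.* M) M (c ℕ.* M))
    (cong (λ z → harmonic (N ℕ.* M) M ℚ.+ harmonic z (c ℕ.* M)) (ℕ.+-comm (N ℕ.* M) M))

  refine-≥ : ∀ M N c → let M = suc M in harmonic N c ℚ.≤ harmonic (N ℕ.* M) (c ℕ.* M)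
  refine-≥ M N zero    = ℚ.≤-refl
  refine-≥ M N (suc c) = subst (harmonic N (suc c) ℚ.≤_) (sym (blocks (suc M) N c))
    (ℚ.+-mono-≤ (ℚ.≤-trans
        (cross-≥ (suc M) b N (ℕ.≤-reflexive (ℕ.*-comm (suc N) (suc M))))
        (harmonic-≥ b (N ℕ.* suc M) (suc M) (ℕ.≤-reflexive (ℕ.+-comm (N ℕ.* suc M) (suc M)))))
      (refine-≥ M (suc N) c))
    where b = M ℕ.+ N ℕ.* suc M

  refine-≤ : ∀ M N c → let M = suc M in harmonic (suc N ℕ.* M) (c ℕ.* M) ℚ.≤ harmonic N c
  refine-≤ M N zero    = ℚ.≤-refl
  refine-≤ M N (suc c) = subst (ℚ._≤ harmonic N (suc c)) (sym (blocks (suc M) (suc N) c))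
    (ℚ.+-mono-≤ (ℚ.≤-trans
        (harmonic-≤ a a (suc M) ℕ.≤-refl)
        (cross-≤ (suc M) a N (ℕ.m≤n⇒m≤1+n (ℕ.≤-reflexive (ℕ.*-comm (suc M) (suc N))))))
      (refine-≤ M (suc N) c))
    where a = suc N ℕ.* suc M

  harmonic-snoc : ∀ a c → harmonic a c ℚ.≤ harmonic a (suc c)
  harmonic-snoc a zero    = ℚ.+-mono-≤ (1/1+-nonNeg a) ℚ.≤-refl
  harmonic-snoc a (suc c) = ℚ.+-monoʳ-≤ (1/1+ a) (harmonic-snoc (suc a) c)

open HarmonicLemmas

-- The right-endpoint Riemann sum of ∫₁¹⁺ᶜ dt/t with mesh 1/(N+1):
-- 1/(N+1) · Σ_{i=1}^{c(N+1)} 1/(1 + i/(N+1)) = Σ_{i=1}^{c(N+1)} 1/(N+1+i).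
riemann : ℕ → ℕ → ℚ
riemann c N = harmonic (suc N) (c ℕ.* suc N)

module RiemannLemmas where
  common : ℕ → ℕ → ℕ → ℚ
  common c M N = harmonic (suc M ℕ.* suc N) (c ℕ.* (suc M ℕ.* suc N))

  common-sym : ∀ c M N → common c M N ≡ common c N M
  common-sym c M N = cong (λ z → harmonic z (c ℕ.* z)) (ℕ.*-comm (suc M) (suc N))

  riemann-≤ : ∀ c M N → riemann c M ℚ.≤ common c M N
  riemann-≤ c M N = subst (λ z → riemann c M ℚ.≤ harmonic (suc M ℕ.* suc N) z)
    (ℕ.*-assoc c (suc M) (suc N)) (refine-≥ N (suc M) (c ℕ.* suc M))

  riemann-≥ : ∀ c M N → common c M N ℚ.≤ 1/1+ M ℚ.+ riemann c M
  riemann-≥ c M N = ℚ.≤-trans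
    (subst (λ z → harmonic (suc M ℕ.* suc N) z ℚ.≤ harmonic M (c ℕ.* suc M))
      (ℕ.*-assoc c (suc M) (suc N)) (refine-≤ N M (c ℕ.* suc M)))
    (harmonic-snoc M (c ℕ.* suc M))

  riemann-close : ∀ c M N → riemann c M ℚ.- riemann c N ℚ.≤ 1/1+ N
  riemann-close c M N = begin
    riemann c M ℚ.- riemann c N
      ≤⟨ ℚ.+-monoˡ-≤ (ℚ.- riemann c N) (ℚ.≤-trans (riemann-≤ c M N)
           (subst (ℚ._≤ 1/1+ N ℚ.+ riemann c N) (common-sym c N M) (riemann-≥ c N M))) ⟩
    1/1+ N ℚ.+ riemann c N ℚ.- riemann c N
      ≡⟨ +ℚ.//-rightDividesʳ (riemann c N) (1/1+ N) ⟩
    1/1+ N ∎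
    where
    open ℚ.≤-Reasoning

  archimedean : ∀ ε → 0ℚ ℚ.< ε → ∃[ N ] 1/1+ N ℚ.< ε
  archimedean (mkℚ (+ zero) d c) (ℚ.*<* (ℤ.+<+ h)) with () ← ℕ.<-irrefl refl h
  archimedean ε@(mkℚ +[1+ n ] d c) 0<ε = suc d , ℚ.toℚᵘ-cancel-<
    (ℚᵘ.<-respˡ-≃ (ℚᵘ.≃-sym (1/1+-ᵘ (suc d)))
      (ℚᵘ.*<* (subst (λ z → z ℤ.< +[1+ n ] ℤ.* + suc (suc d)) (sym (ℤ.*-identityˡ (+ suc d)))
        (ℤ.+<+ (ℕ.≤-trans (ℕ.≤-reflexive (sym (ℕ.*-identityˡ (suc (suc d))))) (ℕ.*-monoˡ-≤ (suc (suc d)) (ℕ.s≤s {0} {n} ℕ.z≤n)))))))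
  archimedean (mkℚ (ℤ.-[1+ n ]) d c) (ℚ.*<* ())

  riemann-cauchy : ∀ c → Cauchy (riemann c)
  riemann-cauchy c ε 0<ε with archimedean ε 0<ε
  ... | K , hK = K , λ m n m≥ n≥ → ∣∣< (riemann c m) (riemann c n)
      (ℚ.≤-<-trans (riemann-close c m n) (ℚ.≤-<-trans (1/1+-anti n≥) hK))
      (ℚ.≤-<-trans (riemann-close c n m) (ℚ.≤-<-trans (1/1+-anti m≥) hK))
    where
    ∣∣< : ∀ p q → p ℚ.- q ℚ.< ε → q ℚ.- p ℚ.< ε → ℚ.∣ p ℚ.- q ∣ ℚ.< ε
    ∣∣< p q h₁ h₂ with ℚ.∣p∣≡p∨∣p∣≡-p (p ℚ.- q)
    ... | inj₁ e = subst (ℚ._< ε) (sym e) h₁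
    ... | inj₂ e = subst (ℚ._< ε) (trans (sym (+ℚ.⁻¹-anti-homo-// p q)) (sym e)) h₂

open RiemannLemmas

-- The natural logarithm ∫₁ⁿ dt/t of n ≥ 1 (with log 0 = 0 as a junk value).
log : ℕ → ℝ
log n = mkℝ (riemann (n ∸ 1)) (riemann-cauchy (n ∸ 1))

-- 1/k, with 1/0 = 0.
recip : ℕ → ℝ
recip zero    = 0ℝ
recip (suc k) = fromℚ (1/1+ k)

-- A family of subsets of an n-element set X = Fin n. Membership is decidable, as it is
-- classically for every family, so that finite sums over a family make sense.
record Family (n : ℕ) : Set₁ where
  field
    Member  : Pred (Subset n) 0ℓ
    member? : Decidable Member

open Family public

infix 4 _∈ᶠ_
_∈ᶠ_ : ∀ {n} → Subset n → Family n → Set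
S ∈ᶠ 𝓕 = Member 𝓕 S

subsets : ∀ n → List (Subset n)
subsets zero    = Vec.[] ∷ []
subsets (suc n) = map (outside Vec.∷_) (subsets n) ++ map (inside Vec.∷_) (subsets n)

members : ∀ {n} → Family n → List (Subset n)
members {n} 𝓕 = filter (member? 𝓕) (subsets n)

∑ᶠ : ∀ {n} → Family n → (Subset n → ℝ) → ℝ
∑ᶠ 𝓕 f = sumℝ (map f (members 𝓕))

Increasing : ∀ {n} → Family n → Set
Increasing 𝓕 = ∀ {A B} → A ∈ᶠ 𝓕 → A ⊆ B → B ∈ᶠ 𝓕

minimal : ∀ {n} → Family n → Family n
minimal 𝓕 .Member  S = S ∈ᶠ 𝓕 × ¬ (∃[ T ] (T ∈ᶠ 𝓕 × T ⊂ S))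
minimal 𝓕 .member? S = member? 𝓕 S ×-dec ¬? (anySubset? λ T → member? 𝓕 T ×-dec T ⊂? S)

-- ℓ 𝓕 = 0 when 𝓕 is empty.
ℓ : ∀ {n} → Family n → ℕ
ℓ 𝓕 = max 0 (map ∣_∣ (members (minimal 𝓕)))

Small : ∀ {n} → Family n → ℝ → Set₁
Small {n} 𝓕 p = ∃[ 𝓖 ] ((∀ {S} → S ∈ᶠ 𝓕 → ∃[ T ] (T ∈ᶠ 𝓖 × T ⊆ S)) × ∑ᶠ {n} 𝓖 (λ S → p ^ℝ ∣ S ∣) ≤ℝ ½ℝ)

IsProbability : ℝ → Set
IsProbability p = 0ℝ ≤ℝ p × p ≤ℝ 1ℝ

-- q = max { p ∈ [0,1] : 𝓕 is p-small }.
IsExpectationThreshold : ∀ {n} → Family n → ℝ → Set₁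
IsExpectationThreshold 𝓕 q =
  (IsProbability q × Small 𝓕 q) × (∀ p → IsProbability p → Small 𝓕 p → p ≤ℝ q)

-- X × [k] is represented by Fin (n * k), through the bijection Data.Fin.combine.
module _ (n k : ℕ) where

  point : Fin (n ℕ.* k) → Fin n
  point = quotient k

  colour : Fin (n ℕ.* k) → Fin k
  colour = remainder {n} k

DistinctOn : ∀ {m j} → (Fin m → Fin j) → Subset m → Set
DistinctOn f S = ∀ e e′ → e ∈ S → e′ ∈ S → f e ≡ f e′ → e ≡ e′

distinctOn? : ∀ {m j} (f : Fin m → Fin j) → Decidable (DistinctOn f)
distinctOn? f S = Fin.all? λ e → Fin.all? λ e′ →
  (e ∈? S) →-dec (e′ ∈? S) →-dec (f e Fin.≟ f e′) →-dec (e Fin.≟ e′)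

image : ∀ {m j} → (Fin m → Fin j) → Subset m → Subset j
image f S = tabulate λ x → does (Fin.any? λ e → (e ∈? S) ×-dec (f e Fin.≟ x))

rainbowEdges : ∀ {n} → Family n → ∀ k → Family (n ℕ.* k)
rainbowEdges {n} 𝓕 k .Member S =
  DistinctOn (point n k) S × image (point n k) S ∈ᶠ minimal 𝓕 × DistinctOn (colour n k) S
rainbowEdges {n} 𝓕 k .member? S =
  distinctOn? (point n k) S ×-dec member? (minimal 𝓕) (image (point n k) S) ×-dec distinctOn? (colour n k) S

rainbow : ∀ {n} → Family n → ∀ k → Family (n ℕ.* k)
rainbow 𝓕 k .Member  S = ∃[ R ] (R ∈ᶠ rainbowEdges 𝓕 k × R ⊆ S)
rainbow 𝓕 k .member? S = anySubset? λ R → member? (rainbowEdges 𝓕 k) R ×-dec R ⊆? S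

-- For k = 0 the only S is empty, so the junk value of recip 0 plays no role.
μ : ∀ n k → ℝ → Subset (n ℕ.* k) → ℝ
μ n k p S =
  if does (distinctOn? (point n k) S)
  then (p *ℝ recip k) ^ℝ ∣ S ∣ *ℝ (1ℝ -ℝ p) ^ℝ (n ∸ ∣ S ∣)
  else 0ℝ

μᶠ : ∀ n k → ℝ → Family (n ℕ.* k) → ℝ
μᶠ n k p 𝓕′ = ∑ᶠ 𝓕′ (μ n k p)

IsRainbowThreshold : ∀ {n} → Family n → ℕ → ℝ → Set
IsRainbowThreshold {n} 𝓕 k p = IsProbability p × μᶠ n k p (rainbow 𝓕 k) ≈ℝ ½ℝ

{-# OPTIONS --safe #-}
module Submission where

-- Write P_p for the Bernoulli(p) measure. A cover 𝓖 of 𝓕 bounds μ_p^k(𝓕^rb) ≤ P_p(𝓕) by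
-- Σ_{S ∈ 𝓖} p^|S|, which gives q ≤ p_c^k. For the upper bound, three facts are combined:
--   (1) μ_p^k(𝓕^rb) is at least the Bernoulli(p/k) probability of 𝓕^rb on X × [k], since a
--       rainbow edge uses each point at most once;
--   (2) the Park–Pham theorem: a family with minimal sets of size < 2^j which is not
--       q-small has probability ≥ 3/4 under Bernoulli(64jq);
--   (3) if 𝓕^rb is r-small then P_{rk/3}(𝓕) ≤ 1/2: colouring a minimal set by a uniformly
--       random injection turns a cover of 𝓕^rb into a fractional cover of 𝓕, because t
--       points get t given colours with probability 1/(k(k-1)⋯(k-t+1)) ≤ (3/k)^t.
-- If 𝓕 is not q-small, then (2) for 𝓕 and (3) show that 𝓕^rb is not (192jq/k)-small, and
-- (2) for 𝓕^rb and (1) give μ_p^k(𝓕^rb) ≥ 3/4 at p = 12288j²q. All estimates are made over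
-- ℚ, on the terms of Cauchy sequences clamped to [0,1].

open import Defs
open CauchyLemmas
open HarmonicLemmas
open import Data.Bool.Base using (true; false; if_then_else_)
open import Data.Bool.Properties using () renaming (_≟_ to _≟ᵇ_)
open import Data.Empty using (⊥; ⊥-elim)
open import Data.Fin.Base using (Fin; zero; suc; splitAt; _↑ˡ_; _↑ʳ_)
import Data.Fin.Properties as Fin
open import Data.Fin.Subset using (Subset; inside; outside; _∈_; _∉_; _⊆_; _⊂_; ∣_∣; ∁; _∪_; _─_; ⁅_⁆; ⊤) renaming (⊥ to ∅)
open import Data.Fin.Subset.Induction using (⊂-wellFounded; Acc; acc)
open import Data.Fin.Subset.Properties
open import Data.List.Base as List using (List; []; _∷_)
open import Data.List.Extrema.Nat using (xs≤max)
open import Data.List.Membership.Propositional using () renaming (_∈_ to _∈ˡ_)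
import Data.List.Membership.Propositional.Properties as ∈ˡ
open import Data.List.Properties using (filter-accept; filter-reject)
import Data.List.Relation.Unary.All as All
open import Data.List.Relation.Unary.Any using (here)
open import Data.Nat.Base as ℕ using (ℕ; zero; suc)
import Data.Nat.Properties as ℕ
import Data.Nat.Solver as ℕ
open import Data.Product.Base using (∃-syntax; _×_; _,_; proj₁; proj₂)
open import Data.Rational.Base as ℚ using (ℚ; 0ℚ; 1ℚ; ½; _+_; _*_; _-_; -_; _≤_; _<_)
import Data.Rational.Properties as ℚ
open import Data.Rational.Solver using (module +-*-Solver)
open import Data.Sum.Base using (_⊎_; inj₁; inj₂)
open import Data.Vec.Base as Vec using ([]; _∷_; here; there; _++_)
open import Data.Vec.Properties using (≡-dec; []=⇒lookup; lookup⇒[]=; lookup-++ˡ; lookup-++ʳ; lookup∘tabulate)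
open import Function.Base using (_∘_)
open import Relation.Binary.PropositionalEquality using (_≡_; refl; sym; trans; cong; cong₂; subst; subst₂; module ≡-Reasoning)
open import Relation.Nullary using (Dec; yes; no; does; ¬_; contradiction)
open import Relation.Nullary.Decidable using (_×-dec_; _⊎-dec_; ¬?; dec-true; dec-false)
open +-*-Solver using (solve; _:=_; _:+_; _:*_; _:-_; :-_; con)
open ℕ.+-*-Solver using () renaming (solve to solveⁿ; _:=_ to _⊜_; _:+_ to _⊞_; _:*_ to _⊠_; con to conⁿ)

-- The square of the logarithm comes from using Park-Pham twice. Averaging a cover of the rainbow
-- edges over random colourings gives only a fractional cover of `𝓕`, which does not directly yield
-- an integral cover and hence says nothing immediate about q. It does bound the probability of `𝓕`
-- by its cost, so the comparison passes through probability: Park-Pham for `𝓕` makes this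
-- probability large, every rainbow cover is therefore expensive, and Park-Pham for the rainbow
-- edges needs its own j rounds.
--
-- Park-Pham is proved in a form linear in the budget: if every cover costs at least c, then c times
-- the failure probability is small. A round lowers c by the cost of its large fragments, so losses
-- add up in expectation and no round has to be declared good or bad. The constant 64 leaves 16^-h
-- once 4^h possible fragments are counted, and the sum of 16^-h over h = 1, 2, 4, ... stays below
-- 1/8.
--
-- The order of the reals is not decidable, so each inequality is obtained by refuting an eventual
-- rational gap; at a fixed index this is a statement about one rational p.

*-monoˡ-≤ : ∀ {a b c} → 0ℚ ≤ c → a ≤ b → c * a ≤ c * b
*-monoˡ-≤ {c = c} 0≤c = ℚ.*-monoˡ-≤-nonNeg c {{ℚ.nonNegative 0≤c}}

*-monoʳ-≤ : ∀ {a b c} → 0ℚ ≤ c → a ≤ b → a * c ≤ b * c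
*-monoʳ-≤ {c = c} 0≤c = ℚ.*-monoʳ-≤-nonNeg c {{ℚ.nonNegative 0≤c}}

*-mono-≤ : ∀ {a b c d} → 0ℚ ≤ a → 0ℚ ≤ d → a ≤ b → c ≤ d → a * c ≤ b * d
*-mono-≤ 0≤a 0≤d a≤b c≤d = ℚ.≤-trans (*-monoˡ-≤ 0≤a c≤d) (*-monoʳ-≤ 0≤d a≤b)

*-nonNeg : ∀ {a b} → 0ℚ ≤ a → 0ℚ ≤ b → 0ℚ ≤ a * b
*-nonNeg {a} {b} 0≤a 0≤b = subst (_≤ a * b) (ℚ.*-zeroʳ a) (*-monoˡ-≤ 0≤a 0≤b)

+-nonNeg : ∀ {a b} → 0ℚ ≤ a → 0ℚ ≤ b → 0ℚ ≤ a + b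
+-nonNeg = ℚ.+-mono-≤ {0ℚ} {_} {0ℚ}

a+[b-a] : ∀ a b → a + (b - a) ≡ b
a+[b-a] = solve 2 (λ a b → a :+ (b :- a) := b) refl

≤⇒0≤- : ∀ {a b} → a ≤ b → 0ℚ ≤ b - a
≤⇒0≤- {a} {b} a≤b = subst (_≤ b - a) (ℚ.+-inverseʳ a) (ℚ.+-monoˡ-≤ (- a) a≤b)

0≤-⇒≤ : ∀ {a b} → 0ℚ ≤ b - a → a ≤ b
0≤-⇒≤ {a} {b} h = subst₂ _≤_ (ℚ.+-identityʳ a) (a+[b-a] a b) (ℚ.+-monoʳ-≤ a h)

0≤1 : 0ℚ ≤ 1ℚ
0≤1 = ℚ.nonNegative⁻¹ 1ℚ

infixr 8 _^_
_^_ : ℚ → ℕ → ℚ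
a ^ zero  = 1ℚ
a ^ suc n = a * a ^ n

^-nonNeg : ∀ {a} n → 0ℚ ≤ a → 0ℚ ≤ a ^ n
^-nonNeg zero    0≤a = 0≤1
^-nonNeg (suc n) 0≤a = *-nonNeg 0≤a (^-nonNeg n 0≤a)

^-mono : ∀ {a b} n → 0ℚ ≤ a → a ≤ b → a ^ n ≤ b ^ n
^-mono zero    0≤a a≤b = ℚ.≤-refl
^-mono (suc n) 0≤a a≤b = *-mono-≤ 0≤a (^-nonNeg n (ℚ.≤-trans 0≤a a≤b)) a≤b (^-mono n 0≤a a≤b)

^-≤1 : ∀ {a} n → 0ℚ ≤ a → a ≤ 1ℚ → a ^ n ≤ 1ℚ
^-≤1 zero    0≤a a≤1 = ℚ.≤-refl
^-≤1 (suc n) 0≤a a≤1 = *-mono-≤ 0≤a 0≤1 a≤1 (^-≤1 n 0≤a a≤1)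

^-anti : ∀ {a m n} → 0ℚ ≤ a → a ≤ 1ℚ → m ℕ.≤ n → a ^ n ≤ a ^ m
^-anti {n = n} 0≤a a≤1 ℕ.z≤n       = ^-≤1 n 0≤a a≤1
^-anti         0≤a a≤1 (ℕ.s≤s m≤n) = *-monoˡ-≤ 0≤a (^-anti 0≤a a≤1 m≤n)

^-mono-exp : ∀ {a m n} → 1ℚ ≤ a → m ℕ.≤ n → a ^ m ≤ a ^ n
^-mono-exp {a} {n = zero}  1≤a ℕ.z≤n = ℚ.≤-refl
^-mono-exp {a} {n = suc n} 1≤a ℕ.z≤n =
  *-mono-≤ 0≤1 (^-nonNeg n (ℚ.≤-trans 0≤1 1≤a)) 1≤a (^-mono-exp 1≤a (ℕ.z≤n {n}))
^-mono-exp         1≤a (ℕ.s≤s m≤n) = *-monoˡ-≤ (ℚ.≤-trans 0≤1 1≤a) (^-mono-exp 1≤a m≤n)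

^-distrib-* : ∀ a b n → (a * b) ^ n ≡ a ^ n * b ^ n
^-distrib-* a b zero    = refl
^-distrib-* a b (suc n) = trans (cong (a * b *_) (^-distrib-* a b n))
  (solve 4 (λ a b x y → a :* b :* (x :* y) := a :* x :* (b :* y)) refl a b (a ^ n) (b ^ n))

^-distrib-+ : ∀ a m n → a ^ (m ℕ.+ n) ≡ a ^ m * a ^ n
^-distrib-+ a zero    n = sym (ℚ.*-identityˡ (a ^ n))
^-distrib-+ a (suc m) n = trans (cong (a *_) (^-distrib-+ a m n)) (sym (ℚ.*-assoc a (a ^ m) (a ^ n)))

-- Indicators and finite measures

⟦_⟧ : ∀ {P : Set} → Dec P → ℚ
⟦ d ⟧ = if does d then 1ℚ else 0ℚ

⟦⟧-true : ∀ {P : Set} (d : Dec P) → P → ⟦ d ⟧ ≡ 1ℚ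
⟦⟧-true d p = cong (if_then 1ℚ else 0ℚ) (dec-true d p)

⟦⟧-false : ∀ {P : Set} (d : Dec P) → ¬ P → ⟦ d ⟧ ≡ 0ℚ
⟦⟧-false d ¬p = cong (if_then 1ℚ else 0ℚ) (dec-false d ¬p)

⟦⟧-nonNeg : ∀ {P : Set} (d : Dec P) → 0ℚ ≤ ⟦ d ⟧
⟦⟧-nonNeg (yes _) = 0≤1
⟦⟧-nonNeg (no _)  = ℚ.≤-refl

⟦⟧-≤1 : ∀ {P : Set} (d : Dec P) → ⟦ d ⟧ ≤ 1ℚ
⟦⟧-≤1 (yes _) = ℚ.≤-refl
⟦⟧-≤1 (no _)  = 0≤1

⟦⟧-mono : ∀ {P Q : Set} (d : Dec P) (e : Dec Q) → (P → Q) → ⟦ d ⟧ ≤ ⟦ e ⟧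
⟦⟧-mono (yes p) e f = ℚ.≤-reflexive (sym (⟦⟧-true e (f p)))
⟦⟧-mono (no _)  e f = ⟦⟧-nonNeg e

⟦⟧-cong : ∀ {P Q : Set} (d : Dec P) (e : Dec Q) → (P → Q) → (Q → P) → ⟦ d ⟧ ≡ ⟦ e ⟧
⟦⟧-cong d e f g = ℚ.≤-antisym (⟦⟧-mono d e f) (⟦⟧-mono e d g)

⟦⟧-¬ : ∀ {P : Set} (d : Dec P) → ⟦ ¬? d ⟧ ≡ 1ℚ - ⟦ d ⟧
⟦⟧-¬ (yes _) = refl
⟦⟧-¬ (no _)  = refl

-- A measure is a positive linear functional, not assumed normalised, so that sums over subsets and
-- expectations obey the same rules. Monotonicity also yields congruence under pointwise equality,
-- replacing function extensionality.
record Measure (A : Set) : Set where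
  field
    ∫      : (A → ℚ) → ℚ
    ∫-mono : ∀ {f g} → (∀ x → f x ≤ g x) → ∫ f ≤ ∫ g
    ∫-+    : ∀ f g → ∫ (λ x → f x + g x) ≡ ∫ f + ∫ g
    ∫-*    : ∀ c f → ∫ (λ x → c * f x) ≡ c * ∫ f

  ∫-cong : ∀ {f g} → (∀ x → f x ≡ g x) → ∫ f ≡ ∫ g
  ∫-cong f≡g = ℚ.≤-antisym (∫-mono (ℚ.≤-reflexive ∘ f≡g)) (∫-mono (ℚ.≤-reflexive ∘ sym ∘ f≡g))

  ∫-0 : ∫ (λ _ → 0ℚ) ≡ 0ℚ
  ∫-0 = trans (∫-* 0ℚ (λ _ → 0ℚ)) (ℚ.*-zeroˡ (∫ (λ _ → 0ℚ)))

  ∫-≡0 : ∀ {f} → (∀ x → f x ≡ 0ℚ) → ∫ f ≡ 0ℚ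
  ∫-≡0 h = trans (∫-cong h) ∫-0

  ∫-nonNeg : ∀ {f} → (∀ x → 0ℚ ≤ f x) → 0ℚ ≤ ∫ f
  ∫-nonNeg {f} 0≤f = subst (_≤ ∫ f) ∫-0 (∫-mono 0≤f)

  ∫-neg : ∀ f → ∫ (λ x → - f x) ≡ - ∫ f
  ∫-neg f = trans (∫-cong (λ x → neg≡ (f x))) (trans (∫-* (- 1ℚ) f) (sym (neg≡ (∫ f))))
    where
    neg≡ : ∀ a → - a ≡ - 1ℚ * a
    neg≡ = solve 1 (λ a → :- a := con (- 1ℚ) :* a) refl

  ∫-- : ∀ f g → ∫ (λ x → f x - g x) ≡ ∫ f - ∫ g
  ∫-- f g = trans (∫-+ f (λ x → - g x)) (cong (∫ f +_) (∫-neg g))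

open Measure public

dirac : ∀ {A} → A → Measure A
dirac a .∫ f         = f a
dirac a .∫-mono f≤g  = f≤g a
dirac a .∫-+ f g     = refl
dirac a .∫-* c f     = refl

0ᵐ : ∀ {A} → Measure A
0ᵐ .∫ f        = 0ℚ
0ᵐ .∫-mono f≤g = ℚ.≤-refl
0ᵐ .∫-+ f g    = refl
0ᵐ .∫-* c f    = sym (ℚ.*-zeroʳ c)

infixl 6 _⊕_
_⊕_ : ∀ {A} → Measure A → Measure A → Measure A
(ν ⊕ ρ) .∫ f        = ∫ ν f + ∫ ρ f
(ν ⊕ ρ) .∫-mono f≤g = ℚ.+-mono-≤ (∫-mono ν f≤g) (∫-mono ρ f≤g)
(ν ⊕ ρ) .∫-+ f g    = trans (cong₂ _+_ (∫-+ ν f g) (∫-+ ρ f g))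
  (solve 4 (λ a b c d → a :+ b :+ (c :+ d) := a :+ c :+ (b :+ d)) refl (∫ ν f) (∫ ν g) (∫ ρ f) (∫ ρ g))
(ν ⊕ ρ) .∫-* c f    = trans (cong₂ _+_ (∫-* ν c f) (∫-* ρ c f)) (sym (ℚ.*-distribˡ-+ c _ _))

scale : ∀ {A} c → 0ℚ ≤ c → Measure A → Measure A
scale c 0≤c ν .∫ f        = c * ∫ ν f
scale c 0≤c ν .∫-mono f≤g = *-monoˡ-≤ 0≤c (∫-mono ν f≤g)
scale c 0≤c ν .∫-+ f g    = trans (cong (c *_) (∫-+ ν f g)) (ℚ.*-distribˡ-+ c _ _)
scale c 0≤c ν .∫-* d f    = trans (cong (c *_) (∫-* ν d f))
  (solve 3 (λ c d a → c :* (d :* a) := d :* (c :* a)) refl c d (∫ ν f))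

pushforward : ∀ {A B} → (A → B) → Measure A → Measure B
pushforward h ν .∫ f        = ∫ ν (f ∘ h)
pushforward h ν .∫-mono f≤g = ∫-mono ν (f≤g ∘ h)
pushforward h ν .∫-+ f g    = ∫-+ ν (f ∘ h) (g ∘ h)
pushforward h ν .∫-* c f    = ∫-* ν c (f ∘ h)

infixl 5 _>>=_
_>>=_ : ∀ {A B} → Measure A → (A → Measure B) → Measure B
(ν >>= κ) .∫ f        = ∫ ν (λ x → ∫ (κ x) f)
(ν >>= κ) .∫-mono f≤g = ∫-mono ν (λ x → ∫-mono (κ x) f≤g)
(ν >>= κ) .∫-+ f g    = trans (∫-cong ν (λ x → ∫-+ (κ x) f g)) (∫-+ ν _ _)
(ν >>= κ) .∫-* c f    = trans (∫-cong ν (λ x → ∫-* (κ x) c f)) (∫-* ν c _)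

record Probability : Set where
  constructor prob
  field
    value : ℚ
    0≤p   : 0ℚ ≤ value
    p≤1   : value ≤ 1ℚ

open Probability public

counting : ∀ m → Measure (Subset m)
counting zero    = dirac []
counting (suc m) = pushforward (outside ∷_) (counting m) ⊕ pushforward (inside ∷_) (counting m)

powerset : ∀ {m} → Subset m → Measure (Subset m)
powerset []            = dirac []
powerset (outside ∷ Z) = pushforward (outside ∷_) (powerset Z)
powerset (inside ∷ Z)  = pushforward (outside ∷_) (powerset Z) ⊕ pushforward (inside ∷_) (powerset Z)

bernoulli : Probability → ∀ m → Measure (Subset m)
bernoulli p zero    = dirac []
bernoulli p (suc m) = scale (1ℚ - value p) (≤⇒0≤- (p≤1 p)) (pushforward (outside ∷_) (bernoulli p m))
                    ⊕ scale (value p) (0≤p p) (pushforward (inside ∷_) (bernoulli p m))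

-- Fubini for an arbitrary `ν`: the counting measure is a finite sum of point masses, and additivity
-- of `ν` moves it past each of them.
∫-counting-comm : ∀ {A} (ν : Measure A) m (f : A → Subset m → ℚ) →
  ∫ ν (λ x → ∫ (counting m) (f x)) ≡ ∫ (counting m) (λ T → ∫ ν (λ x → f x T))
∫-counting-comm ν zero    f = refl
∫-counting-comm ν (suc m) f = trans (∫-+ ν _ _)
  (cong₂ _+_ (∫-counting-comm ν m _) (∫-counting-comm ν m _))

bernoulli-1 : ∀ p m → ∫ (bernoulli p m) (λ _ → 1ℚ) ≡ 1ℚ
bernoulli-1 p zero    = refl
bernoulli-1 p (suc m) = trans (cong₂ (λ a b → (1ℚ - value p) * a + value p * b) (bernoulli-1 p m) (bernoulli-1 p m))
  (solve 1 (λ r → (con 1ℚ :- r) :* con 1ℚ :+ r :* con 1ℚ := con 1ℚ) refl (value p))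

bernoulli-const : ∀ p m c → ∫ (bernoulli p m) (λ _ → c) ≡ c
bernoulli-const p m c = trans (∫-cong (bernoulli p m) (λ _ → sym (ℚ.*-identityʳ c)))
  (trans (∫-* (bernoulli p m) c _) (trans (cong (c *_) (bernoulli-1 p m)) (ℚ.*-identityʳ c)))

bernoulli-⊇ : ∀ p {m} (T : Subset m) → ∫ (bernoulli p m) (λ W → ⟦ T ⊆? W ⟧) ≡ value p ^ ∣ T ∣
bernoulli-⊇ p {zero}  []            = ⟦⟧-true ([] ⊆? []) (λ x → x)
bernoulli-⊇ p {suc m} (outside ∷ T) = trans
  (cong₂ (λ a b → (1ℚ - value p) * a + value p * b)
    (∫-cong (bernoulli p m) (λ W → ⟦⟧-cong (outside ∷ T ⊆? outside ∷ W) (T ⊆? W) drop-∷-⊆ out⊆))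
    (∫-cong (bernoulli p m) (λ W → ⟦⟧-cong (outside ∷ T ⊆? inside ∷ W) (T ⊆? W) drop-∷-⊆ out⊆)))
  (trans (solve 2 (λ r a → (con 1ℚ :- r) :* a :+ r :* a := a) refl (value p) (∫ (bernoulli p m) (λ W → ⟦ T ⊆? W ⟧))) (bernoulli-⊇ p T))
bernoulli-⊇ p {suc m} (inside ∷ T)  = trans
  (cong₂ (λ a b → (1ℚ - value p) * a + value p * b)
    (∫-≡0 (bernoulli p m) (λ W → ⟦⟧-false (inside ∷ T ⊆? outside ∷ W) (λ h → case (h here))))
    (∫-cong (bernoulli p m) (λ W → ⟦⟧-cong (inside ∷ T ⊆? inside ∷ W) (T ⊆? W) drop-∷-⊆ s⊆s)))
  (trans (solve 2 (λ r a → (con 1ℚ :- r) :* con 0ℚ :+ r :* a := r :* a) refl (value p) (∫ (bernoulli p m) (λ W → ⟦ T ⊆? W ⟧)))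
    (cong (value p *_) (bernoulli-⊇ p T)))
  where
  case : ∀ {m} {W : Subset m} → zero ∉ (outside ∷ W)
  case ()

-- Comparison inequalities for Bernoulli measures

Antitone : ∀ {m} → (Subset m → ℚ) → Set
Antitone f = ∀ {V W} → V ⊆ W → f W ≤ f V

antitone-∷ : ∀ {m s} {f : Subset (suc m) → ℚ} → Antitone f → Antitone (f ∘ (s ∷_))
antitone-∷ anti V⊆W = anti (s⊆s V⊆W)

-- The union contains each point independently with probability r + s - rs, at most t, and an
-- antitone function only grows when the set becomes sparser. The gain in one coordinate is rs(a₀ -
-- a₁).
bernoulli-∪ : ∀ r s t → value t ≡ value r + value s → ∀ m {f : Subset m → ℚ} → Antitone f →
  ∫ (bernoulli t m) f ≤ ∫ (bernoulli r m) (λ V → ∫ (bernoulli s m) (λ W → f (V ∪ W)))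
bernoulli-∪ r s t t≡ zero    anti = ℚ.≤-refl
bernoulli-∪ r s t t≡ (suc m) {f} anti = begin
  (1ℚ - value t) * ∫ (bernoulli t m) f₀ + value t * ∫ (bernoulli t m) f₁
    ≤⟨ ℚ.+-mono-≤ (*-monoˡ-≤ (≤⇒0≤- (p≤1 t)) (bernoulli-∪ r s t t≡ m (antitone-∷ {f = f} anti)))
                  (*-monoˡ-≤ (0≤p t) (bernoulli-∪ r s t t≡ m (antitone-∷ {f = f} anti))) ⟩
  (1ℚ - value t) * a₀ + value t * a₁
    ≡⟨ cong (λ t → (1ℚ - t) * a₀ + t * a₁) t≡ ⟩
  (1ℚ - (ρ + σ)) * a₀ + (ρ + σ) * a₁
    ≤⟨ 0≤-⇒≤ (subst (0ℚ ≤_) (algebra ρ σ a₀ a₁) (*-nonNeg (*-nonNeg (0≤p r) (0≤p s)) (≤⇒0≤- a₁≤a₀))) ⟩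
  (1ℚ - ρ) * ((1ℚ - σ) * a₀ + σ * a₁) + ρ * ((1ℚ - σ) * a₁ + σ * a₁)
    ≡⟨ sym (cong₂ (λ x y → (1ℚ - ρ) * x + ρ * y) (split f₀) (split f₁)) ⟩
  ∫ (bernoulli r (suc m)) (λ V → ∫ (bernoulli s (suc m)) (λ W → f (V ∪ W))) ∎
  where
  open ℚ.≤-Reasoning
  ρ = value r
  σ = value s
  f₀ f₁ : Subset m → ℚ
  f₀ = f ∘ (outside ∷_)
  f₁ = f ∘ (inside ∷_)
  iterated : (Subset m → ℚ) → ℚ
  iterated g = ∫ (bernoulli r m) (λ V → ∫ (bernoulli s m) (λ W → g (V ∪ W)))
  a₀ = iterated f₀
  a₁ = iterated f₁
  a₁≤a₀ : a₁ ≤ a₀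
  a₁≤a₀ = ∫-mono (bernoulli r m) (λ V → ∫-mono (bernoulli s m) (λ W → anti (out⊆ ⊆-refl)))
  split : ∀ g → ∫ (bernoulli r m) (λ V → (1ℚ - σ) * ∫ (bernoulli s m) (λ W → g (V ∪ W))
                                        + σ * ∫ (bernoulli s m) (λ W → f₁ (V ∪ W)))
              ≡ (1ℚ - σ) * iterated g + σ * a₁
  split g = trans (∫-+ (bernoulli r m) _ _) (cong₂ _+_
    (∫-* (bernoulli r m) (1ℚ - σ) (λ V → ∫ (bernoulli s m) (λ W → g (V ∪ W))))
    (∫-* (bernoulli r m) σ (λ V → ∫ (bernoulli s m) (λ W → f₁ (V ∪ W)))))
  algebra : ∀ r s a b → r * s * (a - b) ≡
    ((1ℚ - r) * ((1ℚ - s) * a + s * b) + r * ((1ℚ - s) * b + s * b)) - ((1ℚ - (r + s)) * a + (r + s) * b)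
  algebra = solve 4 (λ r s a b → r :* s :* (a :- b) :=
    ((con 1ℚ :- r) :* ((con 1ℚ :- s) :* a :+ s :* b) :+ r :* ((con 1ℚ :- s) :* b :+ s :* b))
      :- ((con 1ℚ :- (r :+ s)) :* a :+ (r :+ s) :* b)) refl

in⊈out : ∀ {m} {S T : Subset m} → ¬ (inside ∷ S ⊆ outside ∷ T)
in⊈out h with () ← h here

powerset-mono : ∀ {m} (Z : Subset m) {f g : Subset m → ℚ} →
  (∀ T → T ⊆ Z → f T ≤ g T) → ∫ (powerset Z) f ≤ ∫ (powerset Z) g
powerset-mono []            f≤g = f≤g [] (λ x → x)
powerset-mono (outside ∷ Z) f≤g = powerset-mono Z (λ T T⊆Z → f≤g (outside ∷ T) (out⊆ T⊆Z))
powerset-mono (inside ∷ Z)  f≤g = ℚ.+-mono-≤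
  (powerset-mono Z (λ T T⊆Z → f≤g (outside ∷ T) (out⊆ T⊆Z)))
  (powerset-mono Z (λ T T⊆Z → f≤g (inside ∷ T) (s⊆s T⊆Z)))

counting≡powerset : ∀ {m} (Z : Subset m) {f : Subset m → ℚ} →
  (∀ T → ¬ T ⊆ Z → f T ≡ 0ℚ) → ∫ (counting m) f ≡ ∫ (powerset Z) f
counting≡powerset []            f≡0 = refl
counting≡powerset {suc m} (outside ∷ Z) {f} f≡0 = trans
  (cong₂ _+_ (counting≡powerset Z (λ T T⊈Z → f≡0 (outside ∷ T) (T⊈Z ∘ drop-∷-⊆)))
             (∫-≡0 (counting m) (λ T → f≡0 (inside ∷ T) in⊈out)))
  (ℚ.+-identityʳ (∫ (powerset Z) (f ∘ (outside ∷_))))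
counting≡powerset (inside ∷ Z)  f≡0 = cong₂ _+_
  (counting≡powerset Z (λ T T⊈Z → f≡0 (outside ∷ T) (T⊈Z ∘ drop-∷-⊆)))
  (counting≡powerset Z (λ T T⊈Z → f≡0 (inside ∷ T) (T⊈Z ∘ drop-∷-⊆)))

2ℚ : ℚ
2ℚ = 1ℚ + 1ℚ

1≤2 : 1ℚ ≤ 2ℚ
1≤2 = ℚ.≤ᵇ⇒≤ _

powerset-⊆ : ∀ {m} (Z S : Subset m) → ∫ (powerset Z) (λ T → ⟦ T ⊆? S ⟧) ≤ 2ℚ ^ ∣ S ∣
powerset-⊆ []            []      = ⟦⟧-≤1 ([] ⊆? [])
powerset-⊆ (outside ∷ Z) (s ∷ S) = begin
  ∫ (powerset Z) (λ T → ⟦ outside ∷ T ⊆? s ∷ S ⟧)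
    ≤⟨ ∫-mono (powerset Z) (λ T → ⟦⟧-mono (outside ∷ T ⊆? s ∷ S) (T ⊆? S) drop-∷-⊆) ⟩
  ∫ (powerset Z) (λ T → ⟦ T ⊆? S ⟧) ≤⟨ powerset-⊆ Z S ⟩
  2ℚ ^ ∣ S ∣                          ≤⟨ ^-mono-exp 1≤2 (∣p∣≤∣x∷p∣ s S) ⟩
  2ℚ ^ ∣ s ∷ S ∣                      ∎
  where open ℚ.≤-Reasoning
powerset-⊆ (inside ∷ Z) (outside ∷ S) = begin
  ∫ (powerset Z) (λ T → ⟦ outside ∷ T ⊆? outside ∷ S ⟧) + ∫ (powerset Z) (λ T → ⟦ inside ∷ T ⊆? outside ∷ S ⟧)
    ≤⟨ ℚ.+-mono-≤
         (∫-mono (powerset Z) (λ T → ⟦⟧-mono (outside ∷ T ⊆? outside ∷ S) (T ⊆? S) drop-∷-⊆))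
         (ℚ.≤-reflexive (∫-≡0 (powerset Z) (λ T → ⟦⟧-false (inside ∷ T ⊆? outside ∷ S) in⊈out))) ⟩
  ∫ (powerset Z) (λ T → ⟦ T ⊆? S ⟧) + 0ℚ ≡⟨ ℚ.+-identityʳ _ ⟩
  ∫ (powerset Z) (λ T → ⟦ T ⊆? S ⟧)      ≤⟨ powerset-⊆ Z S ⟩
  2ℚ ^ ∣ S ∣                               ∎
  where open ℚ.≤-Reasoning
powerset-⊆ (inside ∷ Z) (inside ∷ S) = begin
  ∫ (powerset Z) (λ T → ⟦ outside ∷ T ⊆? inside ∷ S ⟧) + ∫ (powerset Z) (λ T → ⟦ inside ∷ T ⊆? inside ∷ S ⟧)
    ≤⟨ ℚ.+-mono-≤
         (∫-mono (powerset Z) (λ T → ⟦⟧-mono (outside ∷ T ⊆? inside ∷ S) (T ⊆? S) drop-∷-⊆))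
         (∫-mono (powerset Z) (λ T → ⟦⟧-mono (inside ∷ T ⊆? inside ∷ S) (T ⊆? S) drop-∷-⊆)) ⟩
  ∫ (powerset Z) (λ T → ⟦ T ⊆? S ⟧) + ∫ (powerset Z) (λ T → ⟦ T ⊆? S ⟧)
    ≤⟨ ℚ.+-mono-≤ (powerset-⊆ Z S) (powerset-⊆ Z S) ⟩
  2ℚ ^ ∣ S ∣ + 2ℚ ^ ∣ S ∣ ≡⟨ solve 1 (λ x → x :+ x := con 2ℚ :* x) refl (2ℚ ^ ∣ S ∣) ⟩
  2ℚ * 2ℚ ^ ∣ S ∣       ∎
  where open ℚ.≤-Reasoning

-- Adding T to W multiplies the Bernoulli weight of W by (p / (1 - p)) ^ ∣ T ∣, which is
-- why the sum over disjoint pairs (W , T) is a sum over Z = W ∪ T and T ⊆ Z.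
bernoulli-shift : ∀ p m (ψ : Subset m → Subset m → ℚ) → (∀ W T → 0ℚ ≤ ψ W T) →
  ∫ (bernoulli p m) (λ W → ∫ (powerset (∁ W)) (λ T → value p ^ ∣ T ∣ * ψ W T)) ≤
  ∫ (bernoulli p m) (λ Z → ∫ (powerset Z) (λ T → ψ (Z ─ T) T))
bernoulli-shift p zero    ψ 0≤ψ = ℚ.≤-reflexive (ℚ.*-identityˡ (ψ [] []))
bernoulli-shift p (suc m) ψ 0≤ψ = begin
  (1ℚ - r) * ∫ β (λ W → ∫ (powerset (∁ W)) (λ T → r ^ ∣ T ∣ * ψ₀₀ W T)
                      + ∫ (powerset (∁ W)) (λ T → r * r ^ ∣ T ∣ * ψ₀₁ W T))
    + r * L ψ₁₀
    ≡⟨ cong (λ x → (1ℚ - r) * x + r * L ψ₁₀) (trans (∫-+ β _ _) (cong (_+_ (L ψ₀₀)) pull)) ⟩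
  (1ℚ - r) * (L ψ₀₀ + r * L ψ₀₁) + r * L ψ₁₀
    -- A coordinate of `T` lies outside `W`: it weighs `(1 - r) * r` on the left and `r` on the
    -- right, which leaves the slack `r * r`.
    ≤⟨ 0≤-⇒≤ (subst (0ℚ ≤_) (algebra r (L ψ₀₀) (L ψ₀₁) (L ψ₁₀))
         (*-nonNeg (*-nonNeg (0≤p p) (0≤p p)) (∫-nonNeg β λ W → ∫-nonNeg (powerset (∁ W)) λ T →
            *-nonNeg (^-nonNeg ∣ T ∣ (0≤p p)) (0≤ψ (outside ∷ W) (inside ∷ T))))) ⟩
  (1ℚ - r) * L ψ₀₀ + r * (L ψ₁₀ + L ψ₀₁)
    ≤⟨ ℚ.+-mono-≤ (*-monoˡ-≤ (≤⇒0≤- (p≤1 p)) (bernoulli-shift p m ψ₀₀ (λ W T → 0≤ψ (outside ∷ W) (outside ∷ T))))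
         (*-monoˡ-≤ (0≤p p) (ℚ.+-mono-≤ (bernoulli-shift p m ψ₁₀ (λ W T → 0≤ψ (inside ∷ W) (outside ∷ T)))
                                        (bernoulli-shift p m ψ₀₁ (λ W T → 0≤ψ (outside ∷ W) (inside ∷ T))))) ⟩
  (1ℚ - r) * R ψ₀₀ + r * (R ψ₁₀ + R ψ₀₁)
    ≡⟨ cong (λ x → (1ℚ - r) * R ψ₀₀ + r * x) (sym (∫-+ β _ _)) ⟩
  ∫ (bernoulli p (suc m)) (λ Z → ∫ (powerset Z) (λ T → ψ (Z ─ T) T)) ∎
  where
  open ℚ.≤-Reasoning
  r = value p
  β = bernoulli p m
  ψ₀₀ ψ₀₁ ψ₁₀ : Subset m → Subset m → ℚ
  ψ₀₀ W T = ψ (outside ∷ W) (outside ∷ T)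
  ψ₀₁ W T = ψ (outside ∷ W) (inside ∷ T)
  ψ₁₀ W T = ψ (inside ∷ W) (outside ∷ T)
  L R : (Subset m → Subset m → ℚ) → ℚ
  L φ = ∫ β (λ W → ∫ (powerset (∁ W)) (λ T → r ^ ∣ T ∣ * φ W T))
  R φ = ∫ β (λ Z → ∫ (powerset Z) (λ T → φ (Z ─ T) T))
  pull : ∫ β (λ W → ∫ (powerset (∁ W)) (λ T → r * r ^ ∣ T ∣ * ψ₀₁ W T)) ≡ r * L ψ₀₁
  pull = trans
    (∫-cong β λ W → trans (∫-cong (powerset (∁ W)) (λ T → ℚ.*-assoc r (r ^ ∣ T ∣) (ψ₀₁ W T)))
                          (∫-* (powerset (∁ W)) r (λ T → r ^ ∣ T ∣ * ψ₀₁ W T)))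
    (∫-* β r (λ W → ∫ (powerset (∁ W)) (λ T → r ^ ∣ T ∣ * ψ₀₁ W T)))
  algebra : ∀ r a b c → r * r * b ≡ ((1ℚ - r) * a + r * (c + b)) - ((1ℚ - r) * (a + r * b) + r * c)
  algebra = solve 4 (λ r a b c → r :* r :* b :=
    ((con 1ℚ :- r) :* a :+ r :* (c :+ b)) :- ((con 1ℚ :- r) :* (a :+ r :* b) :+ r :* c)) refl

-- Covers, costs and minimal fragments

Covers : ∀ {m} → Family m → Family m → Set
Covers 𝓖 𝓗 = ∀ {S} → S ∈ᶠ 𝓗 → ∃[ T ] (T ∈ᶠ 𝓖 × T ⊆ S)

cost : ∀ {m} → ℚ → Family m → ℚ
cost {m} q 𝓖 = ∫ (counting m) (λ T → ⟦ member? 𝓖 T ⟧ * q ^ ∣ T ∣)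

Contains : ∀ {m} → Family m → Subset m → Set
Contains 𝓗 W = ∃[ S ] (S ∈ᶠ 𝓗 × S ⊆ W)

contains? : ∀ {m} (𝓗 : Family m) W → Dec (Contains 𝓗 W)
contains? 𝓗 W = anySubset? λ S → member? 𝓗 S ×-dec S ⊆? W

cost-nonNeg : ∀ {m q} → 0ℚ ≤ q → (𝓖 : Family m) → 0ℚ ≤ cost q 𝓖
cost-nonNeg {m} 0≤q 𝓖 = ∫-nonNeg (counting m) λ T → *-nonNeg (⟦⟧-nonNeg (member? 𝓖 T)) (^-nonNeg ∣ T ∣ 0≤q)

infixr 6 _∪ᶠ_
_∪ᶠ_ : ∀ {m} → Family m → Family m → Family m
(𝓐 ∪ᶠ 𝓑) .Member  S = S ∈ᶠ 𝓐 ⊎ S ∈ᶠ 𝓑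
(𝓐 ∪ᶠ 𝓑) .member? S = member? 𝓐 S ⊎-dec member? 𝓑 S

⟦⟧-⊎ : ∀ {P Q : Set} (d : Dec P) (e : Dec Q) → ⟦ d ⊎-dec e ⟧ ≤ ⟦ d ⟧ + ⟦ e ⟧
⟦⟧-⊎ (yes _) e = ℚ.≤-trans (ℚ.≤-reflexive (sym (ℚ.+-identityʳ 1ℚ))) (ℚ.+-monoʳ-≤ 1ℚ (⟦⟧-nonNeg e))
⟦⟧-⊎ (no _)  e = ℚ.≤-reflexive (sym (ℚ.+-identityˡ ⟦ e ⟧))

cost-∪ : ∀ {m q} → 0ℚ ≤ q → (𝓐 𝓑 : Family m) → cost q (𝓐 ∪ᶠ 𝓑) ≤ cost q 𝓐 + cost q 𝓑
cost-∪ {m} {q} 0≤q 𝓐 𝓑 = ℚ.≤-trans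
  (∫-mono (counting m) λ T → ℚ.≤-trans
    (*-monoʳ-≤ (^-nonNeg ∣ T ∣ 0≤q) (⟦⟧-⊎ (member? 𝓐 T) (member? 𝓑 T)))
    (ℚ.≤-reflexive (ℚ.*-distribʳ-+ (q ^ ∣ T ∣) ⟦ member? 𝓐 T ⟧ ⟦ member? 𝓑 T ⟧)))
  (ℚ.≤-reflexive (∫-+ (counting m) _ _))

minimal-below : ∀ {m} (𝓗 : Family m) {S} → S ∈ᶠ 𝓗 → ∃[ T ] (T ∈ᶠ minimal 𝓗 × T ⊆ S)
minimal-below 𝓗 {S} = go S (⊂-wellFounded S)
  where
  go : ∀ S → Acc _⊂_ S → S ∈ᶠ 𝓗 → ∃[ T ] (T ∈ᶠ minimal 𝓗 × T ⊆ S)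
  go S (acc rec) S∈ with anySubset? (λ T → member? 𝓗 T ×-dec T ⊂? S)
  ... | no none = S , (S∈ , none) , ⊆-refl
  ... | yes (T , T∈ , T⊂S) with go T (rec T⊂S) T∈
  ...   | R , R∈ , R⊆T = R , R∈ , ⊆-trans R⊆T (p⊂q⇒p⊆q T⊂S)

minimal-⊆ : ∀ {m} {𝓗 : Family m} {S T} → T ∈ᶠ minimal 𝓗 → S ∈ᶠ 𝓗 → S ⊆ T → T ⊆ S
minimal-⊆ {S = S} (T∈ , none) S∈ S⊆T {x} x∈T with x ∈? S
... | yes x∈S = x∈S
... | no  x∉S = ⊥-elim (none (S , S∈ , S⊆T , x , x∈T , x∉S))

x∈p─q⇒x∉q : ∀ {m} {x : Fin m} p q → x ∈ p ─ q → x ∉ q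
x∈p─q⇒x∉q (s ∷ p) (outside ∷ q) here      ()
x∈p─q⇒x∉q (s ∷ p) (t ∷ q)       (there h) (there x∈q) = x∈p─q⇒x∉q p q h x∈q

residual : ∀ {m} → Family m → Subset m → Family m
residual 𝓗 W .Member  T = ∃[ S ] (S ∈ᶠ 𝓗 × T ≡ S ─ W)
residual 𝓗 W .member? T = anySubset? λ S → member? 𝓗 S ×-dec ≡-dec _≟ᵇ_ T (S ─ W)

-- The Park-Pham fragments, taken minimal for inclusion among the sets `S ─ W`. Large ones are put
-- into the cover and paid for; small ones form the family of the next round.
large small : ∀ {m} → Family m → ℕ → Subset m → Family m
large 𝓗 h W .Member  T = T ∈ᶠ minimal (residual 𝓗 W) × h ℕ.≤ ∣ T ∣
large 𝓗 h W .member? T = member? (minimal (residual 𝓗 W)) T ×-dec h ℕ.≤? ∣ T ∣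
small 𝓗 h W .Member  T = T ∈ᶠ minimal (residual 𝓗 W) × ∣ T ∣ ℕ.< h
small 𝓗 h W .member? T = member? (minimal (residual 𝓗 W)) T ×-dec ∣ T ∣ ℕ.<? h

-- Each `S ─ W` contains a minimal fragment, which is either large, hence itself in the cover, or
-- small, hence above a member of `𝓖`.
large∪-covers : ∀ {m} (𝓗 : Family m) h W {𝓖} → Covers 𝓖 (small 𝓗 h W) → Covers (large 𝓗 h W ∪ᶠ 𝓖) 𝓗
large∪-covers 𝓗 h W cov {S} S∈ with minimal-below (residual 𝓗 W) (S , S∈ , refl)
... | T , T∈ , T⊆S─W with h ℕ.≤? ∣ T ∣
...   | yes h≤ = T , inj₁ (T∈ , h≤) , ⊆-trans T⊆S─W (p─q⊆p S W)
...   | no  h≰ with cov (T∈ , ℕ.≰⇒> h≰)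
...     | R , R∈ , R⊆T = R , inj₂ R∈ , ⊆-trans R⊆T (⊆-trans T⊆S─W (p─q⊆p S W))

fragment-disjoint : ∀ {m} (𝓗 : Family m) h W {T} → T ∈ᶠ large 𝓗 h W → T ⊆ ∁ W
fragment-disjoint 𝓗 h W (((S , _ , refl) , _) , _) x∈ = x∉p⇒x∈∁p (x∈p─q⇒x∉q S W x∈)

-- With W = `Z ─ T`, a fragment `T = S ─ W` comes from an edge inside W ∪ T = Z.
fragment-edge : ∀ {m} (𝓗 : Family m) h Z {T} → T ⊆ Z → T ∈ᶠ large 𝓗 h (Z ─ T) → Contains 𝓗 Z
fragment-edge 𝓗 h Z {T} T⊆Z (((S , S∈ , T≡) , _) , _) = S , S∈ , S⊆Z
  where
  S⊆Z : S ⊆ Z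
  S⊆Z {x} x∈S with x ∈? (Z ─ T)
  ... | yes x∈ = p─q⊆p Z T x∈
  ... | no  x∉ = T⊆Z (subst (x ∈_) (sym T≡) (x∈p∧x∉q⇒x∈p─q x∈S x∉))

-- With W = `Z ─ T`, any edge `S ⊆ Z` leaves `S ─ W ⊆ T`; minimality of `T` makes this an equality,
-- so `T = S ─ W` lies in `S`, whichever edge produced `T`.
fragment-⊆ : ∀ {m} (𝓗 : Family m) h Z {S T} → S ∈ᶠ 𝓗 → S ⊆ Z → T ∈ᶠ large 𝓗 h (Z ─ T) → T ⊆ S
fragment-⊆ 𝓗 h Z {S} {T} S∈ S⊆Z (T∈ , _) =
  ⊆-trans (minimal-⊆ {𝓗 = residual 𝓗 (Z ─ T)} T∈ (S , S∈ , refl) S─⊆T) (p─q⊆p S (Z ─ T))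
  where
  S─⊆T : S ─ (Z ─ T) ⊆ T
  S─⊆T {x} x∈ with x ∈? T
  ... | yes x∈T = x∈T
  ... | no  x∉T = contradiction (x∈p∧x∉q⇒x∈p─q (S⊆Z (p─q⊆p S (Z ─ T) x∈)) x∉T) (x∈p─q⇒x∉q S (Z ─ T) x∈)

-- One edge inside `Z`, chosen independently of `T`, contains all the fragments, so they are among
-- its at most 2^(2h) subsets. If `Z` contains no edge, there are no fragments.
fragments-count : ∀ {m} (𝓗 : Family m) h → (∀ {S} → S ∈ᶠ 𝓗 → ∣ S ∣ ℕ.≤ h ℕ.+ h) → ∀ Z →
  ∫ (powerset Z) (λ T → ⟦ member? (large 𝓗 h (Z ─ T)) T ⟧) ≤ (2ℚ * 2ℚ) ^ h
fragments-count 𝓗 h size Z with contains? 𝓗 Z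
... | no none = ℚ.≤-trans
  (powerset-mono Z {g = λ _ → 0ℚ} (λ T T⊆Z → ℚ.≤-reflexive
    (⟦⟧-false (member? (large 𝓗 h (Z ─ T)) T) (none ∘ fragment-edge 𝓗 h Z T⊆Z))))
  (ℚ.≤-trans (ℚ.≤-reflexive (∫-0 (powerset Z))) (^-nonNeg h (ℚ.≤ᵇ⇒≤ _)))
... | yes (S , S∈ , S⊆Z) = begin
  ∫ (powerset Z) (λ T → ⟦ member? (large 𝓗 h (Z ─ T)) T ⟧)
    ≤⟨ ∫-mono (powerset Z) (λ T → ⟦⟧-mono (member? (large 𝓗 h (Z ─ T)) T) (T ⊆? S) (fragment-⊆ 𝓗 h Z S∈ S⊆Z)) ⟩
  ∫ (powerset Z) (λ T → ⟦ T ⊆? S ⟧) ≤⟨ powerset-⊆ Z S ⟩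
  2ℚ ^ ∣ S ∣                         ≤⟨ ^-mono-exp 1≤2 (size S∈) ⟩
  2ℚ ^ (h ℕ.+ h)                     ≡⟨ ^-distrib-+ 2ℚ h h ⟩
  2ℚ ^ h * 2ℚ ^ h                    ≡⟨ sym (^-distrib-* 2ℚ 2ℚ h) ⟩
  (2ℚ * 2ℚ) ^ h                      ∎
  where open ℚ.≤-Reasoning

1/64 1/16 1/8 : ℚ
1/64 = 1/1+ 63
1/16 = 1/1+ 15
1/8  = 1/1+ 7

0≤1/64 : 0ℚ ≤ 1/64
0≤1/64 = ℚ.≤ᵇ⇒≤ _

-- A large fragment has at least h points, so the factor 1/64 in the rate gains 64^-h; against the
-- 4^h fragments of each `Z` this leaves 16^-h.
expected-cost : ∀ p {m} (𝓗 : Family m) h → (∀ {S} → S ∈ᶠ 𝓗 → ∣ S ∣ ℕ.≤ h ℕ.+ h) →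
  ∫ (bernoulli p m) (λ W → cost (1/64 * value p) (large 𝓗 h W)) ≤ 1/16 ^ h
expected-cost p {m} 𝓗 h size = begin
  ∫ β (λ W → cost (1/64 * r) (large 𝓗 h W))
    ≤⟨ ∫-mono β (λ W → ℚ.≤-trans
         (ℚ.≤-reflexive (counting≡powerset (∁ W) (λ T T⊈ → trans
           (cong (_* (1/64 * r) ^ ∣ T ∣) (⟦⟧-false (member? (large 𝓗 h W) T) (λ T∈ → T⊈ (fragment-disjoint 𝓗 h W T∈))))
           (ℚ.*-zeroˡ ((1/64 * r) ^ ∣ T ∣)))))
         (∫-mono (powerset (∁ W)) (λ T → term W T (member? (large 𝓗 h W) T)))) ⟩
  ∫ β (λ W → ∫ (powerset (∁ W)) (λ T → 1/64 ^ h * (r ^ ∣ T ∣ * ⟦ member? (large 𝓗 h W) T ⟧)))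
    ≡⟨ trans (∫-cong β (λ W → ∫-* (powerset (∁ W)) (1/64 ^ h) (λ T → r ^ ∣ T ∣ * ⟦ member? (large 𝓗 h W) T ⟧)))
             (∫-* β (1/64 ^ h) (λ W → ∫ (powerset (∁ W)) (λ T → r ^ ∣ T ∣ * ⟦ member? (large 𝓗 h W) T ⟧))) ⟩
  1/64 ^ h * ∫ β (λ W → ∫ (powerset (∁ W)) (λ T → r ^ ∣ T ∣ * ⟦ member? (large 𝓗 h W) T ⟧))
    ≤⟨ *-monoˡ-≤ (^-nonNeg h 0≤1/64) (bernoulli-shift p m (λ W T → ⟦ member? (large 𝓗 h W) T ⟧)
         (λ W T → ⟦⟧-nonNeg (member? (large 𝓗 h W) T))) ⟩
  1/64 ^ h * ∫ β (λ Z → ∫ (powerset Z) (λ T → ⟦ member? (large 𝓗 h (Z ─ T)) T ⟧))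
    ≤⟨ *-monoˡ-≤ (^-nonNeg h 0≤1/64) (∫-mono β (fragments-count 𝓗 h size)) ⟩
  1/64 ^ h * ∫ β (λ _ → (2ℚ * 2ℚ) ^ h)
    ≡⟨ cong (1/64 ^ h *_) (bernoulli-const p m ((2ℚ * 2ℚ) ^ h)) ⟩
  1/64 ^ h * (2ℚ * 2ℚ) ^ h
    ≡⟨ sym (^-distrib-* 1/64 (2ℚ * 2ℚ) h) ⟩
  1/16 ^ h ∎
  where
  open ℚ.≤-Reasoning
  r = value p
  β = bernoulli p m
  term : ∀ W T (d : Dec (T ∈ᶠ large 𝓗 h W)) → ⟦ d ⟧ * (1/64 * r) ^ ∣ T ∣ ≤ 1/64 ^ h * (r ^ ∣ T ∣ * ⟦ d ⟧)
  term W T (no _) = ℚ.≤-reflexive (solve 3 (λ x y z → con 0ℚ :* x := y :* (z :* con 0ℚ)) refl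
    ((1/64 * r) ^ ∣ T ∣) (1/64 ^ h) (r ^ ∣ T ∣))
  term W T (yes (_ , h≤)) = begin
    1ℚ * (1/64 * r) ^ ∣ T ∣      ≡⟨ ℚ.*-identityˡ _ ⟩
    (1/64 * r) ^ ∣ T ∣           ≡⟨ ^-distrib-* 1/64 r ∣ T ∣ ⟩
    1/64 ^ ∣ T ∣ * r ^ ∣ T ∣     ≤⟨ *-monoʳ-≤ (^-nonNeg ∣ T ∣ (0≤p p)) (^-anti 0≤1/64 (ℚ.≤ᵇ⇒≤ _) h≤) ⟩
    1/64 ^ h * r ^ ∣ T ∣         ≡⟨ cong (1/64 ^ h *_) (sym (ℚ.*-identityʳ (r ^ ∣ T ∣))) ⟩
    1/64 ^ h * (r ^ ∣ T ∣ * 1ℚ)  ∎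

-- The Park-Pham iteration

fails : ∀ {m} → Family m → Subset m → ℚ
fails 𝓗 W = ⟦ ¬? (contains? 𝓗 W) ⟧

fails-antitone : ∀ {m} (𝓗 : Family m) → Antitone (fails 𝓗)
fails-antitone 𝓗 {V} {W} V⊆W = ⟦⟧-mono (¬? (contains? 𝓗 W)) (¬? (contains? 𝓗 V))
  λ none (S , S∈ , S⊆V) → none (S , S∈ , ⊆-trans S⊆V V⊆W)

-- A small fragment `S ─ V` found inside `W` is completed by `V` to the edge `S`, so failure for the
-- union forces failure for the fragments.
fails-∪ : ∀ {m} (𝓗 : Family m) h V W → fails 𝓗 (V ∪ W) ≤ fails (small 𝓗 h V) W
fails-∪ 𝓗 h V W = ⟦⟧-mono (¬? (contains? 𝓗 (V ∪ W))) (¬? (contains? (small 𝓗 h V) W)) λ none contains →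
  none (complete contains)
  where
  complete : Contains (small 𝓗 h V) W → Contains 𝓗 (V ∪ W)
  complete (T , (((S , S∈ , T≡) , _) , _) , T⊆W) = S , S∈ , S⊆
    where
    S⊆ : S ⊆ V ∪ W
    S⊆ {x} x∈S with x ∈? V
    ... | yes x∈V = p⊆p∪q W x∈V
    ... | no  x∉V = q⊆p∪q V W (T⊆W (subst (x ∈_) (sym T≡) (x∈p∧x∉q⇒x∈p─q x∈S x∉V)))

∅ᶠ : ∀ {m} → Family m
∅ᶠ .Member  S = ⊥
∅ᶠ .member? S = no (λ ())

cost-∅ : ∀ {m} q → cost {m} q ∅ᶠ ≡ 0ℚ
cost-∅ {m} q = ∫-≡0 (counting m) (λ T → ℚ.*-zeroˡ (q ^ ∣ T ∣))

fromℕ-nonNeg : ∀ n → 0ℚ ≤ fromℕ n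
fromℕ-nonNeg n = ℚ.nonNegative⁻¹ (fromℕ n) {{ℚ.normalize-nonNeg n 1}}

½^-nonNeg : ∀ j → 0ℚ ≤ ½ ^ j
½^-nonNeg j = ^-nonNeg j (ℚ.≤ᵇ⇒≤ _)

0≤failBound : ∀ j → 0ℚ ≤ 1/8 * (1ℚ - ½ ^ j)
0≤failBound j = *-nonNeg {1/8} (ℚ.≤ᵇ⇒≤ _) (≤⇒0≤- (^-≤1 {½} j (ℚ.≤ᵇ⇒≤ _) (ℚ.≤ᵇ⇒≤ _)))

-- Since 2^j ≥ j + 1, the losses of the rounds are dominated by a geometric series with sum 1/8.
1/16^2^ : ∀ j → 1/16 ^ (2 ℕ.^ j) ≤ 1/16 * ½ ^ j
1/16^2^ j = ℚ.≤-trans (^-anti {1/16} (ℚ.≤ᵇ⇒≤ _) (ℚ.≤ᵇ⇒≤ _) (1+j≤2^j j))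
  (*-monoˡ-≤ {c = 1/16} (ℚ.≤ᵇ⇒≤ _) (^-mono {1/16} {½} j (ℚ.≤ᵇ⇒≤ _) (ℚ.≤ᵇ⇒≤ _)))
  where
  1+j≤2^j : ∀ j → suc j ℕ.≤ 2 ℕ.^ j
  1+j≤2^j zero    = ℕ.≤-refl
  1+j≤2^j (suc j) = ℕ.+-mono-≤ (ℕ.m^n>0 2 j) (subst (suc j ℕ.≤_) (sym (ℕ.+-identityʳ (2 ℕ.^ j))) (1+j≤2^j j))

-- The Park–Pham theorem: exposing j Bernoulli(p₀) sets, each of which either halves the
-- size of the minimal fragments or pays for a cover of the large ones.
park-pham : ∀ j p₀ p → value p ≡ fromℕ j * value p₀ → ∀ {m} (𝓗 : Family m) →
  (∀ {S} → S ∈ᶠ 𝓗 → ∣ S ∣ ℕ.< 2 ℕ.^ j) →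
  ∀ c → (∀ 𝓖 → Covers 𝓖 𝓗 → c ≤ cost (1/64 * value p₀) 𝓖) →
  c * ∫ (bernoulli p m) (fails 𝓗) ≤ 1/8 * (1ℚ - ½ ^ j)
-- The recursion subtracts fragment costs from `c`, which may turn negative; the bound is then
-- trivial.
park-pham j p₀ p p≡ {m} 𝓗 size c cheap with ℚ.≤-total c 0ℚ
... | inj₁ c≤0 = begin
  c * ∫ (bernoulli p m) (fails 𝓗)  ≤⟨ *-monoʳ-≤ (∫-nonNeg (bernoulli p m) (λ W → ⟦⟧-nonNeg (¬? (contains? 𝓗 W)))) c≤0 ⟩
  0ℚ * ∫ (bernoulli p m) (fails 𝓗) ≡⟨ ℚ.*-zeroˡ (∫ (bernoulli p m) (fails 𝓗)) ⟩
  0ℚ                               ≤⟨ 0≤failBound j ⟩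
  1/8 * (1ℚ - ½ ^ j)               ∎
  where open ℚ.≤-Reasoning
-- Every edge now has size 0. If there is one, it lies in every set and failure is impossible; if
-- there is none, the empty family is a cover of cost 0 and forces `c` to be 0.
park-pham zero p₀ p p≡ {m} 𝓗 size c cheap | inj₂ 0≤c with contains? 𝓗 ∅

... | yes (S , S∈ , S⊆∅) = ℚ.≤-reflexive (trans
  (cong (c *_) (∫-≡0 (bernoulli p m) (λ W → ⟦⟧-false (¬? (contains? 𝓗 W)) (λ none → none (S , S∈ , ⊆-trans S⊆∅ ⊥⊆)))))
  (ℚ.*-zeroʳ c))
... | no none = subst (λ c → c * ∫ (bernoulli p m) (fails 𝓗) ≤ 1/8 * (1ℚ - ½ ^ 0)) 0≡c
  (ℚ.≤-reflexive (ℚ.*-zeroˡ (∫ (bernoulli p m) (fails 𝓗))))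
  where
  empty : ∀ {m} (S : Subset m) → ∣ S ∣ ℕ.< 1 → S ⊆ ∅
  empty (outside ∷ S) h = s⊆s (empty S h)
  empty (inside ∷ S)  (ℕ.s≤s ())
  0≡c : 0ℚ ≡ c
  0≡c = ℚ.≤-antisym 0≤c (subst (c ≤_) (cost-∅ {m} (1/64 * value p₀))
    (cheap ∅ᶠ (λ {S} S∈ → ⊥-elim (none (S , S∈ , empty S (size S∈))))))
park-pham (suc j) p₀ p p≡ {m} 𝓗 size c cheap | inj₂ 0≤c = begin
  c * ∫ (bernoulli p m) (fails 𝓗)
    ≤⟨ *-monoˡ-≤ 0≤c (bernoulli-∪ p₀ s p p≡p₀+s m (fails-antitone 𝓗)) ⟩
  c * ∫ β (λ V → ∫ (bernoulli s m) (λ W → fails 𝓗 (V ∪ W)))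
    ≤⟨ *-monoˡ-≤ 0≤c (∫-mono β (λ V → ∫-mono (bernoulli s m) (fails-∪ 𝓗 h V))) ⟩
  c * ∫ β φ
    ≡⟨ sym (∫-* β c φ) ⟩
  ∫ β (λ V → c * φ V)
    ≤⟨ ∫-mono β step ⟩
  ∫ β (λ V → 1/8 * (1ℚ - ½ ^ j) + u V)
    ≡⟨ trans (∫-+ β (λ _ → 1/8 * (1ℚ - ½ ^ j)) u) (cong (_+ ∫ β u) (bernoulli-const p₀ m (1/8 * (1ℚ - ½ ^ j)))) ⟩
  1/8 * (1ℚ - ½ ^ j) + ∫ β u
    ≤⟨ ℚ.+-monoʳ-≤ (1/8 * (1ℚ - ½ ^ j)) (ℚ.≤-trans (expected-cost p₀ 𝓗 h size≤) (1/16^2^ j)) ⟩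
  1/8 * (1ℚ - ½ ^ j) + 1/16 * ½ ^ j
    ≡⟨ solve 1 (λ x → con 1/8 :* (con 1ℚ :- x) :+ con 1/16 :* x := con 1/8 :* (con 1ℚ :- con ½ :* x)) refl (½ ^ j) ⟩
  1/8 * (1ℚ - ½ ^ suc j) ∎
  where
  open ℚ.≤-Reasoning
  h = 2 ℕ.^ j
  β = bernoulli p₀ m
  p≡′ : value p ≡ value p₀ + fromℕ j * value p₀
  p≡′ = trans p≡ (fromℕ-suc-* j (value p₀))
  s : Probability
  s = prob (fromℕ j * value p₀) (*-nonNeg (fromℕ-nonNeg j) (0≤p p₀))
    (ℚ.≤-trans (subst₂ _≤_ (ℚ.+-identityˡ (fromℕ j * value p₀)) (sym p≡′)
      (ℚ.+-monoˡ-≤ (fromℕ j * value p₀) (0≤p p₀))) (p≤1 p))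
  p≡p₀+s : value p ≡ value p₀ + value s
  p≡p₀+s = p≡′
  φ u : Subset m → ℚ
  φ V = ∫ (bernoulli s m) (fails (small 𝓗 h V))
  u V = cost (1/64 * value p₀) (large 𝓗 h V)
  0≤q : 0ℚ ≤ 1/64 * value p₀
  0≤q = *-nonNeg 0≤1/64 (0≤p p₀)
  φ≤1 : ∀ V → φ V ≤ 1ℚ
  φ≤1 V = subst (φ V ≤_) (bernoulli-1 s m) (∫-mono (bernoulli s m) (λ W → ⟦⟧-≤1 (¬? (contains? (small 𝓗 h V) W))))
  size≤ : ∀ {S} → S ∈ᶠ 𝓗 → ∣ S ∣ ℕ.≤ h ℕ.+ h
  size≤ {S} S∈ = ℕ.<⇒≤ (subst (λ z → ∣ S ∣ ℕ.< h ℕ.+ z) (ℕ.+-identityʳ h) (size S∈))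
  cheap′ : ∀ V 𝓖 → Covers 𝓖 (small 𝓗 h V) → c - u V ≤ cost (1/64 * value p₀) 𝓖
  cheap′ V 𝓖 cov = subst (c - u V ≤_)
    (solve 2 (λ u g → u :+ g :- u := g) refl (u V) (cost (1/64 * value p₀) 𝓖))
    (ℚ.+-monoˡ-≤ (- u V) (ℚ.≤-trans (cheap (large 𝓗 h V ∪ᶠ 𝓖) (large∪-covers 𝓗 h V {𝓖} cov))
                                      (cost-∪ 0≤q (large 𝓗 h V) 𝓖)))
  -- The budget splits as `(c - u V) + u V`: the first part is a valid budget for the small
  -- fragments, and the second is bounded using `φ V ≤ 1`.
  step : ∀ V → c * φ V ≤ 1/8 * (1ℚ - ½ ^ j) + u V
  step V = subst (_≤ 1/8 * (1ℚ - ½ ^ j) + u V)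
    (solve 3 (λ c u φ → (c :- u) :* φ :+ u :* φ := c :* φ) refl c (u V) (φ V))
    (ℚ.+-mono-≤ (park-pham j p₀ s refl (small 𝓗 h V) proj₂ (c - u V) (cheap′ V))
      (subst (u V * φ V ≤_) (ℚ.*-identityʳ (u V))
        (*-monoˡ-≤ (cost-nonNeg 0≤q (large 𝓗 h V)) (φ≤1 V))))

-- Images of subsets under maps

module _ {m j : ℕ} (f : Fin m → Fin j) where

  image⁺ : ∀ {S e} → e ∈ S → f e ∈ image f S
  image⁺ {S} {e} e∈S = lookup⇒[]= (f e) (image f S)
    (trans (lookup∘tabulate _ (f e)) (dec-true (Fin.any? λ e′ → (e′ ∈? S) ×-dec (f e′ Fin.≟ f e)) (e , e∈S , refl)))

  image⁻ : ∀ {S x} → x ∈ image f S → ∃[ e ] (e ∈ S × f e ≡ x)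
  image⁻ {S} {x} x∈ with Fin.any? (λ e → (e ∈? S) ×-dec (f e Fin.≟ x))
                       | trans (sym (lookup∘tabulate (λ x → does (Fin.any? λ e → (e ∈? S) ×-dec (f e Fin.≟ x))) x)) ([]=⇒lookup x∈)
  ... | yes found | _ = found

  image-mono : ∀ {S T} → S ⊆ T → image f S ⊆ image f T
  image-mono S⊆T x∈ with e , e∈S , refl ← image⁻ x∈ = image⁺ (S⊆T e∈S)

  distinctOn-⊆ : ∀ {S T} → S ⊆ T → DistinctOn f T → DistinctOn f S
  distinctOn-⊆ S⊆T distinct e e′ e∈ e′∈ = distinct e e′ (S⊆T e∈) (S⊆T e′∈)

∣S∣≤∣image∣ : ∀ {m j} (f : Fin m → Fin j) S → DistinctOn f S → ∣ S ∣ ℕ.≤ ∣ image f S ∣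
∣S∣≤∣image∣ f []            distinct = ℕ.z≤n
∣S∣≤∣image∣ f (outside ∷ S) distinct = ℕ.≤-trans (∣S∣≤∣image∣ (f ∘ suc) S λ e e′ e∈ e′∈ eq → Fin.suc-injective (distinct (suc e) (suc e′) (there e∈) (there e′∈) eq))
  (p⊆q⇒∣p∣≤∣q∣ (λ x∈ → image-∷ x∈))
  where
  image-∷ : ∀ {x} → x ∈ image (f ∘ suc) S → x ∈ image f (outside ∷ S)
  image-∷ x∈ with e , e∈S , refl ← image⁻ (f ∘ suc) x∈ = image⁺ f {outside ∷ S} (there e∈S)
∣S∣≤∣image∣ f (inside ∷ S)  distinct = ℕ.≤-trans (ℕ.s≤s (∣S∣≤∣image∣ (f ∘ suc) S λ e e′ e∈ e′∈ eq → Fin.suc-injective (distinct (suc e) (suc e′) (there e∈) (there e′∈) eq)))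
  (p⊂q⇒∣p∣<∣q∣ ((λ x∈ → image-∷ x∈) , f zero , image⁺ f here , fresh))
  where
  image-∷ : ∀ {x} → x ∈ image (f ∘ suc) S → x ∈ image f (inside ∷ S)
  image-∷ x∈ with e , e∈S , refl ← image⁻ (f ∘ suc) x∈ = image⁺ f {inside ∷ S} (there e∈S)
  fresh : f zero ∉ image (f ∘ suc) S
  fresh x∈ with e , e∈S , eq ← image⁻ (f ∘ suc) x∈ with () ← distinct (suc e) zero (there e∈S) here eq

subsingleton⇒∣S∣≤1 : ∀ {k} {S : Subset k} → (∀ i i′ → i ∈ S → i′ ∈ S → i ≡ i′) → ∣ S ∣ ℕ.≤ 1
subsingleton⇒∣S∣≤1 {S = S} sub = ℕ.≤-trans
  (∣S∣≤∣image∣ {j = 1} (λ _ → zero) S (λ i i′ i∈ i′∈ _ → sub i i′ i∈ i′∈)) (∣p∣≤n (image {j = 1} (λ _ → zero) S))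

-- Subsets of (suc n) × k as T ++ R, with T the colours of the first point

data Block k m : Fin (k ℕ.+ m) → Set where
  left  : ∀ i → Block k m (i ↑ˡ m)
  right : ∀ e → Block k m (k ↑ʳ e)

block : ∀ k m e → Block k m e
block k m e with splitAt k e | Fin.join-splitAt k m e
... | inj₁ i | refl = left i
... | inj₂ e | refl = right e

module _ {k m : ℕ} where

  ∈-++⁺ˡ : ∀ {T : Subset k} {R : Subset m} {i} → i ∈ T → i ↑ˡ m ∈ T ++ R
  ∈-++⁺ˡ {T} {R} {i} i∈ = lookup⇒[]= (i ↑ˡ m) (T ++ R) (trans (lookup-++ˡ T R i) ([]=⇒lookup i∈))

  ∈-++⁺ʳ : ∀ (T : Subset k) {R : Subset m} {e} → e ∈ R → k ↑ʳ e ∈ T ++ R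
  ∈-++⁺ʳ T {R} {e} e∈ = lookup⇒[]= (k ↑ʳ e) (T ++ R) (trans (lookup-++ʳ T R e) ([]=⇒lookup e∈))

  ∈-++⁻ˡ : ∀ {T : Subset k} {R : Subset m} {i} → i ↑ˡ m ∈ T ++ R → i ∈ T
  ∈-++⁻ˡ {T} {R} {i} i∈ = lookup⇒[]= i T (trans (sym (lookup-++ˡ T R i)) ([]=⇒lookup i∈))

  ∈-++⁻ʳ : ∀ (T : Subset k) {R : Subset m} {e} → k ↑ʳ e ∈ T ++ R → e ∈ R
  ∈-++⁻ʳ T {R} {e} e∈ = lookup⇒[]= e R (trans (sym (lookup-++ʳ T R e)) ([]=⇒lookup e∈))

  ++-⊆⁺ : ∀ {T U : Subset k} {R S : Subset m} → T ⊆ U → R ⊆ S → T ++ R ⊆ U ++ S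
  ++-⊆⁺ {T} {U} T⊆U R⊆S {e} e∈ with block k m e
  ... | left i  = ∈-++⁺ˡ (T⊆U (∈-++⁻ˡ {T} e∈))
  ... | right e = ∈-++⁺ʳ U (R⊆S (∈-++⁻ʳ T e∈))

  ++-⊆⁻ˡ : ∀ {T U : Subset k} {R S : Subset m} → T ++ R ⊆ U ++ S → T ⊆ U
  ++-⊆⁻ˡ {T} {U} h i∈ = ∈-++⁻ˡ {U} (h (∈-++⁺ˡ i∈))

  ++-⊆⁻ʳ : ∀ (T U : Subset k) {R S : Subset m} → T ++ R ⊆ U ++ S → R ⊆ S
  ++-⊆⁻ʳ T U h e∈ = ∈-++⁻ʳ U (h (∈-++⁺ʳ T e∈))

∣++∣ : ∀ {k m} (T : Subset k) (R : Subset m) → ∣ T ++ R ∣ ≡ ∣ T ∣ ℕ.+ ∣ R ∣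
∣++∣ []            R = refl
∣++∣ (outside ∷ T) R = ∣++∣ T R
∣++∣ (inside ∷ T)  R = cong suc (∣++∣ T R)

module _ (n k : ℕ) where

  point-left : ∀ i → point (suc n) k (i ↑ˡ (n ℕ.* k)) ≡ zero
  point-left i rewrite Fin.splitAt-↑ˡ k i (n ℕ.* k) = refl

  point-right : ∀ e → point (suc n) k (k ↑ʳ e) ≡ suc (point n k e)
  point-right e rewrite Fin.splitAt-↑ʳ k (n ℕ.* k) e = refl

  colour-left : ∀ i → colour (suc n) k (i ↑ˡ (n ℕ.* k)) ≡ i
  colour-left i rewrite Fin.splitAt-↑ˡ k i (n ℕ.* k) = refl

  colour-right : ∀ e → colour (suc n) k (k ↑ʳ e) ≡ colour n k e
  colour-right e rewrite Fin.splitAt-↑ʳ k (n ℕ.* k) e = refl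

  distinct-point⁺ : ∀ {T : Subset k} {R} → (∀ i i′ → i ∈ T → i′ ∈ T → i ≡ i′) →
    DistinctOn (point n k) R → DistinctOn (point (suc n) k) (T ++ R)
  distinct-point⁺ {T} sub distinct e e′ e∈ e′∈ eq with block k (n ℕ.* k) e | block k (n ℕ.* k) e′
  ... | left i  | left i′  = cong (_↑ˡ (n ℕ.* k)) (sub i i′ (∈-++⁻ˡ {T = T} e∈) (∈-++⁻ˡ {T = T} e′∈))
  ... | left i  | right e′ with () ← trans (sym (point-left i)) (trans eq (point-right e′))
  ... | right e | left i′  with () ← trans (sym (point-left i′)) (trans (sym eq) (point-right e))
  ... | right e | right e′ = cong (k ↑ʳ_) (distinct e e′ (∈-++⁻ʳ T e∈) (∈-++⁻ʳ T e′∈)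
    (Fin.suc-injective (trans (sym (point-right e)) (trans eq (point-right e′)))))

  distinct-point⁻ˡ : ∀ {T : Subset k} {R} → DistinctOn (point (suc n) k) (T ++ R) → ∀ i i′ → i ∈ T → i′ ∈ T → i ≡ i′
  distinct-point⁻ˡ distinct i i′ i∈ i′∈ = Fin.↑ˡ-injective (n ℕ.* k) i i′
    (distinct (i ↑ˡ _) (i′ ↑ˡ _) (∈-++⁺ˡ i∈) (∈-++⁺ˡ i′∈) (trans (point-left i) (sym (point-left i′))))

  distinct-point⁻ʳ : ∀ (T : Subset k) {R} → DistinctOn (point (suc n) k) (T ++ R) → DistinctOn (point n k) R
  distinct-point⁻ʳ T distinct e e′ e∈ e′∈ eq = Fin.↑ʳ-injective k e e′
    (distinct (k ↑ʳ e) (k ↑ʳ e′) (∈-++⁺ʳ T e∈) (∈-++⁺ʳ T e′∈)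
      (trans (point-right e) (trans (cong suc eq) (sym (point-right e′)))))

  image-point-∅ : ∀ R → image (point (suc n) k) (∅ ++ R) ≡ outside ∷ image (point n k) R
  image-point-∅ R = ⊆-antisym ⇒ ⇐
    where
    ⇒ : image (point (suc n) k) (∅ ++ R) ⊆ outside ∷ image (point n k) R
    ⇒ x∈ with e , e∈ , refl ← image⁻ (point (suc n) k) x∈ with block k (n ℕ.* k) e
    ... | left i  = ⊥-elim (∉⊥ (∈-++⁻ˡ {T = ∅} e∈))
    ... | right e rewrite point-right e = there (image⁺ (point n k) (∈-++⁻ʳ ∅ e∈))
    ⇐ : outside ∷ image (point n k) R ⊆ image (point (suc n) k) (∅ ++ R)
    ⇐ (there x∈) with e , e∈ , refl ← image⁻ (point n k) x∈ =
      subst (_∈ image (point (suc n) k) (∅ ++ R)) (point-right e) (image⁺ (point (suc n) k) (∈-++⁺ʳ ∅ e∈))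

  image-point-⁅⁆ : ∀ i R → image (point (suc n) k) (⁅ i ⁆ ++ R) ≡ inside ∷ image (point n k) R
  image-point-⁅⁆ i R = ⊆-antisym ⇒ ⇐
    where
    ⇒ : image (point (suc n) k) (⁅ i ⁆ ++ R) ⊆ inside ∷ image (point n k) R
    ⇒ x∈ with e , e∈ , refl ← image⁻ (point (suc n) k) x∈ with block k (n ℕ.* k) e
    ... | left i  rewrite point-left i = here
    ... | right e rewrite point-right e = there (image⁺ (point n k) (∈-++⁻ʳ ⁅ i ⁆ e∈))
    ⇐ : inside ∷ image (point n k) R ⊆ image (point (suc n) k) (⁅ i ⁆ ++ R)
    ⇐ here       = subst (_∈ image (point (suc n) k) (⁅ i ⁆ ++ R)) (point-left i) (image⁺ (point (suc n) k) (∈-++⁺ˡ (x∈⁅x⁆ i)))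
    ⇐ (there x∈) with e , e∈ , refl ← image⁻ (point n k) x∈ =
      subst (_∈ image (point (suc n) k) (⁅ i ⁆ ++ R)) (point-right e) (image⁺ (point (suc n) k) (∈-++⁺ʳ ⁅ i ⁆ e∈))

-- Measures on blocks and on sets of colours

counting-++ : ∀ k {m} (f : Subset (k ℕ.+ m) → ℚ) →
  ∫ (counting (k ℕ.+ m)) f ≡ ∫ (counting k) (λ T → ∫ (counting m) (λ R → f (T ++ R)))
counting-++ zero    f = refl
counting-++ (suc k) f = cong₂ _+_ (counting-++ k (f ∘ (outside ∷_))) (counting-++ k (f ∘ (inside ∷_)))

bernoulli-++ : ∀ p k {m} (f : Subset (k ℕ.+ m) → ℚ) →
  ∫ (bernoulli p (k ℕ.+ m)) f ≡ ∫ (bernoulli p k) (λ T → ∫ (bernoulli p m) (λ R → f (T ++ R)))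
bernoulli-++ p zero    f = refl
bernoulli-++ p (suc k) f = cong₂ (λ a b → (1ℚ - value p) * a + value p * b)
  (bernoulli-++ p k (f ∘ (outside ∷_))) (bernoulli-++ p k (f ∘ (inside ∷_)))

elements : ∀ {k} → Subset k → Measure (Fin k)
elements []            = 0ᵐ
elements (outside ∷ A) = pushforward suc (elements A)
elements (inside ∷ A)  = dirac zero ⊕ pushforward suc (elements A)

elements-mono : ∀ {k} (A : Subset k) {f g} → (∀ i → i ∈ A → f i ≤ g i) → ∫ (elements A) f ≤ ∫ (elements A) g
elements-mono []            f≤g = ℚ.≤-refl
elements-mono (outside ∷ A) f≤g = elements-mono A (λ i i∈ → f≤g (suc i) (there i∈))
elements-mono (inside ∷ A)  f≤g = ℚ.+-mono-≤ (f≤g zero here) (elements-mono A (λ i i∈ → f≤g (suc i) (there i∈)))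

elements-≥ : ∀ {k} (A : Subset k) {f} → (∀ i → 0ℚ ≤ f i) → ∀ {i} → i ∈ A → f i ≤ ∫ (elements A) f
elements-≥ (inside ∷ A) {f} 0≤f here = subst (_≤ ∫ (elements (inside ∷ A)) f) (ℚ.+-identityʳ (f zero))
  (ℚ.+-monoʳ-≤ (f zero) (∫-nonNeg (elements A) (0≤f ∘ suc)))
elements-≥ (outside ∷ A) 0≤f (there i∈) = elements-≥ A (0≤f ∘ suc) i∈
elements-≥ (inside ∷ A) {f} 0≤f {suc i} (there i∈) = subst (_≤ ∫ (elements (inside ∷ A)) f) (ℚ.+-identityˡ (f (suc i)))
  (ℚ.+-mono-≤ (0≤f zero) (elements-≥ A (0≤f ∘ suc) i∈))

elements-const : ∀ {k} (A : Subset k) c → ∫ (elements A) (λ _ → c) ≡ fromℕ ∣ A ∣ * c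
elements-const []            c = sym (ℚ.*-zeroˡ c)
elements-const (outside ∷ A) c = elements-const A c
elements-const (inside ∷ A)  c = trans (cong (c +_) (elements-const A c)) (sym (fromℕ-suc-* ∣ A ∣ c))

elements-⊤-const : ∀ k c → ∫ (elements (⊤ {k})) (λ _ → c) ≡ fromℕ k * c
elements-⊤-const k c = trans (elements-const (⊤ {k}) c) (cong (λ z → fromℕ z * c) (∣⊤∣≡n k))

∫-elements-comm : ∀ {B} (ν : Measure B) {k} (A : Subset k) (f : B → Fin k → ℚ) →
  ∫ ν (λ x → ∫ (elements A) (f x)) ≡ ∫ (elements A) (λ i → ∫ ν (λ x → f x i))
∫-elements-comm ν []            f = ∫-0 ν
∫-elements-comm ν (outside ∷ A) f = ∫-elements-comm ν A (λ x → f x ∘ suc)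
∫-elements-comm ν (inside ∷ A)  f = trans (∫-+ ν _ _)
  (cong (∫ ν (λ x → f x zero) +_) (∫-elements-comm ν A (λ x → f x ∘ suc)))

-- Linearity of expectation: each element belongs to `T` with probability p.
bernoulli-elements : ∀ p k (f : Fin k → ℚ) →
  ∫ (bernoulli p k) (λ T → ∫ (elements T) f) ≡ value p * ∫ (elements ⊤) f
bernoulli-elements p zero    f = sym (ℚ.*-zeroʳ (value p))
bernoulli-elements p (suc k) f = begin
  (1ℚ - r) * x + r * ∫ (bernoulli p k) (λ T → f zero + ∫ (elements T) (f ∘ suc))
    ≡⟨ cong (λ y → (1ℚ - r) * x + r * y) (trans (∫-+ (bernoulli p k) (λ _ → f zero) _) (cong (_+ x) (bernoulli-const p k (f zero)))) ⟩
  (1ℚ - r) * x + r * (f zero + x)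
    ≡⟨ solve 3 (λ r x y → (con 1ℚ :- r) :* x :+ r :* (y :+ x) := r :* y :+ x) refl r x (f zero) ⟩
  r * f zero + x
    ≡⟨ cong (r * f zero +_) (bernoulli-elements p k (f ∘ suc)) ⟩
  r * f zero + r * ∫ (elements ⊤) (f ∘ suc)
    ≡⟨ sym (ℚ.*-distribˡ-+ r (f zero) _) ⟩
  r * (f zero + ∫ (elements ⊤) (f ∘ suc)) ∎
  where
  open ≡-Reasoning
  r = value p
  x = ∫ (bernoulli p k) (λ T → ∫ (elements T) (f ∘ suc))

counting-∅ : ∀ k {f : Subset k → ℚ} → (∀ T → ¬ ∣ T ∣ ℕ.≤ 0 → f T ≡ 0ℚ) → ∫ (counting k) f ≡ f ∅
counting-∅ zero    f≡0 = refl
counting-∅ (suc k) {f} f≡0 = trans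
  (cong₂ _+_ (counting-∅ k (λ T h → f≡0 (outside ∷ T) h)) (∫-≡0 (counting k) (λ T → f≡0 (inside ∷ T) (λ ()))))
  (ℚ.+-identityʳ (f ∅))

-- Meant for the set of colours given to one point: the point is absent or carries a single colour,
-- and every other `T` has weight zero.
counting-subsingleton : ∀ k {f : Subset k → ℚ} → (∀ T → ¬ ∣ T ∣ ℕ.≤ 1 → f T ≡ 0ℚ) →
  ∫ (counting k) f ≡ f ∅ + ∫ (elements ⊤) (λ i → f ⁅ i ⁆)
counting-subsingleton zero    {f} f≡0 = sym (ℚ.+-identityʳ (f []))
counting-subsingleton (suc k) {f} f≡0 = trans
  (cong₂ _+_ (counting-subsingleton k (λ T h → f≡0 (outside ∷ T) h))
             (counting-∅ k (λ T h → f≡0 (inside ∷ T) (h ∘ ℕ.s≤s⁻¹))))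
  (solve 3 (λ a b c → a :+ b :+ c := a :+ (c :+ b)) refl (f ∅) (∫ (elements ⊤) (λ i → f (outside ∷ ⁅ i ⁆))) (f (inside ∷ ∅)))

-- c = p / k is the probability that a given point is present with a given colour.
module _ (p : Probability) {k : ℕ} (c : Probability) (kc≡p : fromℕ k * value c ≡ value p) where

  coloured : ∀ n → Measure (Subset (n ℕ.* k))
  coloured zero    = dirac []
  coloured (suc n) = scale (1ℚ - value p) (≤⇒0≤- (p≤1 p)) (pushforward (∅ ++_) (coloured n))
                   ⊕ scale (value c) (0≤p c) (elements ⊤ >>= λ i → pushforward (⁅ i ⁆ ++_) (coloured n))

  weight : ∀ n → Subset (n ℕ.* k) → ℚ
  weight n S = if does (distinctOn? (point n k) S) then value c ^ ∣ S ∣ * (1ℚ - value p) ^ (n ℕ.∸ ∣ S ∣) else 0ℚ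

  weight-distinct : ∀ n {S} → DistinctOn (point n k) S → weight n S ≡ value c ^ ∣ S ∣ * (1ℚ - value p) ^ (n ℕ.∸ ∣ S ∣)
  weight-distinct n {S} d = cong (if_then value c ^ ∣ S ∣ * (1ℚ - value p) ^ (n ℕ.∸ ∣ S ∣) else 0ℚ) (dec-true (distinctOn? (point n k) S) d)

  weight-not : ∀ n {S} → ¬ DistinctOn (point n k) S → weight n S ≡ 0ℚ
  weight-not n {S} ¬d = cong (if_then value c ^ ∣ S ∣ * (1ℚ - value p) ^ (n ℕ.∸ ∣ S ∣) else 0ℚ) (dec-false (distinctOn? (point n k) S) ¬d)

  weight-big : ∀ n {T : Subset k} (R : Subset (n ℕ.* k)) → ¬ ∣ T ∣ ℕ.≤ 1 → weight (suc n) (T ++ R) ≡ 0ℚ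
  weight-big n {T} R big = weight-not (suc n) (λ d → big (subsingleton⇒∣S∣≤1 (distinct-point⁻ˡ n k {T} {R} d)))

  weight-∅ : ∀ n R → weight (suc n) (∅ ++ R) ≡ (1ℚ - value p) * weight n R
  weight-∅ n R = by (distinctOn? (point n k) R)
    where
    by : Dec (DistinctOn (point n k) R) → weight (suc n) (∅ ++ R) ≡ (1ℚ - value p) * weight n R
    by (no ¬d) = trans (weight-not (suc n) (¬d ∘ distinct-point⁻ʳ n k ∅))
      (sym (trans (cong ((1ℚ - value p) *_) (weight-not n ¬d)) (ℚ.*-zeroʳ (1ℚ - value p))))
    by (yes d) = begin
      weight (suc n) (∅ ++ R)
        ≡⟨ weight-distinct (suc n) (distinct-point⁺ n k (λ i i′ i∈ → ⊥-elim (∉⊥ i∈)) d) ⟩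
      value c ^ ∣ ∅ {k} ++ R ∣ * (1ℚ - value p) ^ (suc n ℕ.∸ ∣ ∅ {k} ++ R ∣)
        ≡⟨ cong₂ (λ a b → value c ^ a * (1ℚ - value p) ^ b) size (trans (cong (suc n ℕ.∸_) size) (ℕ.+-∸-assoc 1 ∣R∣≤n)) ⟩
      value c ^ ∣ R ∣ * ((1ℚ - value p) * (1ℚ - value p) ^ (n ℕ.∸ ∣ R ∣))
        ≡⟨ solve 3 (λ a b c → a :* (b :* c) := b :* (a :* c)) refl (value c ^ ∣ R ∣) (1ℚ - value p) ((1ℚ - value p) ^ (n ℕ.∸ ∣ R ∣)) ⟩
      (1ℚ - value p) * (value c ^ ∣ R ∣ * (1ℚ - value p) ^ (n ℕ.∸ ∣ R ∣))
        ≡⟨ cong ((1ℚ - value p) *_) (sym (weight-distinct n d)) ⟩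
      (1ℚ - value p) * weight n R ∎
      where
      open ≡-Reasoning
      size : ∣ ∅ {k} ++ R ∣ ≡ ∣ R ∣
      size = trans (∣++∣ (∅ {k}) R) (cong (ℕ._+ ∣ R ∣) (∣⊥∣≡0 k))
      -- Truncated subtraction commutes with the successor only in this range; it holds because `R`
      -- has at most one colour per point.
      ∣R∣≤n : ∣ R ∣ ℕ.≤ n
      ∣R∣≤n = ℕ.≤-trans (∣S∣≤∣image∣ (point n k) R d) (∣p∣≤n (image (point n k) R))

  weight-⁅⁆ : ∀ n i R → weight (suc n) (⁅ i ⁆ ++ R) ≡ value c * weight n R
  weight-⁅⁆ n i R = by (distinctOn? (point n k) R)
    where
    unique : ∀ j j′ → j ∈ ⁅ i ⁆ → j′ ∈ ⁅ i ⁆ → j ≡ j′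
    unique j j′ j∈ j′∈ = trans (x∈⁅y⁆⇒x≡y i j∈) (sym (x∈⁅y⁆⇒x≡y i j′∈))
    by : Dec (DistinctOn (point n k) R) → weight (suc n) (⁅ i ⁆ ++ R) ≡ value c * weight n R
    by (no ¬d) = trans (weight-not (suc n) (¬d ∘ distinct-point⁻ʳ n k ⁅ i ⁆))
      (sym (trans (cong (value c *_) (weight-not n ¬d)) (ℚ.*-zeroʳ (value c))))
    by (yes d) = begin
      weight (suc n) (⁅ i ⁆ ++ R)
        ≡⟨ weight-distinct (suc n) (distinct-point⁺ n k unique d) ⟩
      value c ^ ∣ ⁅ i ⁆ ++ R ∣ * (1ℚ - value p) ^ (suc n ℕ.∸ ∣ ⁅ i ⁆ ++ R ∣)
        ≡⟨ cong (λ a → value c ^ a * (1ℚ - value p) ^ (suc n ℕ.∸ a)) (trans (∣++∣ ⁅ i ⁆ R) (cong (ℕ._+ ∣ R ∣) (∣⁅x⁆∣≡1 i))) ⟩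
      value c * value c ^ ∣ R ∣ * (1ℚ - value p) ^ (n ℕ.∸ ∣ R ∣)
        ≡⟨ ℚ.*-assoc (value c) (value c ^ ∣ R ∣) ((1ℚ - value p) ^ (n ℕ.∸ ∣ R ∣)) ⟩
      value c * (value c ^ ∣ R ∣ * (1ℚ - value p) ^ (n ℕ.∸ ∣ R ∣))
        ≡⟨ cong (value c *_) (sym (weight-distinct n d)) ⟩
      value c * weight n R ∎
      where open ≡-Reasoning

  -- Identifies the closed formula for the measure with the recursive product measure, on which the
  -- inductions over points run. The sum is split by the colours of the first point.
  ∫-weight : ∀ n (f : Subset (n ℕ.* k) → ℚ) → ∫ (counting (n ℕ.* k)) (λ S → weight n S * f S) ≡ ∫ (coloured n) f
  ∫-weight zero    f = trans (cong (_* f []) (weight-distinct 0 {[]} (λ ()))) (ℚ.*-identityˡ (f []))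
  ∫-weight (suc n) f = begin
    ∫ (counting (k ℕ.+ n ℕ.* k)) (λ S → weight (suc n) S * f S)
      ≡⟨ counting-++ k _ ⟩
    ∫ (counting k) (λ T → ∫ (counting (n ℕ.* k)) (λ R → weight (suc n) (T ++ R) * f (T ++ R)))
      ≡⟨ counting-subsingleton k (λ T big → ∫-≡0 (counting (n ℕ.* k)) (λ R →
           trans (cong (_* f (T ++ R)) (weight-big n {T} R big)) (ℚ.*-zeroˡ (f (T ++ R))))) ⟩
    ∫ (counting (n ℕ.* k)) (λ R → weight (suc n) (∅ ++ R) * f (∅ ++ R)) +
    ∫ (elements ⊤) (λ i → ∫ (counting (n ℕ.* k)) (λ R → weight (suc n) (⁅ i ⁆ ++ R) * f (⁅ i ⁆ ++ R)))
      ≡⟨ cong₂ _+_ (pull (1ℚ - value p) ∅ (weight-∅ n))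
           (trans (∫-cong (elements ⊤) (λ i → pull (value c) ⁅ i ⁆ (weight-⁅⁆ n i)))
                  (∫-* (elements ⊤) (value c) (λ i → ∫ (coloured n) (λ R → f (⁅ i ⁆ ++ R))))) ⟩
    ∫ (coloured (suc n)) f ∎
    where
    open ≡-Reasoning
    pull : ∀ a T → (∀ R → weight (suc n) (T ++ R) ≡ a * weight n R) →
      ∫ (counting (n ℕ.* k)) (λ R → weight (suc n) (T ++ R) * f (T ++ R)) ≡ a * ∫ (coloured n) (λ R → f (T ++ R))
    pull a T h = trans
      (∫-cong (counting (n ℕ.* k)) (λ R → trans (cong (_* f (T ++ R)) (h R)) (ℚ.*-assoc a (weight n R) (f (T ++ R)))))
      (trans (∫-* (counting (n ℕ.* k)) a (λ R → weight n R * f (T ++ R))) (cong (a *_) (∫-weight n (λ R → f (T ++ R)))))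

  -- Forgetting colours leaves a Bernoulli(p) set: each point is present with total probability kc =
  -- p over its k colours.
  coloured-⊆-image : ∀ n (T : Subset n) → ∫ (coloured n) (λ R → ⟦ T ⊆? image (point n k) R ⟧) ≡ value p ^ ∣ T ∣
  coloured-⊆-image zero    []      = ⟦⟧-true ([] ⊆? image (point 0 k) []) (λ ())
  coloured-⊆-image (suc n) (t ∷ T) = trans
    (cong₂ (λ a b → (1ℚ - value p) * a + value c * b)
      (∫-cong (coloured n) (λ R → cong (λ I → ⟦ t ∷ T ⊆? I ⟧) (image-point-∅ n k R)))
      (∫-cong (elements ⊤) (λ i → ∫-cong (coloured n) (λ R → cong (λ I → ⟦ t ∷ T ⊆? I ⟧) (image-point-⁅⁆ n k i R)))))
    (trans (cong (λ b → (1ℚ - value p) * ∫ (coloured n) (λ R → ⟦ t ∷ T ⊆? outside ∷ image (point n k) R ⟧) + value c * b)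
      (elements-⊤-const k (∫ (coloured n) (λ R → ⟦ t ∷ T ⊆? inside ∷ image (point n k) R ⟧)))) (step t))
    where
    X = ∫ (coloured n) (λ R → ⟦ T ⊆? image (point n k) R ⟧)
    step : ∀ t → (1ℚ - value p) * ∫ (coloured n) (λ R → ⟦ t ∷ T ⊆? outside ∷ image (point n k) R ⟧)
               + value c * (fromℕ k * ∫ (coloured n) (λ R → ⟦ t ∷ T ⊆? inside ∷ image (point n k) R ⟧)) ≡ value p ^ ∣ t ∷ T ∣
    step outside = trans
      (cong₂ (λ a b → (1ℚ - value p) * a + value c * (fromℕ k * b))
        (∫-cong (coloured n) (λ R → ⟦⟧-cong (outside ∷ T ⊆? outside ∷ image (point n k) R) (T ⊆? image (point n k) R) drop-∷-⊆ out⊆))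
        (∫-cong (coloured n) (λ R → ⟦⟧-cong (outside ∷ T ⊆? inside ∷ image (point n k) R) (T ⊆? image (point n k) R) drop-∷-⊆ out⊆)))
      (trans (solve 4 (λ p c k x → (con 1ℚ :- p) :* x :+ c :* (k :* x) := x :+ (k :* c :- p) :* x) refl (value p) (value c) (fromℕ k) X)
        (trans (cong (λ z → X + (z - value p) * X) kc≡p)
          (trans (solve 2 (λ p x → x :+ (p :- p) :* x := x) refl (value p) X) (coloured-⊆-image n T))))
    step inside = trans
      (cong₂ (λ a b → (1ℚ - value p) * a + value c * (fromℕ k * b))
        (∫-≡0 (coloured n) (λ R → ⟦⟧-false (inside ∷ T ⊆? outside ∷ image (point n k) R) in⊈out))
        (∫-cong (coloured n) (λ R → ⟦⟧-cong (inside ∷ T ⊆? inside ∷ image (point n k) R) (T ⊆? image (point n k) R) drop-∷-⊆ s⊆s)))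
      (trans (solve 4 (λ p c k x → (con 1ℚ :- p) :* con 0ℚ :+ c :* (k :* x) := k :* c :* x) refl (value p) (value c) (fromℕ k) X)
        (cong₂ _*_ kc≡p (coloured-⊆-image n T)))

  -- Given the rest, the product measure hits a set C of good colours with probability at
  -- most ∣ C ∣ c, which is exactly the probability that the coloured measure does.
  bernoulli≤coloured : ∀ n {P : Subset (n ℕ.* k) → Set} (P? : ∀ S → Dec (P S)) →
    (∀ {S T} → S ⊆ T → P S → P T) → (∀ {S} → P S → ∃[ R ] (R ⊆ S × P R × DistinctOn (point n k) R)) →
    ∫ (bernoulli c (n ℕ.* k)) (λ S → ⟦ P? S ⟧) ≤ ∫ (coloured n) (λ S → ⟦ P? S ⟧)
  bernoulli≤coloured zero    P? up gen = ℚ.≤-refl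
  bernoulli≤coloured (suc n) {P} P? up gen = begin
    ∫ (bernoulli c (k ℕ.+ n ℕ.* k)) (λ S → ⟦ P? S ⟧)
      ≡⟨ bernoulli-++ c k _ ⟩
    ∫ (bernoulli c k) (λ T → ∫ β (λ R → ⟦ P? (T ++ R) ⟧))
      -- A union bound over colours: a generator uses at most one colour of the first point, so the
      -- event for `T` already holds with `∅` or with some `⁅ i ⁆`, `i ∈ T`. Written through gains
      -- over `∅`, the bound integrates exactly to the mixture that defines `coloured`.
      ≤⟨ ∫-mono (bernoulli c k) (λ T → ∫-mono β (split T)) ⟩
    ∫ (bernoulli c k) (λ T → ∫ β (λ R → ⟦ P? (∅ ++ R) ⟧ + ∫ (elements T) (λ i → ⟦ P? (⁅ i ⁆ ++ R) ⟧ - ⟦ P? (∅ ++ R) ⟧)))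
      ≡⟨ ∫-cong (bernoulli c k) (λ T → trans (∫-+ β _ _) (cong (a +_) (trans (∫-elements-comm β T _)
           (∫-cong (elements T) (λ i → ∫-- β (λ R → ⟦ P? (⁅ i ⁆ ++ R) ⟧) (λ R → ⟦ P? (∅ ++ R) ⟧)))))) ⟩
    ∫ (bernoulli c k) (λ T → a + ∫ (elements T) (λ i → b i - a))
      ≡⟨ trans (∫-+ (bernoulli c k) (λ _ → a) _) (cong₂ _+_ (bernoulli-const c k a) (bernoulli-elements c k (λ i → b i - a))) ⟩
    a + value c * ∫ (elements ⊤) (λ i → b i - a)
      ≡⟨ cong (λ z → a + value c * z) (trans (∫-- (elements ⊤) b (λ _ → a)) (cong (λ y → ∫ (elements ⊤) b - y) (elements-⊤-const k a))) ⟩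
    a + value c * (∫ (elements ⊤) b - fromℕ k * a)
      ≡⟨ solve 4 (λ a c b k → a :+ c :* (b :- k :* a) := (con 1ℚ :- k :* c) :* a :+ c :* b) refl a (value c) (∫ (elements ⊤) b) (fromℕ k) ⟩
    (1ℚ - fromℕ k * value c) * a + value c * ∫ (elements ⊤) b
      ≡⟨ cong (λ z → (1ℚ - z) * a + value c * ∫ (elements ⊤) b) kc≡p ⟩
    (1ℚ - value p) * a + value c * ∫ (elements ⊤) b
      ≤⟨ ℚ.+-mono-≤ (*-monoˡ-≤ (≤⇒0≤- (p≤1 p)) (rec ∅)) (*-monoˡ-≤ (0≤p c) (∫-mono (elements ⊤) (λ i → rec ⁅ i ⁆))) ⟩
    ∫ (coloured (suc n)) (λ S → ⟦ P? S ⟧) ∎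
    where
    open ℚ.≤-Reasoning
    β = bernoulli c (n ℕ.* k)
    a = ∫ β (λ R → ⟦ P? (∅ ++ R) ⟧)
    b : Fin k → ℚ
    b i = ∫ β (λ R → ⟦ P? (⁅ i ⁆ ++ R) ⟧)
    rec : ∀ (T : Subset k) → ∫ β (λ R → ⟦ P? (T ++ R) ⟧) ≤ ∫ (coloured n) (λ R → ⟦ P? (T ++ R) ⟧)
    rec T = bernoulli≤coloured n (λ R → P? (T ++ R)) (λ S⊆S′ → up (++-⊆⁺ ⊆-refl S⊆S′)) genT
      where
      genT : ∀ {S} → P (T ++ S) → ∃[ R ] (R ⊆ S × P (T ++ R) × DistinctOn (point n k) R)
      -- In a generator `U ++ R` below `T ++ S` the block `U` may be enlarged to `T`; only the
      -- distinctness within `R` has to survive.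
      genT {S} PTS with gen PTS
      ... | E , E⊆ , PE , dE with Vec.splitAt k E
      ...   | U , R , refl = R , ++-⊆⁻ʳ U T E⊆ , up (++-⊆⁺ {T = U} {T} {R} (++-⊆⁻ˡ {T = U} {T} {R} {S} E⊆) ⊆-refl) PE , distinct-point⁻ʳ n k U dE
    gain : ∀ (R : Subset (n ℕ.* k)) i → 0ℚ ≤ ⟦ P? (⁅ i ⁆ ++ R) ⟧ - ⟦ P? (∅ ++ R) ⟧
    gain R i = ≤⇒0≤- (⟦⟧-mono (P? (∅ ++ R)) (P? (⁅ i ⁆ ++ R)) (up (++-⊆⁺ {T = ∅ {k}} {⁅ i ⁆} {R} ⊥⊆ ⊆-refl)))
    split : ∀ (T : Subset k) (R : Subset (n ℕ.* k)) → ⟦ P? (T ++ R) ⟧ ≤ ⟦ P? (∅ ++ R) ⟧ + ∫ (elements T) (λ i → ⟦ P? (⁅ i ⁆ ++ R) ⟧ - ⟦ P? (∅ ++ R) ⟧)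
    split T R with P? (T ++ R)
    ... | no _ = +-nonNeg (⟦⟧-nonNeg (P? (∅ ++ R))) (∫-nonNeg (elements T) (gain R))
    ... | yes PTR with gen PTR
    ...   | E , E⊆ , PE , dE with Vec.splitAt k E
    ...     | U , R′ , refl with nonempty? U
    ...       | no empty = ℚ.≤-trans
                  (ℚ.≤-reflexive (trans (sym (⟦⟧-true (P? (∅ ++ R)) (up (++-⊆⁺ U⊆∅ (++-⊆⁻ʳ U T E⊆)) PE))) (sym (ℚ.+-identityʳ _))))
                  (ℚ.+-monoʳ-≤ ⟦ P? (∅ ++ R) ⟧ (∫-nonNeg (elements T) (gain R)))
                where
                U⊆∅ : U ⊆ ∅
                U⊆∅ {x} x∈ = ⊥-elim (empty (x , x∈))
    ...       | yes (i , i∈U) = ℚ.≤-trans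
                  (ℚ.≤-reflexive (trans (sym (⟦⟧-true (P? (⁅ i ⁆ ++ R)) (up (++-⊆⁺ U⊆⁅i⁆ (++-⊆⁻ʳ U T E⊆)) PE)))
                    (sym (a+[b-a] ⟦ P? (∅ ++ R) ⟧ ⟦ P? (⁅ i ⁆ ++ R) ⟧))))
                  (ℚ.+-monoʳ-≤ ⟦ P? (∅ ++ R) ⟧ (elements-≥ T (gain R) (++-⊆⁻ˡ {U = T} E⊆ i∈U)))
                where
                U⊆⁅i⁆ : U ⊆ ⁅ i ⁆
                U⊆⁅i⁆ {x} x∈ = subst (λ z → x ∈ ⁅ z ⁆) (distinct-point⁻ˡ n k dE x i x∈ i∈U) (x∈⁅x⁆ x)

-- Random injective colourings

fromℕ*1/1+ : ∀ m → fromℕ (suc m) * 1/1+ m ≡ 1ℚ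
fromℕ*1/1+ m = ℚ.≤-antisym (cross-≤ (suc m) m 0 (ℕ.≤-reflexive (ℕ.*-identityʳ (suc m))))
                           (cross-≥ (suc m) m 0 (ℕ.≤-reflexive (sym (ℕ.*-identityʳ (suc m)))))

1/1+*fromℕ* : ∀ m a → 1/1+ m * (fromℕ (suc m) * a) ≡ a
1/1+*fromℕ* m a = trans (solve 3 (λ x y a → x :* (y :* a) := y :* x :* a) refl (1/1+ m) (fromℕ (suc m)) a)
  (trans (cong (_* a) (fromℕ*1/1+ m)) (ℚ.*-identityˡ a))

fromℕ*1/1+* : ∀ m a → fromℕ (suc m) * (1/1+ m * a) ≡ a
fromℕ*1/1+* m a = trans (solve 3 (λ x y a → x :* (y :* a) := y :* (x :* a)) refl (fromℕ (suc m)) (1/1+ m) a) (1/1+*fromℕ* m a)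

fromℕ-mono : ∀ {m n} → m ℕ.≤ n → fromℕ m ≤ fromℕ n
fromℕ-mono {n = n} ℕ.z≤n = fromℕ-nonNeg n
fromℕ-mono (ℕ.s≤s {m} {n} m≤n) = subst₂ _≤_ (sym (fromℕ-suc m)) (sym (fromℕ-suc n)) (ℚ.+-monoʳ-≤ 1ℚ (fromℕ-mono m≤n))

-- 1 / (m (m - 1) ⋯ (m - t + 1)), the probability that t given points get t given
-- colours in a uniformly random injective colouring with m colours.
invFalling : ℕ → ℕ → ℚ
invFalling m       zero    = 1ℚ
invFalling zero    (suc t) = 0ℚ
invFalling (suc m) (suc t) = 1/1+ m * invFalling m t

invFalling-nonNeg : ∀ m t → 0ℚ ≤ invFalling m t
invFalling-nonNeg m       zero    = 0≤1
invFalling-nonNeg zero    (suc t) = ℚ.≤-refl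
invFalling-nonNeg (suc m) (suc t) = *-nonNeg (1/1+-nonNeg m) (invFalling-nonNeg m t)

-- An identity of falling factorials for t ≤ m; beyond that the left side vanishes. It serves a
-- point whose colour must avoid t prescribed ones, so that m + 1 - t of its m + 1 choices remain.
invFalling-step : ∀ m t → fromℕ (suc m ℕ.∸ t) * invFalling m t ≤ fromℕ (suc m) * invFalling (suc m) t
invFalling-step m       zero    = ℚ.≤-refl
invFalling-step zero    (suc t) = ℚ.≤-trans (ℚ.≤-reflexive (ℚ.*-zeroʳ (fromℕ (0 ℕ.∸ t))))
  (*-nonNeg (fromℕ-nonNeg 1) (invFalling-nonNeg 1 (suc t)))
invFalling-step (suc m) (suc t) = begin
  fromℕ (suc m ℕ.∸ t) * (1/1+ m * invFalling m t)
    ≡⟨ solve 3 (λ a b c → a :* (b :* c) := b :* (a :* c)) refl (fromℕ (suc m ℕ.∸ t)) (1/1+ m) (invFalling m t) ⟩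
  1/1+ m * (fromℕ (suc m ℕ.∸ t) * invFalling m t)
    ≤⟨ *-monoˡ-≤ (1/1+-nonNeg m) (invFalling-step m t) ⟩
  1/1+ m * (fromℕ (suc m) * invFalling (suc m) t)
    ≡⟨ 1/1+*fromℕ* m (invFalling (suc m) t) ⟩
  invFalling (suc m) t
    ≡⟨ sym (fromℕ*1/1+* (suc m) (invFalling (suc m) t)) ⟩
  fromℕ (suc (suc m)) * (1/1+ (suc m) * invFalling (suc m) t) ∎
  where open ℚ.≤-Reasoning

module _ (n k : ℕ) where

  distinct-colour⁺ : ∀ {T : Subset k} {R} → (∀ i e → i ∈ T → e ∈ R → ¬ i ≡ colour n k e) →
    DistinctOn (colour n k) R → DistinctOn (colour (suc n) k) (T ++ R)
  distinct-colour⁺ {T} fresh distinct e e′ e∈ e′∈ eq with block k (n ℕ.* k) e | block k (n ℕ.* k) e′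
  ... | left i  | left i′  = cong (_↑ˡ (n ℕ.* k)) (trans (sym (colour-left n k i)) (trans eq (colour-left n k i′)))
  ... | left i  | right e′ = ⊥-elim (fresh i e′ (∈-++⁻ˡ {T = T} e∈) (∈-++⁻ʳ T e′∈)
    (trans (sym (colour-left n k i)) (trans eq (colour-right n k e′))))
  ... | right e | left i′  = ⊥-elim (fresh i′ e (∈-++⁻ˡ {T = T} e′∈) (∈-++⁻ʳ T e∈)
    (trans (sym (colour-left n k i′)) (trans (sym eq) (colour-right n k e))))
  ... | right e | right e′ = cong (k ↑ʳ_) (distinct e e′ (∈-++⁻ʳ T e∈) (∈-++⁻ʳ T e′∈)
    (trans (sym (colour-right n k e)) (trans eq (colour-right n k e′))))

-- R is the graph of an injective colouring of S with colours from A.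
data Colouring {k} : ∀ {n} → Subset n → Subset k → Subset (n ℕ.* k) → Set where
  []   : ∀ {A} → Colouring [] A []
  skip : ∀ {n} {S : Subset n} {A R} → Colouring S A R → Colouring (outside ∷ S) A (∅ {k} ++ R)
  pick : ∀ {n} {S : Subset n} {A R i} → i ∈ A → Colouring S (A ─ ⁅ i ⁆) R → Colouring (inside ∷ S) A (⁅ i ⁆ ++ R)

module _ {k : ℕ} where

  colouring-distinct : ∀ {n} {S : Subset n} {A : Subset k} {R} → Colouring S A R → DistinctOn (point n k) R
  colouring-distinct []                 = λ ()
  colouring-distinct (skip {n} {R = R} col) = distinct-point⁺ n k {∅} {R} (λ i i′ i∈ → ⊥-elim (∉⊥ i∈)) (colouring-distinct col)
  colouring-distinct (pick {n} {R = R} {i} _ col) = distinct-point⁺ n k {⁅ i ⁆} {R}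
    (λ j j′ j∈ j′∈ → trans (x∈⁅y⁆⇒x≡y i j∈) (sym (x∈⁅y⁆⇒x≡y i j′∈))) (colouring-distinct col)

  colouring-image : ∀ {n} {S : Subset n} {A : Subset k} {R} → Colouring S A R → image (point n k) R ≡ S
  colouring-image []                          = refl
  colouring-image (skip {n} {R = R} col)        = trans (image-point-∅ n k R) (cong (outside ∷_) (colouring-image col))
  colouring-image (pick {n} {R = R} {i} _ col) = trans (image-point-⁅⁆ n k i R) (cong (inside ∷_) (colouring-image col))

  colouring-colours : ∀ {n} {S : Subset n} {A : Subset k} {R} → Colouring S A R → ∀ {e} → e ∈ R → colour n k e ∈ A
  colouring-colours (skip {n} {R = R} col) {e} e∈ with block k (n ℕ.* k) e
  ... | left i  = ⊥-elim (∉⊥ (∈-++⁻ˡ {T = ∅} e∈))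
  ... | right e = subst (_∈ _) (sym (colour-right n k e)) (colouring-colours col (∈-++⁻ʳ ∅ e∈))
  colouring-colours (pick {n} {A = A} {R} {i} i∈ col) {e} e∈ with block k (n ℕ.* k) e
  ... | left j  = subst (_∈ A) (sym (trans (colour-left n k j) (x∈⁅y⁆⇒x≡y i (∈-++⁻ˡ {T = ⁅ i ⁆} e∈)))) i∈
  ... | right e = subst (_∈ A) (sym (colour-right n k e)) (p─q⊆p A ⁅ i ⁆ (colouring-colours col (∈-++⁻ʳ ⁅ i ⁆ e∈)))

  colouring-rainbow : ∀ {n} {S : Subset n} {A : Subset k} {R} → Colouring S A R → DistinctOn (colour n k) R
  colouring-rainbow []                          = λ ()
  colouring-rainbow (skip {n} {R = R} col)        = distinct-colour⁺ n k {∅} {R} (λ i e i∈ → ⊥-elim (∉⊥ i∈)) (colouring-rainbow col)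
  colouring-rainbow (pick {n} {A = A} {R} {i} _ col) = distinct-colour⁺ n k {⁅ i ⁆} {R}
    (λ j e j∈ e∈ j≡ → x∈p─q⇒x∉q A ⁅ i ⁆ (subst (_∈ A ─ ⁅ i ⁆) (sym j≡) (colouring-colours col e∈)) j∈)
    (colouring-rainbow col)

recipℕ : ℕ → ℚ
recipℕ zero    = 0ℚ
recipℕ (suc m) = 1/1+ m

recipℕ-nonNeg : ∀ m → 0ℚ ≤ recipℕ m
recipℕ-nonNeg zero    = ℚ.≤-refl
recipℕ-nonNeg (suc m) = 1/1+-nonNeg m

∣A∣≡1+∣A─⁅i⁆∣ : ∀ {k} (A : Subset k) {i} → i ∈ A → ∣ A ∣ ≡ suc ∣ A ─ ⁅ i ⁆ ∣
∣A∣≡1+∣A─⁅i⁆∣ (inside ∷ A)  here       = cong (suc ∘ ∣_∣) (sym (p─⊥≡p A))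
∣A∣≡1+∣A─⁅i⁆∣ (inside ∷ A)  (there i∈) = cong suc (∣A∣≡1+∣A─⁅i⁆∣ A i∈)
∣A∣≡1+∣A─⁅i⁆∣ (outside ∷ A) (there i∈) = ∣A∣≡1+∣A─⁅i⁆∣ A i∈

elements-∉ : ∀ {k} (A C : Subset k) → C ⊆ A → ∫ (elements A) (λ i → ⟦ ¬? (i ∈? C) ⟧) ≤ fromℕ (∣ A ∣ ℕ.∸ ∣ C ∣)
elements-∉ [] [] C⊆A = ℚ.≤-refl
elements-∉ (a ∷ A) (c ∷ C) C⊆A = step a c C⊆A
  where
  rec : ∀ c → ∫ (elements A) (λ i → ⟦ ¬? (suc i ∈? c ∷ C) ⟧) ≤ fromℕ (∣ A ∣ ℕ.∸ ∣ C ∣)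
  rec c = ℚ.≤-trans (∫-mono (elements A) (λ i → ⟦⟧-mono (¬? (suc i ∈? c ∷ C)) (¬? (i ∈? C)) (_∘ there)))
    (elements-∉ A C (drop-∷-⊆ C⊆A))
  step : ∀ a c → c ∷ C ⊆ a ∷ A → ∫ (elements (a ∷ A)) (λ i → ⟦ ¬? (i ∈? c ∷ C) ⟧) ≤ fromℕ (∣ a ∷ A ∣ ℕ.∸ ∣ c ∷ C ∣)
  step outside outside _ = rec outside
  step outside inside  h = ⊥-elim (in⊈out h)
  step inside  inside  _ = ℚ.≤-trans (ℚ.≤-reflexive (ℚ.+-identityˡ _)) (rec inside)
  step inside  outside h = ℚ.≤-trans (ℚ.+-monoʳ-≤ 1ℚ (rec outside))
    (ℚ.≤-reflexive (trans (sym (fromℕ-suc (∣ A ∣ ℕ.∸ ∣ C ∣)))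
      (cong fromℕ (sym (ℕ.+-∸-assoc 1 (p⊆q⇒∣p∣≤∣q∣ (drop-∷-⊆ h)))))))

elements-≟ : ∀ {k} (A : Subset k) j → ∫ (elements A) (λ i → ⟦ i Fin.≟ j ⟧) ≤ 1ℚ
elements-≟ (outside ∷ A) zero = ℚ.≤-trans (ℚ.≤-reflexive (∫-≡0 (elements A) (λ i → ⟦⟧-false (suc i Fin.≟ zero) (λ ())))) 0≤1
elements-≟ (inside ∷ A)  zero = ℚ.≤-reflexive (cong (1ℚ +_) (∫-≡0 (elements A) (λ i → ⟦⟧-false (suc i Fin.≟ zero) (λ ()))))
elements-≟ (outside ∷ A) (suc j) = ℚ.≤-trans
  (∫-mono (elements A) (λ i → ⟦⟧-mono (suc i Fin.≟ suc j) (i Fin.≟ j) Fin.suc-injective)) (elements-≟ A j)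
elements-≟ (inside ∷ A)  (suc j) = ℚ.≤-trans (ℚ.≤-reflexive (ℚ.+-identityˡ _)) (ℚ.≤-trans
  (∫-mono (elements A) (λ i → ⟦⟧-mono (suc i Fin.≟ suc j) (i Fin.≟ j) Fin.suc-injective)) (elements-≟ A j))

-- The uniformly random injective colouring of S with colours from A.
injective : ∀ {k n} → Subset n → Subset k → Measure (Subset (n ℕ.* k))
injective []            A = dirac []
injective (outside ∷ S) A = pushforward (∅ ++_) (injective S A)
injective (inside ∷ S)  A = scale (recipℕ ∣ A ∣) (recipℕ-nonNeg ∣ A ∣)
  (elements A >>= λ i → pushforward (⁅ i ⁆ ++_) (injective S (A ─ ⁅ i ⁆)))

module _ {k : ℕ} where

  injective-mono : ∀ {n} (S : Subset n) (A : Subset k) {f g} → (∀ R → Colouring S A R → f R ≤ g R) →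
    ∫ (injective S A) f ≤ ∫ (injective S A) g
  injective-mono []            A f≤g = f≤g [] []
  injective-mono (outside ∷ S) A f≤g = injective-mono S A (λ R col → f≤g (∅ ++ R) (skip col))
  injective-mono (inside ∷ S)  A f≤g = *-monoˡ-≤ (recipℕ-nonNeg ∣ A ∣) (elements-mono A (λ i i∈ →
    injective-mono S (A ─ ⁅ i ⁆) (λ R col → f≤g (⁅ i ⁆ ++ R) (pick i∈ col))))

  injective-≤0 : ∀ {n} (S : Subset n) (A : Subset k) {f} → (∀ R → Colouring S A R → f R ≡ 0ℚ) → ∫ (injective S A) f ≤ 0ℚ
  injective-≤0 S A f≡0 = ℚ.≤-trans (injective-mono S A {g = λ _ → 0ℚ} (λ R col → ℚ.≤-reflexive (f≡0 R col)))
    (ℚ.≤-reflexive (∫-0 (injective S A)))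

  private
    predecessor : ∀ {n} {A : Subset k} → suc n ℕ.≤ ∣ A ∣ → ∃[ m ] (∣ A ∣ ≡ suc m × n ℕ.≤ m)
    predecessor {A = A} h with ∣ A ∣
    predecessor (ℕ.s≤s h) | suc m = m , refl , h

    ∣A─⁅i⁆∣≡ : ∀ {A : Subset k} {m i} → ∣ A ∣ ≡ suc m → i ∈ A → ∣ A ─ ⁅ i ⁆ ∣ ≡ m
    ∣A─⁅i⁆∣≡ {A} ∣A∣≡ i∈ = ℕ.suc-injective (trans (sym (∣A∣≡1+∣A─⁅i⁆∣ A i∈)) ∣A∣≡)

  injective-1 : ∀ {n} (S : Subset n) (A : Subset k) → ∣ S ∣ ℕ.≤ ∣ A ∣ → 1ℚ ≤ ∫ (injective S A) (λ _ → 1ℚ)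
  injective-1 []            A h = ℚ.≤-refl
  injective-1 (outside ∷ S) A h = injective-1 S A h
  injective-1 (inside ∷ S)  A h with m , ∣A∣≡ , h′ ← predecessor {A = A} h =
    subst (λ z → 1ℚ ≤ recipℕ z * X) (sym ∣A∣≡) (begin
      1ℚ                                   ≡⟨ sym (1/1+*fromℕ* m 1ℚ) ⟩
      1/1+ m * (fromℕ (suc m) * 1ℚ)        ≡⟨ cong (λ z → 1/1+ m * (fromℕ z * 1ℚ)) (sym ∣A∣≡) ⟩
      1/1+ m * (fromℕ ∣ A ∣ * 1ℚ)          ≡⟨ cong (1/1+ m *_) (sym (elements-const A 1ℚ)) ⟩
      1/1+ m * ∫ (elements A) (λ _ → 1ℚ)   ≤⟨ *-monoˡ-≤ (1/1+-nonNeg m) (elements-mono A (λ i i∈ →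
        injective-1 S (A ─ ⁅ i ⁆) (subst (∣ S ∣ ℕ.≤_) (sym (∣A─⁅i⁆∣≡ {A = A} ∣A∣≡ i∈)) h′))) ⟩
      1/1+ m * X                           ∎)
    where
    open ℚ.≤-Reasoning
    X = ∫ (elements A) (λ i → ∫ (injective S (A ─ ⁅ i ⁆)) (λ _ → 1ℚ))

  -- Induction on points, by the set `U` of colours that `T` prescribes at the current one. Two
  -- colours are impossible; one colour is hit with probability 1 / ∣ A ∣; with none, the colour
  -- must avoid the colours of the rest `V`, and `invFalling-step` absorbs the lost choices. The
  -- event is empty if `V` repeats a colour or uses one outside `A`.
  injective-⊇ : ∀ {n} (S : Subset n) (A : Subset k) (T : Subset (n ℕ.* k)) → ∣ S ∣ ℕ.≤ ∣ A ∣ →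
    ∫ (injective S A) (λ R → ⟦ T ⊆? R ⟧) ≤ invFalling ∣ A ∣ ∣ T ∣
  injective-⊇ []                A [] h = ⟦⟧-≤1 ([] ⊆? [])
  injective-⊇ {suc n} (outside ∷ S) A T h with Vec.splitAt k T
  ... | U , V , refl with nonempty? U
  ...   | yes (i , i∈U) = ℚ.≤-trans
            (injective-≤0 S A (λ R _ → ⟦⟧-false (U ++ V ⊆? ∅ ++ R) (λ h → ∉⊥ (++-⊆⁻ˡ {T = U} {∅} {V} {R} h i∈U))))
            (invFalling-nonNeg ∣ A ∣ ∣ U ++ V ∣)
  ...   | no empty rewrite Empty-unique empty = ℚ.≤-trans
            (∫-mono (injective S A) (λ R → ⟦⟧-mono (∅ {k} ++ V ⊆? ∅ ++ R) (V ⊆? R) (++-⊆⁻ʳ ∅ ∅)))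
            (subst (λ t → ∫ (injective S A) (λ R → ⟦ V ⊆? R ⟧) ≤ invFalling ∣ A ∣ t)
              (sym (trans (∣++∣ (∅ {k}) V) (cong (ℕ._+ ∣ V ∣) (∣⊥∣≡0 k)))) (injective-⊇ S A V h))
  injective-⊇ {suc n} (inside ∷ S) A T h
    with Vec.splitAt k T | predecessor {A = A} h
  ... | U , V , refl | m , ∣A∣≡ , h′ =
    subst (λ z → recipℕ z * ∫ (elements A) X ≤ invFalling z ∣ U ++ V ∣) (sym ∣A∣≡) (cases (nonempty? U))
    where
    open ℚ.≤-Reasoning
    X Y : Fin k → ℚ
    X i = ∫ (injective S (A ─ ⁅ i ⁆)) (λ R → ⟦ U ++ V ⊆? ⁅ i ⁆ ++ R ⟧)
    Y i = ∫ (injective S (A ─ ⁅ i ⁆)) (λ R → ⟦ V ⊆? R ⟧)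

    X≤Y : ∀ i → X i ≤ Y i
    X≤Y i = ∫-mono (injective S (A ─ ⁅ i ⁆)) (λ R → ⟦⟧-mono (U ++ V ⊆? ⁅ i ⁆ ++ R) (V ⊆? R) (++-⊆⁻ʳ U ⁅ i ⁆))

    Y≤ : ∀ i → i ∈ A → Y i ≤ invFalling m ∣ V ∣
    Y≤ i i∈ = subst (λ z → Y i ≤ invFalling z ∣ V ∣) (∣A─⁅i⁆∣≡ {A = A} ∣A∣≡ i∈)
      (injective-⊇ S (A ─ ⁅ i ⁆) V (subst (∣ S ∣ ℕ.≤_) (sym (∣A─⁅i⁆∣≡ {A = A} ∣A∣≡ i∈)) h′))

    vanish : (∀ i → i ∈ A → X i ≤ 0ℚ) → 1/1+ m * ∫ (elements A) X ≤ invFalling (suc m) ∣ U ++ V ∣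
    vanish X≤0 = begin
      1/1+ m * ∫ (elements A) X           ≤⟨ *-monoˡ-≤ (1/1+-nonNeg m) (elements-mono A X≤0) ⟩
      1/1+ m * ∫ (elements A) (λ _ → 0ℚ)  ≡⟨ trans (cong (1/1+ m *_) (∫-0 (elements A))) (ℚ.*-zeroʳ (1/1+ m)) ⟩
      0ℚ                                  ≤⟨ invFalling-nonNeg (suc m) ∣ U ++ V ∣ ⟩
      invFalling (suc m) ∣ U ++ V ∣       ∎

    coloured-first : ∀ j → j ∈ U → Dec (U ⊆ ⁅ j ⁆) → 1/1+ m * ∫ (elements A) X ≤ invFalling (suc m) ∣ U ++ V ∣
    coloured-first j j∈U (no U⊈) = vanish (λ i i∈ → ℚ.≤-reflexive (∫-≡0 (injective S (A ─ ⁅ i ⁆)) (λ R →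
      ⟦⟧-false (U ++ V ⊆? ⁅ i ⁆ ++ R) (λ sub → let U⊆ = λ {x} → ++-⊆⁻ˡ {T = U} {⁅ i ⁆} {V} {R} sub {x} in
        U⊈ (subst (λ z → U ⊆ ⁅ z ⁆) (sym (x∈⁅y⁆⇒x≡y i (U⊆ j∈U))) U⊆)))))
    coloured-first j j∈U (yes U⊆) = subst (λ t → 1/1+ m * ∫ (elements A) X ≤ invFalling (suc m) t) (sym size) (begin
      1/1+ m * ∫ (elements A) X
        ≤⟨ *-monoˡ-≤ (1/1+-nonNeg m) (elements-mono A (λ i i∈ → term i i∈ (i Fin.≟ j))) ⟩
      1/1+ m * ∫ (elements A) (λ i → invFalling m ∣ V ∣ * ⟦ i Fin.≟ j ⟧)
        ≡⟨ cong (1/1+ m *_) (∫-* (elements A) (invFalling m ∣ V ∣) (λ i → ⟦ i Fin.≟ j ⟧)) ⟩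
      1/1+ m * (invFalling m ∣ V ∣ * ∫ (elements A) (λ i → ⟦ i Fin.≟ j ⟧))
        ≤⟨ *-monoˡ-≤ (1/1+-nonNeg m) (*-monoˡ-≤ (invFalling-nonNeg m ∣ V ∣) (elements-≟ A j)) ⟩
      1/1+ m * (invFalling m ∣ V ∣ * 1ℚ)
        ≡⟨ cong (1/1+ m *_) (ℚ.*-identityʳ (invFalling m ∣ V ∣)) ⟩
      1/1+ m * invFalling m ∣ V ∣ ∎)
      where
      U≡ : U ≡ ⁅ j ⁆
      U≡ = ⊆-antisym U⊆ (λ {x} x∈ → subst (_∈ U) (sym (x∈⁅y⁆⇒x≡y j x∈)) j∈U)
      size : ∣ U ++ V ∣ ≡ suc ∣ V ∣
      size = trans (∣++∣ U V) (cong (ℕ._+ ∣ V ∣) (trans (cong ∣_∣ U≡) (∣⁅x⁆∣≡1 j)))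
      term : ∀ i → i ∈ A → (d : Dec (i ≡ j)) → X i ≤ invFalling m ∣ V ∣ * ⟦ d ⟧
      term i i∈ (yes _)  = ℚ.≤-trans (X≤Y i) (ℚ.≤-trans (Y≤ i i∈) (ℚ.≤-reflexive (sym (ℚ.*-identityʳ (invFalling m ∣ V ∣)))))
      term i i∈ (no i≢j) = ℚ.≤-reflexive (trans (∫-≡0 (injective S (A ─ ⁅ i ⁆)) (λ R →
        ⟦⟧-false (U ++ V ⊆? ⁅ i ⁆ ++ R) (λ sub → i≢j (sym (x∈⁅y⁆⇒x≡y i (++-⊆⁻ˡ {T = U} {⁅ i ⁆} {V} {R} sub j∈U))))))
        (sym (ℚ.*-zeroʳ (invFalling m ∣ V ∣))))

    C = image (colour n k) V

    uncoloured-first : U ≡ ∅ → Dec (DistinctOn (colour n k) V × C ⊆ A) →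
      1/1+ m * ∫ (elements A) X ≤ invFalling (suc m) ∣ U ++ V ∣
    uncoloured-first U≡∅ (no bad) = vanish (λ i i∈ → ℚ.≤-trans (X≤Y i)
      (injective-≤0 S (A ─ ⁅ i ⁆) (λ R col → ⟦⟧-false (V ⊆? R) (λ V⊆R →
        bad (distinctOn-⊆ (colour n k) V⊆R (colouring-rainbow col) , colours i R col V⊆R)))))
      where
      colours : ∀ i R → Colouring S (A ─ ⁅ i ⁆) R → V ⊆ R → C ⊆ A
      colours i R col V⊆R x∈ with e , e∈ , refl ← image⁻ (colour n k) x∈ =
        p─q⊆p A ⁅ i ⁆ (colouring-colours col (V⊆R e∈))
    uncoloured-first U≡∅ (yes (distinct , C⊆A)) = subst (λ t → 1/1+ m * ∫ (elements A) X ≤ invFalling (suc m) t) (sym size) (begin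
      1/1+ m * ∫ (elements A) X
        ≤⟨ *-monoˡ-≤ (1/1+-nonNeg m) (elements-mono A (λ i i∈ → ℚ.≤-trans (X≤Y i) (term i i∈ (i ∈? C)))) ⟩
      1/1+ m * ∫ (elements A) (λ i → invFalling m t * ⟦ ¬? (i ∈? C) ⟧)
        ≡⟨ cong (1/1+ m *_) (∫-* (elements A) (invFalling m t) (λ i → ⟦ ¬? (i ∈? C) ⟧)) ⟩
      1/1+ m * (invFalling m t * ∫ (elements A) (λ i → ⟦ ¬? (i ∈? C) ⟧))
        ≤⟨ *-monoˡ-≤ (1/1+-nonNeg m) (*-monoˡ-≤ (invFalling-nonNeg m t) (ℚ.≤-trans (elements-∉ A C C⊆A)
             (fromℕ-mono (ℕ.∸-mono (ℕ.≤-reflexive ∣A∣≡) (∣S∣≤∣image∣ (colour n k) V distinct))))) ⟩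
      1/1+ m * (invFalling m t * fromℕ (suc m ℕ.∸ t))
        ≡⟨ cong (1/1+ m *_) (ℚ.*-comm (invFalling m t) (fromℕ (suc m ℕ.∸ t))) ⟩
      1/1+ m * (fromℕ (suc m ℕ.∸ t) * invFalling m t)
        ≤⟨ *-monoˡ-≤ (1/1+-nonNeg m) (invFalling-step m t) ⟩
      1/1+ m * (fromℕ (suc m) * invFalling (suc m) t)
        ≡⟨ 1/1+*fromℕ* m (invFalling (suc m) t) ⟩
      invFalling (suc m) t ∎)
      where
      t = ∣ V ∣
      size : ∣ U ++ V ∣ ≡ t
      size = trans (∣++∣ U V) (cong (ℕ._+ t) (trans (cong ∣_∣ U≡∅) (∣⊥∣≡0 k)))
      term : ∀ i → i ∈ A → (d : Dec (i ∈ C)) → Y i ≤ invFalling m t * ⟦ ¬? d ⟧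
      term i i∈ (no _)    = ℚ.≤-trans (Y≤ i i∈) (ℚ.≤-reflexive (sym (ℚ.*-identityʳ (invFalling m t))))
      term i i∈ (yes i∈C) = ℚ.≤-trans
        (injective-≤0 S (A ─ ⁅ i ⁆) (λ R col → ⟦⟧-false (V ⊆? R) (used R col)))
        (ℚ.≤-reflexive (sym (ℚ.*-zeroʳ (invFalling m t))))
        where
        used : ∀ R → Colouring S (A ─ ⁅ i ⁆) R → ¬ V ⊆ R
        used R col V⊆R with e , e∈ , refl ← image⁻ (colour n k) i∈C =
          x∈p─q⇒x∉q A ⁅ i ⁆ (colouring-colours col (V⊆R e∈)) (x∈⁅x⁆ i)

    cases : Dec (∃[ i ] i ∈ U) → 1/1+ m * ∫ (elements A) X ≤ invFalling (suc m) ∣ U ++ V ∣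
    cases (yes (j , j∈U)) = coloured-first j j∈U (U ⊆? ⁅ j ⁆)
    cases (no empty)      = uncoloured-first (Empty-unique empty) (distinctOn? (colour n k) V ×-dec C ⊆? A)

-- The estimate (3/k)^t for inverse falling factorials

fromℕ-+ : ∀ m n → fromℕ (m ℕ.+ n) ≡ fromℕ m + fromℕ n
fromℕ-+ zero    n = sym (ℚ.+-identityˡ (fromℕ n))
fromℕ-+ (suc m) n = trans (fromℕ-suc (m ℕ.+ n)) (trans (cong (1ℚ +_) (fromℕ-+ m n))
  (trans (sym (ℚ.+-assoc 1ℚ (fromℕ m) (fromℕ n))) (cong (_+ fromℕ n) (sym (fromℕ-suc m)))))

fromℕ-* : ∀ m n → fromℕ (m ℕ.* n) ≡ fromℕ m * fromℕ n
fromℕ-* zero    n = sym (ℚ.*-zeroˡ (fromℕ n))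
fromℕ-* (suc m) n = trans (fromℕ-+ n (m ℕ.* n)) (trans (cong (fromℕ n +_) (fromℕ-* m n)) (sym (fromℕ-suc-* m (fromℕ n))))

fromℕ-^ : ∀ m t → fromℕ (m ℕ.^ t) ≡ fromℕ m ^ t
fromℕ-^ m zero    = refl
fromℕ-^ m (suc t) = trans (fromℕ-* m (m ℕ.^ t)) (cong (fromℕ m *_) (fromℕ-^ m t))

-- (1 + 1/m)ᵗ ≤ 1 + t/m + t²/m² for t ≤ m, with denominators cleared.
[1+m]^t*m² : ∀ m t → t ℕ.≤ m → suc m ℕ.^ t ℕ.* (m ℕ.* m) ℕ.≤ m ℕ.^ t ℕ.* (m ℕ.* m ℕ.+ t ℕ.* m ℕ.+ t ℕ.* t)
[1+m]^t*m² m zero    t≤m = ℕ.*-monoʳ-≤ 1 (ℕ.≤-trans (ℕ.m≤m+n (m ℕ.* m) 0) (ℕ.m≤m+n (m ℕ.* m ℕ.+ 0) 0))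
[1+m]^t*m² m (suc t) t<m = begin
  suc m ℕ.* suc m ℕ.^ t ℕ.* (m ℕ.* m)
    ≡⟨ ℕ.*-assoc (suc m) (suc m ℕ.^ t) (m ℕ.* m) ⟩
  suc m ℕ.* (suc m ℕ.^ t ℕ.* (m ℕ.* m))
    ≤⟨ ℕ.*-monoʳ-≤ (suc m) ([1+m]^t*m² m t (ℕ.<⇒≤ t<m)) ⟩
  suc m ℕ.* (m ℕ.^ t ℕ.* (m ℕ.* m ℕ.+ t ℕ.* m ℕ.+ t ℕ.* t))
    ≤⟨ ℕ.m≤m+n _ (m ℕ.^ t ℕ.* m) ⟩
  suc m ℕ.* (m ℕ.^ t ℕ.* (m ℕ.* m ℕ.+ t ℕ.* m ℕ.+ t ℕ.* t)) ℕ.+ m ℕ.^ t ℕ.* m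
    ≡⟨ solveⁿ 3 (λ m t x → (conⁿ 1 ⊞ m) ⊠ (x ⊠ (m ⊠ m ⊞ t ⊠ m ⊞ t ⊠ t)) ⊞ x ⊠ m ⊜
         x ⊠ (t ⊠ t) ⊞ x ⊠ (m ⊠ (m ⊠ m) ⊞ t ⊠ (m ⊠ m) ⊞ t ⊠ (t ⊠ m) ⊞ m ⊠ m ⊞ t ⊠ m ⊞ m)) refl m t (m ℕ.^ t) ⟩
  m ℕ.^ t ℕ.* (t ℕ.* t) ℕ.+ m ℕ.^ t ℕ.* (m ℕ.* (m ℕ.* m) ℕ.+ t ℕ.* (m ℕ.* m) ℕ.+ t ℕ.* (t ℕ.* m) ℕ.+ m ℕ.* m ℕ.+ t ℕ.* m ℕ.+ m)
    ≤⟨ ℕ.+-monoˡ-≤ _ (ℕ.*-monoʳ-≤ (m ℕ.^ t) (ℕ.*-monoʳ-≤ t (ℕ.<⇒≤ t<m))) ⟩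
  m ℕ.^ t ℕ.* (t ℕ.* m) ℕ.+ m ℕ.^ t ℕ.* (m ℕ.* (m ℕ.* m) ℕ.+ t ℕ.* (m ℕ.* m) ℕ.+ t ℕ.* (t ℕ.* m) ℕ.+ m ℕ.* m ℕ.+ t ℕ.* m ℕ.+ m)
    ≡⟨ solveⁿ 3 (λ m t x →
         x ⊠ (t ⊠ m) ⊞ x ⊠ (m ⊠ (m ⊠ m) ⊞ t ⊠ (m ⊠ m) ⊞ t ⊠ (t ⊠ m) ⊞ m ⊠ m ⊞ t ⊠ m ⊞ m) ⊜
         m ⊠ x ⊠ (m ⊠ m ⊞ (conⁿ 1 ⊞ t) ⊠ m ⊞ (conⁿ 1 ⊞ t) ⊠ (conⁿ 1 ⊞ t))) refl m t (m ℕ.^ t) ⟩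
  m ℕ.* m ℕ.^ t ℕ.* (m ℕ.* m ℕ.+ suc t ℕ.* m ℕ.+ suc t ℕ.* suc t) ∎
  where open ℕ.≤-Reasoning

[1+m]^t≤3m^t : ∀ m t → t ℕ.≤ m → suc m ℕ.^ t ℕ.≤ 3 ℕ.* m ℕ.^ t
[1+m]^t≤3m^t zero    zero ℕ.z≤n = ℕ.s≤s ℕ.z≤n
[1+m]^t≤3m^t m@(suc _) t t≤m = ℕ.*-cancelʳ-≤ (suc m ℕ.^ t) (3 ℕ.* m ℕ.^ t) (m ℕ.* m) (begin
  suc m ℕ.^ t ℕ.* (m ℕ.* m)                                   ≤⟨ [1+m]^t*m² m t t≤m ⟩
  m ℕ.^ t ℕ.* (m ℕ.* m ℕ.+ t ℕ.* m ℕ.+ t ℕ.* t)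
    ≤⟨ ℕ.*-monoʳ-≤ (m ℕ.^ t) (ℕ.+-mono-≤ (ℕ.+-monoʳ-≤ (m ℕ.* m) (ℕ.*-monoˡ-≤ m t≤m)) (ℕ.*-mono-≤ t≤m t≤m)) ⟩
  m ℕ.^ t ℕ.* (m ℕ.* m ℕ.+ m ℕ.* m ℕ.+ m ℕ.* m)
    ≡⟨ solveⁿ 2 (λ m x → x ⊠ (m ⊠ m ⊞ m ⊠ m ⊞ m ⊠ m) ⊜ conⁿ 3 ⊠ x ⊠ (m ⊠ m)) refl m (m ℕ.^ t) ⟩
  3 ℕ.* m ℕ.^ t ℕ.* (m ℕ.* m) ∎)
  where open ℕ.≤-Reasoning

-- Passing from (m, t) to (m + 1, t + 1) multiplies the left side by (1 + 1/m)^t, which is below e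
-- for t ≤ m; the 3 stands in for e.
m^t*invFalling≤3^t : ∀ m t → t ℕ.≤ m → fromℕ m ^ t * invFalling m t ≤ fromℕ 3 ^ t
m^t*invFalling≤3^t m       zero    t≤m         = ℚ.≤-refl
m^t*invFalling≤3^t (suc m) (suc t) (ℕ.s≤s t≤m) = begin
  fromℕ (suc m) * fromℕ (suc m) ^ t * (1/1+ m * invFalling m t)
    ≡⟨ solve 4 (λ a x b g → a :* x :* (b :* g) := a :* (b :* (x :* g))) refl
         (fromℕ (suc m)) (fromℕ (suc m) ^ t) (1/1+ m) (invFalling m t) ⟩
  fromℕ (suc m) * (1/1+ m * (fromℕ (suc m) ^ t * invFalling m t))
    ≡⟨ fromℕ*1/1+* m (fromℕ (suc m) ^ t * invFalling m t) ⟩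
  fromℕ (suc m) ^ t * invFalling m t
    ≤⟨ *-monoʳ-≤ (invFalling-nonNeg m t) (subst₂ _≤_ (fromℕ-^ (suc m) t)
         (trans (fromℕ-* 3 (m ℕ.^ t)) (cong (fromℕ 3 *_) (fromℕ-^ m t))) (fromℕ-mono ([1+m]^t≤3m^t m t t≤m))) ⟩
  fromℕ 3 * fromℕ m ^ t * invFalling m t
    ≡⟨ ℚ.*-assoc (fromℕ 3) (fromℕ m ^ t) (invFalling m t) ⟩
  fromℕ 3 * (fromℕ m ^ t * invFalling m t)
    ≤⟨ *-monoˡ-≤ (fromℕ-nonNeg 3) (m^t*invFalling≤3^t m t t≤m) ⟩
  fromℕ 3 * fromℕ 3 ^ t ∎
  where open ℚ.≤-Reasoning

invFalling≤ : ∀ k t → t ℕ.≤ suc k → invFalling (suc k) t ≤ (fromℕ 3 * 1/1+ k) ^ t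
invFalling≤ k t t≤ = begin
  invFalling (suc k) t
    ≡⟨ sym (trans (cong (_* invFalling (suc k) t) (^-1 t)) (ℚ.*-identityˡ (invFalling (suc k) t))) ⟩
  (fromℕ (suc k) * 1/1+ k) ^ t * invFalling (suc k) t
    ≡⟨ cong (_* invFalling (suc k) t) (^-distrib-* (fromℕ (suc k)) (1/1+ k) t) ⟩
  fromℕ (suc k) ^ t * 1/1+ k ^ t * invFalling (suc k) t
    ≡⟨ solve 3 (λ a b c → a :* b :* c := b :* (a :* c)) refl (fromℕ (suc k) ^ t) (1/1+ k ^ t) (invFalling (suc k) t) ⟩
  1/1+ k ^ t * (fromℕ (suc k) ^ t * invFalling (suc k) t)
    ≤⟨ *-monoˡ-≤ (^-nonNeg t (1/1+-nonNeg k)) (m^t*invFalling≤3^t (suc k) t t≤) ⟩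
  1/1+ k ^ t * fromℕ 3 ^ t
    ≡⟨ trans (ℚ.*-comm (1/1+ k ^ t) (fromℕ 3 ^ t)) (sym (^-distrib-* (fromℕ 3) (1/1+ k) t)) ⟩
  (fromℕ 3 * 1/1+ k) ^ t ∎
  where
  open ℚ.≤-Reasoning
  ^-1 : ∀ t → (fromℕ (suc k) * 1/1+ k) ^ t ≡ 1ℚ
  ^-1 zero    = refl
  ^-1 (suc t) = trans (cong₂ _*_ (fromℕ*1/1+ k) (^-1 t)) refl

-- First-moment bounds from covers

counting-≥ : ∀ {m} {f : Subset m → ℚ} → (∀ T → 0ℚ ≤ f T) → ∀ T → f T ≤ ∫ (counting m) f
counting-≥ 0≤f []            = ℚ.≤-refl
counting-≥ {suc m} {f} 0≤f (outside ∷ T) = subst (_≤ ∫ (counting (suc m)) f) (ℚ.+-identityʳ (f (outside ∷ T)))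
  (ℚ.+-mono-≤ (counting-≥ (0≤f ∘ (outside ∷_)) T) (∫-nonNeg (counting m) (0≤f ∘ (inside ∷_))))
counting-≥ {suc m} {f} 0≤f (inside ∷ T) = subst (_≤ ∫ (counting (suc m)) f) (ℚ.+-identityˡ (f (inside ∷ T)))
  (ℚ.+-mono-≤ (∫-nonNeg (counting m) (0≤f ∘ (outside ∷_))) (counting-≥ (0≤f ∘ (inside ∷_)) T))

1≤cover-sum : ∀ {m} (𝓖 : Family m) S → Contains 𝓖 S → 1ℚ ≤ ∫ (counting m) (λ T → ⟦ member? 𝓖 T ⟧ * ⟦ T ⊆? S ⟧)
1≤cover-sum 𝓖 S (T , T∈ , T⊆S) = subst (_≤ _) (cong₂ _*_ (⟦⟧-true (member? 𝓖 T) T∈) (⟦⟧-true (T ⊆? S) T⊆S))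
  (counting-≥ (λ T → *-nonNeg (⟦⟧-nonNeg (member? 𝓖 T)) (⟦⟧-nonNeg (T ⊆? S))) T)

coloured≤cost : ∀ {n k} (𝓕 : Family n) → Increasing 𝓕 → ∀ p c (kc≡p : fromℕ k * value c ≡ value p) 𝓖 → Covers 𝓖 𝓕 →
  ∫ (coloured p c kc≡p n) (λ S → ⟦ member? (rainbow 𝓕 k) S ⟧) ≤ cost (value p) 𝓖
coloured≤cost {n} {k} 𝓕 incr p c kc≡p 𝓖 cov = begin
  ∫ ν (λ S → ⟦ member? (rainbow 𝓕 k) S ⟧)
    ≤⟨ ∫-mono ν (λ S → term S (member? (rainbow 𝓕 k) S)) ⟩
  ∫ ν (λ S → ∫ (counting n) (λ T → ⟦ member? 𝓖 T ⟧ * ⟦ T ⊆? image (point n k) S ⟧))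
    ≡⟨ ∫-counting-comm ν n (λ S T → ⟦ member? 𝓖 T ⟧ * ⟦ T ⊆? image (point n k) S ⟧) ⟩
  ∫ (counting n) (λ T → ∫ ν (λ S → ⟦ member? 𝓖 T ⟧ * ⟦ T ⊆? image (point n k) S ⟧))
    ≡⟨ ∫-cong (counting n) (λ T → trans (∫-* ν ⟦ member? 𝓖 T ⟧ (λ S → ⟦ T ⊆? image (point n k) S ⟧))
         (cong (⟦ member? 𝓖 T ⟧ *_) (coloured-⊆-image p c kc≡p n T))) ⟩
  cost (value p) 𝓖 ∎
  where
  open ℚ.≤-Reasoning
  ν = coloured p c kc≡p n
  term : ∀ S (d : Dec (S ∈ᶠ rainbow 𝓕 k)) → ⟦ d ⟧ ≤ ∫ (counting n) (λ T → ⟦ member? 𝓖 T ⟧ * ⟦ T ⊆? image (point n k) S ⟧)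
  term S (no _)  = ∫-nonNeg (counting n) (λ T → *-nonNeg (⟦⟧-nonNeg (member? 𝓖 T)) (⟦⟧-nonNeg (T ⊆? image (point n k) S)))
  term S (yes (R , (_ , (imR∈ , _) , _) , R⊆S)) =
    1≤cover-sum 𝓖 (image (point n k) S) (cov (incr imR∈ (image-mono (point n k) R⊆S)))

-- Colouring a minimal set uniformly at random spreads a cover 𝓖 of the rainbow edges into
-- a fractional cover of 𝓕, so the first moment bound applies to 𝓕 itself.
fractional-cover : ∀ {n} k (𝓕 : Family n) → (∀ {S} → S ∈ᶠ minimal 𝓕 → ∣ S ∣ ℕ.≤ suc k) →
  ∀ a 𝓖 → Covers 𝓖 (rainbowEdges 𝓕 (suc k)) →
  ∫ (bernoulli a n) (λ A → ⟦ contains? (minimal 𝓕) A ⟧) ≤ cost (fromℕ 3 * 1/1+ k * value a) 𝓖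
fractional-cover {n} k 𝓕 size a 𝓖 cov = begin
  ∫ β (λ A → ⟦ contains? (minimal 𝓕) A ⟧)
    ≤⟨ ∫-mono β (λ A → pointwise A (contains? (minimal 𝓕) A)) ⟩
  ∫ β (λ A → ∫ # (λ T → ⟦ member? 𝓖 T ⟧ * (κ ^ ∣ T ∣ * ⟦ fits? A T ⟧)))
    ≡⟨ ∫-counting-comm β (n ℕ.* suc k) (λ A T → ⟦ member? 𝓖 T ⟧ * (κ ^ ∣ T ∣ * ⟦ fits? A T ⟧)) ⟩
  ∫ # (λ T → ∫ β (λ A → ⟦ member? 𝓖 T ⟧ * (κ ^ ∣ T ∣ * ⟦ fits? A T ⟧)))
    ≡⟨ ∫-cong # (λ T → trans (∫-* β ⟦ member? 𝓖 T ⟧ (λ A → κ ^ ∣ T ∣ * ⟦ fits? A T ⟧))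
                             (cong (⟦ member? 𝓖 T ⟧ *_) (∫-* β (κ ^ ∣ T ∣) (λ A → ⟦ fits? A T ⟧)))) ⟩
  ∫ # (λ T → ⟦ member? 𝓖 T ⟧ * (κ ^ ∣ T ∣ * ∫ β (λ A → ⟦ fits? A T ⟧)))
    ≤⟨ ∫-mono # (λ T → *-monoˡ-≤ (⟦⟧-nonNeg (member? 𝓖 T)) (ℚ.≤-trans
         (*-monoˡ-≤ (^-nonNeg ∣ T ∣ 0≤κ) (fits-prob T (distinctOn? pt T)))
         (ℚ.≤-reflexive (sym (^-distrib-* κ (value a) ∣ T ∣))))) ⟩
  cost (κ * value a) 𝓖 ∎
  where
  open ℚ.≤-Reasoning
  β  = bernoulli a n
  #  = counting (n ℕ.* suc k)
  pt = point n (suc k)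
  κ  = fromℕ 3 * 1/1+ k
  0≤κ : 0ℚ ≤ κ
  0≤κ = *-nonNeg (fromℕ-nonNeg 3) (1/1+-nonNeg k)
  -- A `T` with two colours at some point lies in no colouring. Any other `T` has as many points as
  -- elements, so its points all lie in a Bernoulli(a) set with probability at most a^∣T∣.
  Fits : Subset n → Subset (n ℕ.* suc k) → Set
  Fits A T = DistinctOn pt T × image pt T ⊆ A
  fits? : ∀ A T → Dec (Fits A T)
  fits? A T = distinctOn? pt T ×-dec image pt T ⊆? A
  fits-prob : ∀ T → Dec (DistinctOn pt T) → ∫ β (λ A → ⟦ fits? A T ⟧) ≤ value a ^ ∣ T ∣
  fits-prob T (no ¬d) = ℚ.≤-trans (ℚ.≤-reflexive (∫-≡0 β (λ A → ⟦⟧-false (fits? A T) (¬d ∘ proj₁)))) (^-nonNeg ∣ T ∣ (0≤p a))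
  fits-prob T (yes d) = begin
    ∫ β (λ A → ⟦ fits? A T ⟧)          ≤⟨ ∫-mono β (λ A → ⟦⟧-mono (fits? A T) (image pt T ⊆? A) proj₂) ⟩
    ∫ β (λ A → ⟦ image pt T ⊆? A ⟧)    ≡⟨ bernoulli-⊇ a (image pt T) ⟩
    value a ^ ∣ image pt T ∣           ≤⟨ ^-anti (0≤p a) (p≤1 a) (∣S∣≤∣image∣ pt T d) ⟩
    value a ^ ∣ T ∣                    ∎
  colour-prob : ∀ {S A} → S ∈ᶠ minimal 𝓕 → S ⊆ A → ∀ T → Dec (Fits S T) →
    ∫ (injective S (⊤ {suc k})) (λ R → ⟦ T ⊆? R ⟧) ≤ κ ^ ∣ T ∣ * ⟦ fits? A T ⟧
  colour-prob {S} {A} S∈ S⊆A T (no ¬fits) = ℚ.≤-trans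
    (injective-≤0 S ⊤ (λ R col → ⟦⟧-false (T ⊆? R) (λ T⊆R → ¬fits
      (distinctOn-⊆ pt T⊆R (colouring-distinct col) , λ {x} → subst (image pt T ⊆_) (colouring-image col) (image-mono pt T⊆R) {x}))))
    (*-nonNeg (^-nonNeg ∣ T ∣ 0≤κ) (⟦⟧-nonNeg (fits? A T)))
  colour-prob {S} {A} S∈ S⊆A T (yes (d , im⊆)) = begin
    ∫ (injective S ⊤) (λ R → ⟦ T ⊆? R ⟧)
      ≤⟨ injective-⊇ S ⊤ T (subst (∣ S ∣ ℕ.≤_) (sym (∣⊤∣≡n (suc k))) (size S∈)) ⟩
    invFalling (∣ ⊤ {suc k} ∣) (∣ T ∣)
      ≡⟨ cong (λ z → invFalling z ∣ T ∣) (∣⊤∣≡n (suc k)) ⟩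
    invFalling (suc k) ∣ T ∣
      ≤⟨ invFalling≤ k ∣ T ∣ (ℕ.≤-trans (∣S∣≤∣image∣ pt T d) (ℕ.≤-trans (p⊆q⇒∣p∣≤∣q∣ im⊆) (size S∈))) ⟩
    κ ^ ∣ T ∣
      ≡⟨ sym (trans (cong (κ ^ ∣ T ∣ *_) (⟦⟧-true (fits? A T) (d , λ {x} → ⊆-trans im⊆ S⊆A {x}))) (ℚ.*-identityʳ (κ ^ ∣ T ∣))) ⟩
    κ ^ ∣ T ∣ * ⟦ fits? A T ⟧ ∎
  pointwise : ∀ A (d : Dec (Contains (minimal 𝓕) A)) →
    ⟦ d ⟧ ≤ ∫ # (λ T → ⟦ member? 𝓖 T ⟧ * (κ ^ ∣ T ∣ * ⟦ fits? A T ⟧))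
  pointwise A (no _) = ∫-nonNeg # (λ T → *-nonNeg (⟦⟧-nonNeg (member? 𝓖 T))
    (*-nonNeg (^-nonNeg ∣ T ∣ 0≤κ) (⟦⟧-nonNeg (fits? A T))))
  -- A single minimal set `S ⊆ A` suffices: every injective colouring of `S` is a rainbow edge,
  -- hence contains a member of `𝓖`, and averaging over the colourings turns this into the weights
  -- `κ ^ ∣ T ∣`.
  pointwise A (yes (S , S∈ , S⊆A)) = begin
    1ℚ
      ≤⟨ injective-1 S ⊤ (subst (∣ S ∣ ℕ.≤_) (sym (∣⊤∣≡n (suc k))) (size S∈)) ⟩
    ∫ ν (λ _ → 1ℚ)
      ≤⟨ injective-mono S ⊤ (λ R col → 1≤cover-sum 𝓖 R (cov (colouring-distinct col ,
           subst (_∈ᶠ minimal 𝓕) (sym (colouring-image col)) S∈ , colouring-rainbow col))) ⟩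
    ∫ ν (λ R → ∫ # (λ T → ⟦ member? 𝓖 T ⟧ * ⟦ T ⊆? R ⟧))
      ≡⟨ ∫-counting-comm ν (n ℕ.* suc k) (λ R T → ⟦ member? 𝓖 T ⟧ * ⟦ T ⊆? R ⟧) ⟩
    ∫ # (λ T → ∫ ν (λ R → ⟦ member? 𝓖 T ⟧ * ⟦ T ⊆? R ⟧))
      ≡⟨ ∫-cong # (λ T → ∫-* ν ⟦ member? 𝓖 T ⟧ (λ R → ⟦ T ⊆? R ⟧)) ⟩
    ∫ # (λ T → ⟦ member? 𝓖 T ⟧ * ∫ ν (λ R → ⟦ T ⊆? R ⟧))
      ≤⟨ ∫-mono # (λ T → *-monoˡ-≤ (⟦⟧-nonNeg (member? 𝓖 T)) (colour-prob S∈ S⊆A T (fits? S T))) ⟩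
    ∫ # (λ T → ⟦ member? 𝓖 T ⟧ * (κ ^ ∣ T ∣ * ⟦ fits? A T ⟧)) ∎
    where
    ν : Measure (Subset (n ℕ.* suc k))
    ν = injective S ⊤

-- The upper bound at a rational p

¾ : ℚ
¾ = ½ + ½ * ½

-- The budget c = ½ turns the bound 1/8 into a failure probability of at most 1/4.
park-pham-¾ : ∀ j p₀ p → value p ≡ fromℕ j * value p₀ → ∀ {m} (𝓗 : Family m) →
  (∀ {S} → S ∈ᶠ 𝓗 → ∣ S ∣ ℕ.< 2 ℕ.^ j) →
  (∀ 𝓖 → Covers 𝓖 𝓗 → ½ ≤ cost (1/64 * value p₀) 𝓖) →
  ¾ ≤ ∫ (bernoulli p m) (λ W → ⟦ contains? 𝓗 W ⟧)
park-pham-¾ j p₀ p p≡ {m} 𝓗 size dear = 0≤-⇒≤ (subst (0ℚ ≤_) (algebra (½ ^ j) x)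
  (+-nonNeg (*-nonNeg (ℚ.≤-trans 0≤1 1≤2) (≤⇒0≤- fail≤)) (*-nonNeg {½ * ½} (ℚ.≤ᵇ⇒≤ _) (½^-nonNeg j))))
  where
  x = ∫ (bernoulli p m) (λ W → ⟦ contains? 𝓗 W ⟧)
  fail≡ : ∫ (bernoulli p m) (fails 𝓗) ≡ 1ℚ - x
  fail≡ = trans (∫-cong (bernoulli p m) (λ W → ⟦⟧-¬ (contains? 𝓗 W)))
    (trans (∫-- (bernoulli p m) (λ _ → 1ℚ) (λ W → ⟦ contains? 𝓗 W ⟧)) (cong (_- x) (bernoulli-1 p m)))
  fail≤ : ½ * (1ℚ - x) ≤ 1/8 * (1ℚ - ½ ^ j)
  fail≤ = subst (λ z → ½ * z ≤ 1/8 * (1ℚ - ½ ^ j)) fail≡ (park-pham j p₀ p p≡ 𝓗 size ½ dear)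
  algebra : ∀ h x → 2ℚ * (1/8 * (1ℚ - h) - ½ * (1ℚ - x)) + ½ * ½ * h ≡ x - ¾
  algebra = solve 2 (λ h x → con 2ℚ :* (con 1/8 :* (con 1ℚ :- h) :- con ½ :* (con 1ℚ :- x)) :+ con (½ * ½) :* h := x :- con ¾) refl

infixl 7 _*ₚ_
_*ₚ_ : Probability → Probability → Probability
(p *ₚ q) .value = value p * value q
(p *ₚ q) .0≤p   = *-nonNeg (0≤p p) (0≤p q)
(p *ₚ q) .p≤1   = *-mono-≤ (0≤p p) 0≤1 (p≤1 p) (p≤1 q)

unit : ℕ → Probability
unit m = prob (1/1+ m) (1/1+-nonNeg m) (1/1+-anti {0} {m} ℕ.z≤n)

perColour : ∀ k (p : Probability) → fromℕ (suc k) * value (unit k *ₚ p) ≡ value p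
perColour k p = fromℕ*1/1+* k (value p)

-- With rounds of rate s₁ = p/(kj) on coloured points and s₂ = p/(192j²) on points, a cover
-- of the rainbow edges cheap at s₁/64 bounds the 𝓕-probability at js₂ = (k/3)(s₁/64).
rainbow-likely : ∀ {n} k j (𝓕 : Family n) → (∀ {S} → S ∈ᶠ minimal 𝓕 → ∣ S ∣ ℕ.≤ suc k) →
  (∀ {S} → S ∈ᶠ minimal 𝓕 → ∣ S ∣ ℕ.< 2 ℕ.^ suc j) → ∀ p →
  (∀ 𝓖 → Covers 𝓖 𝓕 → ½ ≤ cost (1/64 * (1/1+ 191 * (1/1+ j * (1/1+ j * value p)))) 𝓖) →
  ¾ ≤ ∫ (coloured p (unit k *ₚ p) (perColour k p) n) (λ S → ⟦ member? (rainbow 𝓕 (suc k)) S ⟧)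
rainbow-likely {n} k j 𝓕 size≤ size< p dear = ℚ.≤-trans
  (park-pham-¾ (suc j) s₁ c c≡ (rainbowEdges 𝓕 (suc k)) edge-size dear′)
  (bernoulli≤coloured p c (perColour k p) n (member? (rainbow 𝓕 (suc k)))
    (λ { S⊆T (R , R∈ , R⊆S) → R , R∈ , λ {x} → ⊆-trans R⊆S S⊆T {x} })
    (λ { (R , R∈ , R⊆S) → R , R⊆S , (R , R∈ , ⊆-refl) , proj₁ R∈ }))
  where
  c  = unit k *ₚ p
  s₁ = unit j *ₚ c
  s₂ = unit 191 *ₚ (unit j *ₚ (unit j *ₚ p))
  a  = unit 191 *ₚ (unit j *ₚ p)
  c≡ : value c ≡ fromℕ (suc j) * value s₁
  c≡ = sym (fromℕ*1/1+* j (value c))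
  a≡ : value a ≡ fromℕ (suc j) * value s₂
  a≡ = sym (trans (solve 4 (λ J x y z → J :* (x :* (y :* z)) := J :* (y :* (x :* z))) refl
    (fromℕ (suc j)) (1/1+ 191) (1/1+ j) (1/1+ j * value p)) (fromℕ*1/1+* j (value a)))
  edge-size : ∀ {R} → R ∈ᶠ rainbowEdges 𝓕 (suc k) → ∣ R ∣ ℕ.< 2 ℕ.^ suc j
  edge-size {R} (d , im∈ , _) = ℕ.≤-<-trans (∣S∣≤∣image∣ (point n (suc k)) R d) (size< im∈)
  -- Here 192 = 3 · 64: the 3 cancels the loss of the random colouring, and the 64 is the one that
  -- Park-Pham asks for in the rainbow family.
  rate≡ : fromℕ 3 * 1/1+ k * value a ≡ 1/64 * value s₁
  rate≡ = solve 3 (λ x y p → con (fromℕ 3) :* x :* (con (1/1+ 191) :* (y :* p)) := con 1/64 :* (y :* (x :* p)))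
    refl (1/1+ k) (1/1+ j) (value p)
  likely : ¾ ≤ ∫ (bernoulli a n) (λ A → ⟦ contains? (minimal 𝓕) A ⟧)
  likely = park-pham-¾ (suc j) s₂ a a≡ (minimal 𝓕) size< (λ 𝓖 cov → dear 𝓖 (λ S∈ → below 𝓖 cov (minimal-below 𝓕 S∈)))
    where
    below : ∀ 𝓖 → Covers 𝓖 (minimal 𝓕) → ∀ {S} → ∃[ T ] (T ∈ᶠ minimal 𝓕 × T ⊆ S) → ∃[ R ] (R ∈ᶠ 𝓖 × R ⊆ S)
    below 𝓖 cov (T , T∈ , T⊆S) with R , R∈ , R⊆T ← cov T∈ = R , R∈ , ⊆-trans R⊆T T⊆S
  dear′ : ∀ 𝓖 → Covers 𝓖 (rainbowEdges 𝓕 (suc k)) → ½ ≤ cost (1/64 * value s₁) 𝓖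
  dear′ 𝓖 cov = ℚ.≤-trans (ℚ.≤ᵇ⇒≤ _) (ℚ.≤-trans likely
    (subst (λ r → ∫ (bernoulli a n) (λ A → ⟦ contains? (minimal 𝓕) A ⟧) ≤ cost r 𝓖) rate≡
      (fractional-cover k 𝓕 size≤ a 𝓖 cov)))

-- Real numbers

∣-∣<⇒< : ∀ {a b ε} → ℚ.∣ a - b ∣ < ε → a < b + ε
∣-∣<⇒< {a} {b} {ε} h = subst (_< b + ε) (a+[b-a] b a) (ℚ.+-monoʳ-< b (ℚ.≤-<-trans (p≤∣p∣ (a - b)) h))
  where
  p≤∣p∣ : ∀ p → p ≤ ℚ.∣ p ∣
  p≤∣p∣ p with ℚ.≤-total 0ℚ p
  ... | inj₁ 0≤p = ℚ.≤-reflexive (sym (ℚ.0≤p⇒∣p∣≡p 0≤p))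
  ... | inj₂ p≤0 = ℚ.≤-trans p≤0 (ℚ.0≤∣p∣ p)

∣-∣-comm : ∀ a b → ℚ.∣ a - b ∣ ≡ ℚ.∣ b - a ∣
∣-∣-comm a b = trans (sym (ℚ.∣-p∣≡∣p∣ (a - b))) (cong ℚ.∣_∣ (solve 2 (λ a b → :- (a :- b) := b :- a) refl a b))

<⇒∣-∣< : ∀ {a b ε} → a < b + ε → b < a + ε → ℚ.∣ a - b ∣ < ε
<⇒∣-∣< {a} {b} {ε} a<b+ε b<a+ε with ℚ.∣p∣≡p∨∣p∣≡-p (a - b)
... | inj₁ e = subst₂ _<_ (sym e) (cancel b ε) (ℚ.+-monoˡ-< (- b) a<b+ε)
  where
  cancel : ∀ b ε → b + ε - b ≡ ε
  cancel = solve 2 (λ b ε → b :+ ε :- b := ε) refl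
... | inj₂ e = subst₂ _<_ (trans (flip a b) (sym e)) (cancel a ε) (ℚ.+-monoˡ-< (- a) b<a+ε)
  where
  flip : ∀ a b → b - a ≡ - (a - b)
  flip = solve 2 (λ a b → b :- a := :- (a :- b)) refl
  cancel : ∀ b ε → b + ε - b ≡ ε
  cancel = solve 2 (λ b ε → b :+ ε :- b := ε) refl

∣-∣-triangle : ∀ {a b c δ η} → ℚ.∣ a - b ∣ < δ → ℚ.∣ b - c ∣ < η → ℚ.∣ a - c ∣ < δ + η
∣-∣-triangle {a} {b} {c} h₁ h₂ = ℚ.≤-<-trans
  (subst (λ z → ℚ.∣ z ∣ ≤ ℚ.∣ a - b ∣ + ℚ.∣ b - c ∣)
    (solve 3 (λ a b c → a :- b :+ (b :- c) := a :- c) refl a b c) (ℚ.∣p+q∣≤∣p∣+∣q∣ (a - b) (b - c)))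
  (ℚ.+-mono-< h₁ h₂)

<-+-pos : ∀ a {ε} → 0ℚ < ε → a < a + ε
<-+-pos a {ε} 0<ε = subst (_< a + ε) (ℚ.+-identityʳ a) (ℚ.+-monoʳ-< a 0<ε)

≈-refl : ∀ {x} → x ≈ℝ x
≈-refl {x} ε 0<ε = 0 , λ n _ → subst (λ z → ℚ.∣ z ∣ < ε) (sym (ℚ.+-inverseʳ (seq x n))) 0<ε

≈-sym : ∀ {x y} → x ≈ℝ y → y ≈ℝ x
≈-sym {x} {y} x≈y ε 0<ε with x≈y ε 0<ε
... | N , h = N , λ n N≤n → subst (_< ε) (∣-∣-comm (seq x n) (seq y n)) (h n N≤n)

≈-trans : ∀ {x y z} → x ≈ℝ y → y ≈ℝ z → x ≈ℝ z
≈-trans {x} {y} {z} x≈y y≈z ε 0<ε with x≈y (½ * ε) (half-pos 0<ε) | y≈z (½ * ε) (half-pos 0<ε)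
... | M , h₁ | N , h₂ = M ℕ.⊔ N , λ n h → subst (ℚ.∣ seq x n - seq z n ∣ <_) (half+half ε)
  (∣-∣-triangle {seq x n} {seq y n} {seq z n} (h₁ n (ℕ.m⊔n≤o⇒m≤o M N h)) (h₂ n (ℕ.m⊔n≤o⇒n≤o M N h)))

≈⇒≤ : ∀ {x y} → x ≈ℝ y → x ≤ℝ y
≈⇒≤ {x} {y} x≈y ε 0<ε with x≈y ε 0<ε
... | N , h = N , λ n N≤n → ∣-∣<⇒< {seq x n} {seq y n} (h n N≤n)

≤ℝ-trans : ∀ {x y z} → x ≤ℝ y → y ≤ℝ z → x ≤ℝ z
≤ℝ-trans {x} {y} {z} x≤y y≤z ε 0<ε with x≤y (½ * ε) (half-pos 0<ε) | y≤z (½ * ε) (half-pos 0<ε)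
... | M , h₁ | N , h₂ = M ℕ.⊔ N , λ n h → subst (seq x n <_)
  (trans (ℚ.+-assoc (seq z n) (½ * ε) (½ * ε)) (cong (seq z n +_) (half+half ε)))
  (ℚ.<-trans (h₁ n (ℕ.m⊔n≤o⇒m≤o M N h)) (ℚ.+-monoˡ-< (½ * ε) (h₂ n (ℕ.m⊔n≤o⇒n≤o M N h))))

+-cong : ∀ {x x′ y y′} → x ≈ℝ x′ → y ≈ℝ y′ → x +ℝ y ≈ℝ x′ +ℝ y′
+-cong {x} {x′} {y} {y′} x≈ y≈ ε 0<ε with x≈ (½ * ε) (half-pos 0<ε) | y≈ (½ * ε) (half-pos 0<ε)
... | M , h₁ | N , h₂ = M ℕ.⊔ N , λ n h → subst₂ _<_
  (cong ℚ.∣_∣ (sym (sub-+ (seq x n) (seq y n) (seq x′ n) (seq y′ n)))) (half+half ε)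
  (ℚ.≤-<-trans (ℚ.∣p+q∣≤∣p∣+∣q∣ (seq x n - seq x′ n) (seq y n - seq y′ n))
    (ℚ.+-mono-< (h₁ n (ℕ.m⊔n≤o⇒m≤o M N h)) (h₂ n (ℕ.m⊔n≤o⇒n≤o M N h))))

1--cong : ∀ {x x′} → x ≈ℝ x′ → 1ℝ -ℝ x ≈ℝ 1ℝ -ℝ x′
1--cong {x} {x′} x≈ ε 0<ε with x≈ ε 0<ε
... | N , h = N , λ n N≤n → subst (λ z → ℚ.∣ z ∣ < ε)
  (solve 2 (λ a b → b :- a := (con 1ℚ :- a) :- (con 1ℚ :- b)) refl (seq x n) (seq x′ n))
  (subst (_< ε) (∣-∣-comm (seq x n) (seq x′ n)) (h n N≤n))

*-cong : ∀ {x x′ y y′} → x ≈ℝ x′ → y ≈ℝ y′ → x *ℝ y ≈ℝ x′ *ℝ y′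
*-cong {x} {x′} {y} {y′} x≈ y≈ ε 0<ε = bounded (bound {seq x} (cauchy x)) (bound {seq y′} (cauchy y′))
  where
  open ℚ.≤-Reasoning
  Bounded : ℝ → Set
  Bounded z = ∃[ B ] ∃[ N ] (0ℚ < B × ∀ n → N ℕ.≤ n → ℚ.∣ seq z n ∣ ≤ B)
  bounded : Bounded x → Bounded y′ → ∃[ N ] (∀ n → N ℕ.≤ n → ℚ.∣ seq x n * seq y n - seq x′ n * seq y′ n ∣ < ε)
  bounded (A , M₁ , 0<A , x≤A) (B , N₁ , 0<B , y′≤B) =
    M₁ ℕ.⊔ M₂ ℕ.⊔ (N₁ ℕ.⊔ N₂) , λ n h →
      let hM = ℕ.m⊔n≤o⇒m≤o (M₁ ℕ.⊔ M₂) (N₁ ℕ.⊔ N₂) h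
          hN = ℕ.m⊔n≤o⇒n≤o (M₁ ℕ.⊔ M₂) (N₁ ℕ.⊔ N₂) h
      in begin-strict
      ℚ.∣ seq x n * seq y n - seq x′ n * seq y′ n ∣
        ≡⟨ cong ℚ.∣_∣ (sub-* (seq x n) (seq y n) (seq x′ n) (seq y′ n)) ⟩
      ℚ.∣ seq x n * (seq y n - seq y′ n) + seq y′ n * (seq x n - seq x′ n) ∣
        ≤⟨ ℚ.∣p+q∣≤∣p∣+∣q∣ (seq x n * (seq y n - seq y′ n)) (seq y′ n * (seq x n - seq x′ n)) ⟩
      ℚ.∣ seq x n * (seq y n - seq y′ n) ∣ + ℚ.∣ seq y′ n * (seq x n - seq x′ n) ∣
        <⟨ ℚ.+-mono-<
             (*-bound {seq x n} {seq y n - seq y′ n} 0<A (x≤A n (ℕ.m⊔n≤o⇒m≤o M₁ M₂ hM)) (proj₂ y-near n (ℕ.m⊔n≤o⇒n≤o N₁ N₂ hN)))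
             (*-bound {seq y′ n} {seq x n - seq x′ n} 0<B (y′≤B n (ℕ.m⊔n≤o⇒m≤o N₁ N₂ hN)) (proj₂ x-near n (ℕ.m⊔n≤o⇒n≤o M₁ M₂ hM))) ⟩
      A * proj₁ α + B * proj₁ β ≡⟨ cong₂ _+_ (proj₂ (proj₂ α)) (proj₂ (proj₂ β)) ⟩
      ½ * ε + ½ * ε             ≡⟨ half+half ε ⟩
      ε                         ∎
    where
    α = quot A (½ * ε) 0<A (half-pos 0<ε)
    β = quot B (½ * ε) 0<B (half-pos 0<ε)
    y-near = y≈ (proj₁ α) (proj₁ (proj₂ α))
    x-near = x≈ (proj₁ β) (proj₁ (proj₂ β))
    N₂ = proj₁ y-near
    M₂ = proj₁ x-near

^-cong : ∀ {x x′} t → x ≈ℝ x′ → x ^ℝ t ≈ℝ x′ ^ℝ t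
^-cong {x} {x′} zero    x≈ = ≈-refl {1ℝ}
^-cong {x} {x′} (suc t) x≈ = *-cong {x} {x′} {x ^ℝ t} {x′ ^ℝ t} x≈ (^-cong {x} {x′} t x≈)

sum-cong : ∀ {A : Set} {f g : A → ℝ} → (∀ x → f x ≈ℝ g x) → ∀ xs → sumℝ (List.map f xs) ≈ℝ sumℝ (List.map g xs)
sum-cong         f≈g []       = ≈-refl {0ℝ}
sum-cong {f = f} {g} f≈g (x ∷ xs) =
  +-cong {f x} {g x} {sumℝ (List.map f xs)} {sumℝ (List.map g xs)} (f≈g x) (sum-cong {f = f} {g} f≈g xs)

if-cong : ∀ b {x x′ y} → x ≈ℝ x′ → (if b then x else y) ≈ℝ (if b then x′ else y)
if-cong true          x≈ = x≈
if-cong false {y = y} x≈ = ≈-refl {y}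

μ-cong : ∀ n k {p p′} → p ≈ℝ p′ → ∀ S → μ n k p S ≈ℝ μ n k p′ S
μ-cong n k {p} {p′} p≈ S = if-cong (does (distinctOn? (point n k) S)) {a *ℝ b} {a′ *ℝ b′} {0ℝ}
  (*-cong {a} {a′} {b} {b′}
    (^-cong {p *ℝ recip k} {p′ *ℝ recip k} ∣ S ∣ (*-cong {p} {p′} {recip k} {recip k} p≈ (≈-refl {recip k})))
    (^-cong {1ℝ -ℝ p} {1ℝ -ℝ p′} (n ℕ.∸ ∣ S ∣) (1--cong {p} {p′} p≈)))
  where
  a  = (p *ℝ recip k) ^ℝ ∣ S ∣
  a′ = (p′ *ℝ recip k) ^ℝ ∣ S ∣
  b  = (1ℝ -ℝ p) ^ℝ (n ℕ.∸ ∣ S ∣)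
  b′ = (1ℝ -ℝ p′) ^ℝ (n ℕ.∸ ∣ S ∣)

-- Constructively x ≤ y holds as soon as an eventual gap below x is refuted.
≤ℝ-by-gap : ∀ x y → (∀ ε → 0ℚ < ε → ∀ N → (∀ n → N ℕ.≤ n → seq y n + ε ≤ seq x n) → ⊥) → x ≤ℝ y
≤ℝ-by-gap x y no-gap ε 0<ε = by (seq x J ℚ.<? seq y J + ½ * ε)
  where
  open ℚ.≤-Reasoning
  -- One rational comparison at index `J` with threshold ε/2 decides. Oscillations of ε/8 in each
  -- sequence either keep the difference below ε from `J` on or leave a gap of ε/4.
  δ = ½ * (½ * (½ * ε))
  0<δ : 0ℚ < δ
  0<δ = half-pos (half-pos (half-pos 0<ε))
  M = proj₁ (cauchy x δ 0<δ)
  N = proj₁ (cauchy y δ 0<δ)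
  hx = proj₂ (cauchy x δ 0<δ)
  hy = proj₂ (cauchy y δ 0<δ)
  J = M ℕ.⊔ N
  M≤J = ℕ.m≤m⊔n M N
  N≤J = ℕ.m≤n⊔m M N
  by : Dec (seq x J < seq y J + ½ * ε) → ∃[ N ] (∀ n → N ℕ.≤ n → seq x n < seq y n + ε)
  by (yes near) = J , λ n J≤n → begin-strict
    seq x n                    <⟨ ∣-∣<⇒< {seq x n} {seq x J} (hx n J (ℕ.≤-trans M≤J J≤n) M≤J) ⟩
    seq x J + δ                <⟨ ℚ.+-monoˡ-< δ near ⟩
    seq y J + ½ * ε + δ        <⟨ ℚ.+-monoˡ-< δ (ℚ.+-monoˡ-< (½ * ε) (∣-∣<⇒< {seq y J} {seq y n} (hy J n N≤J (ℕ.≤-trans N≤J J≤n)))) ⟩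
    seq y n + δ + ½ * ε + δ    <⟨ <-+-pos (seq y n + δ + ½ * ε + δ) (half-pos (half-pos 0<ε)) ⟩
    seq y n + δ + ½ * ε + δ + ½ * (½ * ε)
      ≡⟨ solve 2 (λ b e → b :+ con ½ :* (con ½ :* (con ½ :* e)) :+ con ½ :* e :+ con ½ :* (con ½ :* (con ½ :* e)) :+ con ½ :* (con ½ :* e) := b :+ e) refl (seq y n) ε ⟩
    seq y n + ε ∎
  by (no far) = ⊥-elim (no-gap (½ * (½ * ε)) (half-pos (half-pos 0<ε)) J λ n J≤n → ℚ.<⇒≤ (begin-strict
    seq y n + ½ * (½ * ε)          <⟨ ℚ.+-monoˡ-< (½ * (½ * ε)) (∣-∣<⇒< {seq y n} {seq y J} (hy n J (ℕ.≤-trans N≤J J≤n) N≤J)) ⟩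
    seq y J + δ + ½ * (½ * ε)      ≡⟨ solve 2 (λ b e → b :+ con ½ :* (con ½ :* (con ½ :* e)) :+ con ½ :* (con ½ :* e)
                                        := b :+ con ½ :* e :- con ½ :* (con ½ :* (con ½ :* e))) refl (seq y J) ε ⟩
    seq y J + ½ * ε - δ            ≤⟨ ℚ.+-monoˡ-≤ (- δ) (ℚ.≮⇒≥ far) ⟩
    seq x J - δ                    <⟨ ℚ.+-monoˡ-< (- δ) (∣-∣<⇒< {seq x J} {seq x n} (hx J n M≤J (ℕ.≤-trans M≤J J≤n))) ⟩
    seq x n + δ - δ                ≡⟨ solve 2 (λ a d → a :+ d :- d := a) refl (seq x n) δ ⟩
    seq x n ∎))

-- Clamped sequences and termwise evaluation

-- Rational approximations of a number in [0,1] may leave the interval, whereas the measures need a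
-- genuine probability at every index.
clamp : ℚ → Probability
clamp a with ℚ.≤-total a 0ℚ | ℚ.≤-total a 1ℚ
... | inj₁ _   | _        = prob 0ℚ ℚ.≤-refl 0≤1
... | inj₂ 0≤a | inj₁ a≤1 = prob a 0≤a a≤1
... | inj₂ _   | inj₂ _   = prob 1ℚ 0≤1 ℚ.≤-refl

clamp-close : ∀ a {ε} → 0ℚ < ε → 0ℚ < a + ε → a < 1ℚ + ε → ℚ.∣ value (clamp a) - a ∣ < ε
clamp-close a {ε} 0<ε lo hi with ℚ.≤-total a 0ℚ | ℚ.≤-total a 1ℚ
... | inj₁ a≤0 | _        = <⇒∣-∣< {0ℚ} {a} lo (ℚ.≤-<-trans a≤0 (<-+-pos 0ℚ 0<ε))
... | inj₂ _   | inj₁ _   = <⇒∣-∣< {a} {a} (<-+-pos a 0<ε) (<-+-pos a 0<ε)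
... | inj₂ _   | inj₂ 1≤a = <⇒∣-∣< {1ℚ} {a} (ℚ.≤-<-trans 1≤a (<-+-pos a 0<ε)) hi

module _ {x : ℝ} (px : IsProbability x) where

  private
    near : ∀ ε → 0ℚ < ε → ∃[ N ] (∀ n → N ℕ.≤ n → ℚ.∣ value (clamp (seq x n)) - seq x n ∣ < ε)
    near ε 0<ε with proj₁ px ε 0<ε | proj₂ px ε 0<ε
    ... | M , lo | N , hi = M ℕ.⊔ N , λ n h →
      clamp-close (seq x n) 0<ε (lo n (ℕ.m⊔n≤o⇒m≤o M N h)) (hi n (ℕ.m⊔n≤o⇒n≤o M N h))

  clampℝ : ℝ
  clampℝ = mkℝ (λ n → value (clamp (seq x n))) cauchy-clamp
    where
    cauchy-clamp : Cauchy (λ n → value (clamp (seq x n)))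
    cauchy-clamp ε 0<ε = M ℕ.⊔ N , λ m n m≥ n≥ → subst (ℚ.∣ value (clamp (seq x m)) - value (clamp (seq x n)) ∣ <_)
      (solve 1 (λ e → con ½ :* (con ½ :* e) :+ con ½ :* e :+ con ½ :* (con ½ :* e) := e) refl ε)
      (∣-∣-triangle {value (clamp (seq x m))} {seq x n} {value (clamp (seq x n))}
        (∣-∣-triangle {value (clamp (seq x m))} {seq x m} {seq x n} (proj₂ x-near m (ℕ.m⊔n≤o⇒m≤o M N m≥))
          (proj₂ x-steady m n (ℕ.m⊔n≤o⇒n≤o M N m≥) (ℕ.m⊔n≤o⇒n≤o M N n≥)))
        (subst (_< ½ * (½ * ε)) (∣-∣-comm (value (clamp (seq x n))) (seq x n)) (proj₂ x-near n (ℕ.m⊔n≤o⇒m≤o M N n≥))))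
      where
      x-near = near (½ * (½ * ε)) (half-pos (half-pos 0<ε))
      x-steady = cauchy x (½ * ε) (half-pos 0<ε)
      M = proj₁ x-near
      N = proj₁ x-steady

  clampℝ-≈ : clampℝ ≈ℝ x
  clampℝ-≈ = near

seq-^ : ∀ x t N → seq (x ^ℝ t) N ≡ seq x N ^ t
seq-^ x zero    N = refl
seq-^ x (suc t) N = cong (seq x N *_) (seq-^ x t N)

listSum : {A : Set} → (A → ℚ) → List A → ℚ
listSum h []       = 0ℚ
listSum h (x ∷ xs) = h x + listSum h xs

listSum-++ : ∀ {A : Set} (h : A → ℚ) xs ys → listSum h (xs List.++ ys) ≡ listSum h xs + listSum h ys
listSum-++ h []       ys = sym (ℚ.+-identityˡ (listSum h ys))
listSum-++ h (x ∷ xs) ys = trans (cong (h x +_) (listSum-++ h xs ys)) (sym (ℚ.+-assoc (h x) (listSum h xs) (listSum h ys)))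

listSum-map : ∀ {A B : Set} (h : B → ℚ) (g : A → B) xs → listSum h (List.map g xs) ≡ listSum (h ∘ g) xs
listSum-map h g []       = refl
listSum-map h g (x ∷ xs) = cong (h (g x) +_) (listSum-map h g xs)

listSum-subsets : ∀ m (h : Subset m → ℚ) → listSum h (subsets m) ≡ ∫ (counting m) h
listSum-subsets zero    h = ℚ.+-identityʳ (h [])
listSum-subsets (suc m) h = trans (listSum-++ h (List.map (outside ∷_) (subsets m)) (List.map (inside ∷_) (subsets m)))
  (cong₂ _+_ (trans (listSum-map h (outside ∷_) (subsets m)) (listSum-subsets m (h ∘ (outside ∷_))))
             (trans (listSum-map h (inside ∷_) (subsets m)) (listSum-subsets m (h ∘ (inside ∷_)))))

seq-∑ᶠ : ∀ {m} (𝓖 : Family m) (f : Subset m → ℝ) N →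
  seq (∑ᶠ 𝓖 f) N ≡ ∫ (counting m) (λ T → ⟦ member? 𝓖 T ⟧ * seq (f T) N)
seq-∑ᶠ {m} 𝓖 f N = trans (go (subsets m)) (listSum-subsets m (λ T → ⟦ member? 𝓖 T ⟧ * seq (f T) N))
  where
  go : ∀ xs → seq (sumℝ (List.map f (List.filter (member? 𝓖) xs))) N ≡ listSum (λ T → ⟦ member? 𝓖 T ⟧ * seq (f T) N) xs
  go []       = refl
  go (T ∷ xs) = by (member? 𝓖 T)
    where
    rest = listSum (λ T → ⟦ member? 𝓖 T ⟧ * seq (f T) N) xs
    by : Dec (T ∈ᶠ 𝓖) → seq (sumℝ (List.map f (List.filter (member? 𝓖) (T ∷ xs)))) N ≡ ⟦ member? 𝓖 T ⟧ * seq (f T) N + rest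
    by (yes T∈) = trans (cong (λ ys → seq (sumℝ (List.map f ys)) N) (filter-accept (member? 𝓖) T∈))
      (cong₂ _+_ (sym (trans (cong (_* seq (f T) N) (⟦⟧-true (member? 𝓖 T) T∈)) (ℚ.*-identityˡ (seq (f T) N)))) (go xs))
    by (no T∉)  = trans (cong (λ ys → seq (sumℝ (List.map f ys)) N) (filter-reject (member? 𝓖) T∉))
      (trans (go xs) (sym (trans (cong (_+ rest) (trans (cong (_* seq (f T) N) (⟦⟧-false (member? 𝓖 T) T∉)) (ℚ.*-zeroˡ (seq (f T) N))))
        (ℚ.+-identityˡ rest))))

seq-cost : ∀ {m} (𝓖 : Family m) q N → seq (∑ᶠ 𝓖 (λ S → q ^ℝ ∣ S ∣)) N ≡ cost (seq q N) 𝓖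
seq-cost {m} 𝓖 q N = trans (seq-∑ᶠ 𝓖 (λ S → q ^ℝ ∣ S ∣) N)
  (∫-cong (counting m) (λ T → cong (⟦ member? 𝓖 T ⟧ *_) (seq-^ q ∣ T ∣ N)))

-- Real operations act term by term, so each term of the real measure is exactly the rational
-- measure at that term of x. This is how the rational estimates reach the reals.
seq-μᶠ : ∀ n k x N p → value p ≡ seq x N → ∀ (𝓕 : Family (n ℕ.* suc k)) →
  seq (μᶠ n (suc k) x 𝓕) N ≡ ∫ (coloured p (unit k *ₚ p) (perColour k p) n) (λ S → ⟦ member? 𝓕 S ⟧)
seq-μᶠ n k x N p p≡ 𝓕 = begin
  seq (μᶠ n (suc k) x 𝓕) N
    ≡⟨ seq-∑ᶠ 𝓕 (μ n (suc k) x) N ⟩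
  ∫ (counting (n ℕ.* suc k)) (λ S → ⟦ member? 𝓕 S ⟧ * seq (μ n (suc k) x S) N)
    ≡⟨ ∫-cong (counting (n ℕ.* suc k)) (λ S → trans (cong (⟦ member? 𝓕 S ⟧ *_) (seq-μ S)) (ℚ.*-comm ⟦ member? 𝓕 S ⟧ (w S))) ⟩
  ∫ (counting (n ℕ.* suc k)) (λ S → w S * ⟦ member? 𝓕 S ⟧)
    ≡⟨ ∫-weight p (unit k *ₚ p) (perColour k p) n (λ S → ⟦ member? 𝓕 S ⟧) ⟩
  ∫ (coloured p (unit k *ₚ p) (perColour k p) n) (λ S → ⟦ member? 𝓕 S ⟧) ∎
  where
  open ≡-Reasoning
  w = weight p (unit k *ₚ p) (perColour k p) n
  seq-if : ∀ b (y : ℝ) → seq (if b then y else 0ℝ) N ≡ (if b then seq y N else 0ℚ)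
  seq-if true  y = refl
  seq-if false y = refl
  seq-μ : ∀ S → seq (μ n (suc k) x S) N ≡ w S
  seq-μ S = trans (seq-if (does (distinctOn? (point n (suc k)) S)) _)
    (cong (if does (distinctOn? (point n (suc k)) S) then_else 0ℚ) (cong₂ _*_
      (trans (seq-^ (x *ℝ recip (suc k)) ∣ S ∣ N) (cong (_^ ∣ S ∣) (trans (ℚ.*-comm (seq x N) (1/1+ k)) (cong (1/1+ k *_) (sym p≡)))))
      (trans (seq-^ (1ℝ -ℝ x) (n ℕ.∸ ∣ S ∣) N) (cong (λ z → (1ℚ - z) ^ (n ℕ.∸ ∣ S ∣)) (sym p≡)))))

-- Logarithms

harmonic-mono : ∀ a {c d} → c ℕ.≤ d → harmonic a c ≤ harmonic a d
harmonic-mono a {zero}  {zero}  ℕ.z≤n       = ℚ.≤-refl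
harmonic-mono a {zero}  {suc d} ℕ.z≤n       = ℚ.≤-trans (harmonic-mono a (ℕ.z≤n {d})) (harmonic-snoc a d)
harmonic-mono a {suc c} {suc d} (ℕ.s≤s c≤d) = ℚ.+-monoʳ-≤ (1/1+ a) (harmonic-mono (suc a) c≤d)

harmonic-double : ∀ a → ½ ≤ harmonic (suc a) (suc a)
harmonic-double a = ℚ.≤-trans
  (cross-≥ (suc a) (a ℕ.+ suc a) 1 (ℕ.≤-reflexive (solveⁿ 1 (λ a → conⁿ 1 ⊞ (a ⊞ (conⁿ 1 ⊞ a)) ⊜ (conⁿ 1 ⊞ a) ⊠ conⁿ 2) refl a)))
  (harmonic-≥ (a ℕ.+ suc a) (suc a) (suc a) ℕ.≤-refl)

-- The number 2^j - 1, the length of the interval of integration for log 2^j, written without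
-- truncated subtraction.
mersenne : ℕ → ℕ
mersenne zero    = 0
mersenne (suc j) = suc (mersenne j ℕ.+ mersenne j)

1+mersenne : ∀ j → suc (mersenne j) ≡ 2 ℕ.^ j
1+mersenne zero    = refl
1+mersenne (suc j) = trans (solveⁿ 1 (λ x → conⁿ 2 ⊞ (x ⊞ x) ⊜ conⁿ 2 ⊠ (conⁿ 1 ⊞ x)) refl (mersenne j)) (cong (2 ℕ.*_) (1+mersenne j))

-- Cut at the points 2^i (a + 1): each of the j dyadic blocks contributes at least ½.
harmonic-2^ : ∀ j a → fromℕ j * ½ ≤ harmonic (suc a) (mersenne j ℕ.* suc a)
harmonic-2^ zero    a = ℚ.≤-reflexive (ℚ.*-zeroˡ ½)
harmonic-2^ (suc j) a = begin
  fromℕ (suc j) * ½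
    ≡⟨ fromℕ-suc-* j ½ ⟩
  ½ + fromℕ j * ½
    ≤⟨ ℚ.+-mono-≤ (harmonic-double a) (harmonic-2^ j (a ℕ.+ suc a)) ⟩
  harmonic (suc a) (suc a) + harmonic (suc a ℕ.+ suc a) (mersenne j ℕ.* (suc a ℕ.+ suc a))
    ≡⟨ sym (harmonic-++ (suc a) (suc a) (mersenne j ℕ.* (suc a ℕ.+ suc a))) ⟩
  harmonic (suc a) (suc a ℕ.+ mersenne j ℕ.* (suc a ℕ.+ suc a))
    ≡⟨ cong (harmonic (suc a)) (solveⁿ 2 (λ a x → a ⊞ x ⊠ (a ⊞ a) ⊜ (conⁿ 1 ⊞ (x ⊞ x)) ⊠ a) refl (suc a) (mersenne j)) ⟩
  harmonic (suc a) (mersenne (suc j) ℕ.* suc a) ∎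
  where open ℚ.≤-Reasoning

log-≥ : ∀ {m j} → 2 ℕ.^ j ℕ.≤ m → ∀ N → fromℕ j * ½ ≤ seq (log m) N
log-≥ {m} {j} 2^j≤m N = ℚ.≤-trans (harmonic-2^ j N) (harmonic-mono (suc N) (ℕ.*-monoˡ-≤ (suc N)
  (ℕ.∸-monoˡ-≤ 1 (subst (ℕ._≤ m) (sym (1+mersenne j)) 2^j≤m))))

binary-length : ∀ m → 2 ℕ.≤ m → ∃[ j ] (2 ℕ.^ suc j ℕ.≤ m × m ℕ.< 2 ℕ.^ suc (suc j))
binary-length (suc zero) (ℕ.s≤s ())
binary-length (suc (suc zero)) h = 0 , ℕ.≤-refl , ℕ.s≤s (ℕ.s≤s (ℕ.s≤s ℕ.z≤n))
binary-length (suc (suc (suc m))) h with binary-length (suc (suc m)) (ℕ.s≤s (ℕ.s≤s ℕ.z≤n))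
... | j , lo , hi with suc (suc (suc m)) ℕ.<? 2 ℕ.^ suc (suc j)
...   | yes hi′ = j , ℕ.m≤n⇒m≤1+n lo , hi′
...   | no  lo′ = suc j , ℕ.≮⇒≥ lo′ , ℕ.≤-trans (ℕ.s≤s hi) (ℕ.+-mono-≤ (ℕ.m^n>0 2 (suc (suc j))) (ℕ.m≤m+n (2 ℕ.^ suc (suc j)) 0))

-- Sizes of minimal sets and rescaling of costs

∈-subsets : ∀ {m} (S : Subset m) → S ∈ˡ subsets m
∈-subsets []            = here refl
∈-subsets (outside ∷ S) = ∈ˡ.∈-++⁺ˡ (∈ˡ.∈-map⁺ (outside ∷_) (∈-subsets S))
∈-subsets {suc m} (inside ∷ S)  = ∈ˡ.∈-++⁺ʳ (List.map (outside ∷_) (subsets m)) (∈ˡ.∈-map⁺ (inside ∷_) (∈-subsets S))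

∣minimal∣≤ℓ : ∀ {n} (𝓕 : Family n) {S} → S ∈ᶠ minimal 𝓕 → ∣ S ∣ ℕ.≤ ℓ 𝓕
∣minimal∣≤ℓ 𝓕 {S} S∈ = All.lookup (xs≤max 0 (List.map ∣_∣ (members (minimal 𝓕))))
  (∈ˡ.∈-map⁺ ∣_∣ (∈ˡ.∈-filter⁺ (member? (minimal 𝓕)) (∈-subsets S) S∈))

1≤cost : ∀ {m q} → 0ℚ ≤ q → (𝓖 : Family m) → ∀ {T} → T ∈ᶠ 𝓖 → ∣ T ∣ ≡ 0 → 1ℚ ≤ cost q 𝓖
1≤cost {q = q} 0≤q 𝓖 {T} T∈ ∣T∣≡0 = subst (_≤ cost q 𝓖)
  (cong₂ (λ a t → a * q ^ t) (⟦⟧-true (member? 𝓖 T) T∈) ∣T∣≡0)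
  (counting-≥ (λ T → *-nonNeg (⟦⟧-nonNeg (member? 𝓖 T)) (^-nonNeg ∣ T ∣ 0≤q)) T)

-- A nonempty `T` has at least one factor a to trade for tq, so lowering the rate lowers the cost by
-- a definite ratio. The empty set would keep its cost 1.
cost-shrink : ∀ {m a q t} → 0ℚ ≤ a → 0ℚ ≤ q → a ≤ t * q → a ≤ q → 0ℚ ≤ t → (𝓖 : Family m) →
  (∀ {T} → T ∈ᶠ 𝓖 → ¬ ∣ T ∣ ≡ 0) → cost a 𝓖 ≤ t * cost q 𝓖
cost-shrink {m} {a} {q} {t} 0≤a 0≤q a≤tq a≤q 0≤t 𝓖 nonempty = ℚ.≤-trans
  (∫-mono (counting m) (λ T → term T (member? 𝓖 T) ∣ T ∣ refl))
  (ℚ.≤-reflexive (∫-* (counting m) t (λ T → ⟦ member? 𝓖 T ⟧ * q ^ ∣ T ∣)))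
  where
  open ℚ.≤-Reasoning
  term : ∀ T (d : Dec (T ∈ᶠ 𝓖)) s → ∣ T ∣ ≡ s → ⟦ d ⟧ * a ^ s ≤ t * (⟦ d ⟧ * q ^ s)
  term T (no _)   s       _  = ℚ.≤-reflexive (solve 3 (λ x t y → con 0ℚ :* x := t :* (con 0ℚ :* y)) refl (a ^ s) t (q ^ s))
  term T (yes T∈) zero    eq = ⊥-elim (nonempty T∈ eq)
  term T (yes T∈) (suc s) eq = begin
    1ℚ * (a * a ^ s)        ≡⟨ ℚ.*-identityˡ (a * a ^ s) ⟩
    a * a ^ s               ≤⟨ *-mono-≤ 0≤a (^-nonNeg s 0≤q) a≤tq (^-mono s 0≤a a≤q) ⟩
    t * q * q ^ s           ≡⟨ solve 3 (λ t q x → t :* q :* x := t :* (con 1ℚ :* (q :* x))) refl t q (q ^ s) ⟩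
    t * (1ℚ * (q * q ^ s))  ∎

-- p = 64 (3 · 64) j² q, with a number of rounds j ≤ 4 log (ℓ ⊔ 2).
K₀ : ℚ
K₀ = fromℕ 64 * fromℕ 192 * (fromℕ 4 * fromℕ 4)

regroup : ∀ a A B b q J f l → a * A * (B * (b * (q * (J * (f * l) * (J * (f * l)))))) ≡
  A * (B * (J * (J * (a * b * (f * f) * q * (l * (l * 1ℚ))))))
regroup = solve 8 (λ a A B b q J f l → a :* A :* (B :* (b :* (q :* (J :* (f :* l) :* (J :* (f :* l)))))) :=
  A :* (B :* (J :* (J :* (a :* b :* (f :* f) :* q :* (l :* (l :* con 1ℚ))))))) refl

-- The two bounds for clamped reals

module _ {n : ℕ} (𝓕 : Family n) (incr : Increasing 𝓕) (k : ℕ) (ℓ≤k : ℓ 𝓕 ℕ.≤ suc k)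
         (x y : ℝ) (p q : ℕ → Probability) (p≡ : ∀ N → value (p N) ≡ seq x N) (q≡ : ∀ N → value (q N) ≡ seq y N)
         (half : μᶠ n (suc k) x (rainbow 𝓕 (suc k)) ≈ℝ ½ℝ)
         where

  private
    hit : ℕ → ℚ
    hit N = ∫ (coloured (p N) (unit k *ₚ p N) (perColour k (p N)) n) (λ S → ⟦ member? (rainbow 𝓕 (suc k)) S ⟧)

    hit-close : ∀ ε → 0ℚ < ε → ∃[ N ] (∀ m → N ℕ.≤ m → ℚ.∣ hit m - ½ ∣ < ε)
    hit-close ε 0<ε = proj₁ (half ε 0<ε) , λ m N≤m → subst (λ z → ℚ.∣ z - ½ ∣ < ε)
      (seq-μᶠ n k x m (p m) (p≡ m) (rainbow 𝓕 (suc k))) (proj₂ (half ε 0<ε) m N≤m)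

  -- If x stayed ε below y, a cover of cost about ½ at y would cost at most about (1 - ε)/2 at x,
  -- too little for an event of probability about ½.
  lower-bound : Small 𝓕 y → y ≤ℝ x
  lower-bound (𝓖 , cov , small) = ≤ℝ-by-gap y x refute
    where
    refute : ∀ ε → 0ℚ < ε → ∀ N → (∀ n → N ℕ.≤ n → seq x n + ε ≤ seq y n) → ⊥
    refute ε 0<ε N gap = ℚ.<-irrefl refl (begin-strict
      ½                                    <⟨ ∣-∣<⇒< {½} {hit m} (subst (_< δ) (∣-∣-comm (hit m) ½) (close m N₂≤m)) ⟩
      hit m + δ                            ≤⟨ ℚ.+-monoˡ-≤ δ (coloured≤cost 𝓕 incr (p m) (unit k *ₚ p m) (perColour k (p m)) 𝓖 cov) ⟩
      cost a 𝓖 + δ                         ≤⟨ ℚ.+-monoˡ-≤ δ (cost-shrink (0≤p (p m)) (0≤p (q m)) a≤tb a≤b 0≤t 𝓖 nonempty) ⟩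
      (1ℚ - ε) * cost b 𝓖 + δ              ≤⟨ ℚ.+-monoˡ-≤ δ (*-monoˡ-≤ 0≤t (ℚ.<⇒≤ cost<)) ⟩
      (1ℚ - ε) * (½ + δ) + δ               ≤⟨ 0≤-⇒≤ (subst (0ℚ ≤_) (algebra ε) (+-nonNeg (ℚ.<⇒≤ (half-pos (half-pos 0<ε)))
                                                (*-nonNeg (ℚ.<⇒≤ 0<ε) (ℚ.<⇒≤ 0<δ)))) ⟩
      ½                                    ∎)
      where
      open ℚ.≤-Reasoning
      -- The two approximation errors amount to at most 2δ = ε/4, less than the gain ε/2 from the
      -- shrunken cost.
      δ = ½ * (½ * (½ * ε))
      0<δ : 0ℚ < δ
      0<δ = half-pos (half-pos (half-pos 0<ε))
      N₁ = proj₁ (small δ 0<δ)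
      N₂ = proj₁ (hit-close δ 0<δ)
      cheap = proj₂ (small δ 0<δ)
      close = proj₂ (hit-close δ 0<δ)
      m = N ℕ.⊔ (N₁ ℕ.⊔ N₂)
      N₁≤m = ℕ.≤-trans (ℕ.m≤m⊔n N₁ N₂) (ℕ.m≤n⊔m N (N₁ ℕ.⊔ N₂))
      N₂≤m = ℕ.≤-trans (ℕ.m≤n⊔m N₁ N₂) (ℕ.m≤n⊔m N (N₁ ℕ.⊔ N₂))
      a = value (p m)
      b = value (q m)
      gap′ : a + ε ≤ b
      gap′ = subst₂ (λ u v → u + ε ≤ v) (sym (p≡ m)) (sym (q≡ m)) (gap m (ℕ.m≤m⊔n N (N₁ ℕ.⊔ N₂)))
      a≤b : a ≤ b
      a≤b = ℚ.≤-trans (ℚ.<⇒≤ (<-+-pos a 0<ε)) gap′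
      ε≤1 : ε ≤ 1ℚ
      ε≤1 = ℚ.≤-trans (subst (_≤ a + ε) (ℚ.+-identityˡ ε) (ℚ.+-monoˡ-≤ ε (0≤p (p m)))) (ℚ.≤-trans gap′ (p≤1 (q m)))
      0≤t : 0ℚ ≤ 1ℚ - ε
      0≤t = ≤⇒0≤- ε≤1
      -- The additive gap becomes multiplicative because b ≤ 1: b - ε ≤ b - εb.
      a≤tb : a ≤ (1ℚ - ε) * b
      a≤tb = 0≤-⇒≤ (subst (0ℚ ≤_)
        (solve 3 (λ a b e → b :- (a :+ e) :+ e :* (con 1ℚ :- b) := (con 1ℚ :- e) :* b :- a) refl a b ε)
        (+-nonNeg (≤⇒0≤- gap′) (*-nonNeg (ℚ.<⇒≤ 0<ε) (≤⇒0≤- (p≤1 (q m))))))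
      cost< : cost b 𝓖 < ½ + δ
      cost< = subst (_< ½ + δ) (trans (seq-cost 𝓖 y m) (cong (λ z → cost z 𝓖) (sym (q≡ m)))) (cheap m N₁≤m)
      δ≤½ : δ ≤ ½
      δ≤½ = ℚ.≤-trans (*-monoˡ-≤ {c = ½} (ℚ.≤ᵇ⇒≤ _) (*-monoˡ-≤ {c = ½} (ℚ.≤ᵇ⇒≤ _) (*-monoˡ-≤ {c = ½} (ℚ.≤ᵇ⇒≤ _) ε≤1))) (ℚ.≤ᵇ⇒≤ _)
      -- The empty set would cost 1, but the total is below `½ + δ ≤ 1`.
      nonempty : ∀ {T} → T ∈ᶠ 𝓖 → ¬ ∣ T ∣ ≡ 0
      nonempty T∈ ∣T∣≡0 = ℚ.<-irrefl refl (ℚ.≤-<-trans (1≤cost (0≤p (q m)) 𝓖 T∈ ∣T∣≡0)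
        (ℚ.<-≤-trans cost< (ℚ.+-monoʳ-≤ ½ δ≤½)))
      algebra : ∀ ε → ½ * (½ * ε) + ε * (½ * (½ * (½ * ε))) ≡ ½ - ((1ℚ - ε) * (½ + ½ * (½ * (½ * ε))) + ½ * (½ * (½ * ε)))
      algebra = solve 1 (λ e → con ½ :* (con ½ :* e) :+ e :* (con ½ :* (con ½ :* (con ½ :* e))) :=
        con ½ :- ((con 1ℚ :- e) :* (con ½ :+ con ½ :* (con ½ :* (con ½ :* e))) :+ con ½ :* (con ½ :* (con ½ :* e)))) refl

  -- An excess of ε over the bound puts `θ` of x above y by `θ ε`. By maximality no cover is cheap
  -- at that rate, and `rainbow-likely` then contradicts a probability near ½.
  upper-bound : (∀ z → IsProbability z → Small 𝓕 z → z ≤ℝ y) →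
    x ≤ℝ fromℚ K₀ *ℝ y *ℝ log (ℓ 𝓕 ℕ.⊔ 2) ^ℝ 2
  upper-bound maximal = ≤ℝ-by-gap x bnd refute
    where
    length = binary-length (ℓ 𝓕 ℕ.⊔ 2) (ℕ.m≤n⊔m (ℓ 𝓕) 2)
    j = proj₁ length
    2^≤ = proj₁ (proj₂ length)
    <2^ = proj₂ (proj₂ length)
    L : ℕ → ℚ
    L = seq (log (ℓ 𝓕 ℕ.⊔ 2))
    bnd = fromℚ K₀ *ℝ y *ℝ log (ℓ 𝓕 ℕ.⊔ 2) ^ℝ 2

    -- θ z = z / (64 · 192 · (j + 2)²), the rate fed to rainbow-likely.
    θ : ℚ → ℚ
    θ z = 1/64 * (1/1+ 191 * (1/1+ (suc j) * (1/1+ (suc j) * z)))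

    θ-mono : ∀ {u v} → u ≤ v → θ u ≤ θ v
    θ-mono u≤v = *-monoˡ-≤ (1/1+-nonNeg 63) (*-monoˡ-≤ (1/1+-nonNeg 191)
      (*-monoˡ-≤ (1/1+-nonNeg (suc j)) (*-monoˡ-≤ (1/1+-nonNeg (suc j)) u≤v)))

    θ-+ : ∀ u v → θ (u + v) ≡ θ u + θ v
    θ-+ u v = solve 5 (λ A B J u v → A :* (B :* (J :* (J :* (u :+ v)))) := A :* (B :* (J :* (J :* u))) :+ A :* (B :* (J :* (J :* v))))
      refl 1/64 (1/1+ 191) (1/1+ (suc j)) u v

    1/1+-pos : ∀ m {z} → 0ℚ < z → 0ℚ < 1/1+ m * z
    1/1+-pos m {z} 0<z = ℚ.positive⁻¹ _ {{ℚ.pos*pos⇒pos (1/1+ m) {{ℚ.normalize-pos 1 (suc m)}} z {{ℚ.positive 0<z}}}}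

    θ-pos : ∀ {ε} → 0ℚ < ε → 0ℚ < θ ε
    θ-pos 0<ε = 1/1+-pos 63 (1/1+-pos 191 (1/1+-pos (suc j) (1/1+-pos (suc j) 0<ε)))

    -- There are j + 2 ≤ 2(j + 1) rounds, and each of j + 1 doublings adds at least ½ to the
    -- logarithm. This is the origin of the factor 4 in `K₀`.
    1≤4L/j : ∀ N → 1ℚ ≤ 1/1+ (suc j) * (fromℕ 4 * L N)
    1≤4L/j N = begin
      1ℚ                                             ≡⟨ sym (1/1+*fromℕ* (suc j) 1ℚ) ⟩
      1/1+ (suc j) * (fromℕ (suc (suc j)) * 1ℚ)      ≤⟨ *-monoˡ-≤ (1/1+-nonNeg (suc j)) (begin
        fromℕ (suc (suc j)) * 1ℚ      ≡⟨ ℚ.*-identityʳ (fromℕ (suc (suc j))) ⟩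
        fromℕ (suc (suc j))           ≤⟨ fromℕ-mono (ℕ.≤-trans (ℕ.≤-reflexive (ℕ.+-comm 1 (suc j)))
                                            (ℕ.+-monoʳ-≤ (suc j) (ℕ.s≤s (ℕ.z≤n {j})))) ⟩
        fromℕ (suc j ℕ.+ suc j)       ≡⟨ fromℕ-+ (suc j) (suc j) ⟩
        fromℕ (suc j) + fromℕ (suc j) ≡⟨ solve 1 (λ z → z :+ z := con (fromℕ 4) :* (z :* con ½)) refl (fromℕ (suc j)) ⟩
        fromℕ 4 * (fromℕ (suc j) * ½) ≤⟨ *-monoˡ-≤ (fromℕ-nonNeg 4) (log-≥ {ℓ 𝓕 ℕ.⊔ 2} {suc j} 2^≤ N) ⟩
        fromℕ 4 * L N                 ∎) ⟩
      1/1+ (suc j) * (fromℕ 4 * L N) ∎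
      where open ℚ.≤-Reasoning

    ≤θ-bnd : ∀ N → value (q N) ≤ θ (seq bnd N)
    ≤θ-bnd N = begin
      value (q N)
        ≡⟨ sym (ℚ.*-identityʳ (value (q N))) ⟩
      value (q N) * 1ℚ
        ≤⟨ *-monoˡ-≤ (0≤p (q N)) (*-mono-≤ 0≤1 (ℚ.≤-trans 0≤1 (1≤4L/j N)) (1≤4L/j N) (1≤4L/j N)) ⟩
      value (q N) * (Y * Y)
        ≡⟨ sym (trans (cong (_* (1/1+ 191 * (fromℕ 192 * (value (q N) * (Y * Y))))) (fromℕ*1/1+ 63))
             (trans (ℚ.*-identityˡ _) (1/1+*fromℕ* 191 (value (q N) * (Y * Y))))) ⟩
      fromℕ 64 * 1/64 * (1/1+ 191 * (fromℕ 192 * (value (q N) * (Y * Y))))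
        ≡⟨ regroup (fromℕ 64) 1/64 (1/1+ 191) (fromℕ 192) (value (q N)) (1/1+ (suc j)) (fromℕ 4) (L N) ⟩
      θ (K₀ * value (q N) * (L N * (L N * 1ℚ)))
        ≡⟨ cong (λ z → θ (K₀ * z * (L N * (L N * 1ℚ)))) (q≡ N) ⟩
      θ (seq bnd N) ∎
      where
      open ℚ.≤-Reasoning
      Y = 1/1+ (suc j) * (fromℕ 4 * L N)

    size≤ : ∀ {S} → S ∈ᶠ minimal 𝓕 → ∣ S ∣ ℕ.≤ suc k
    size≤ S∈ = ℕ.≤-trans (∣minimal∣≤ℓ 𝓕 S∈) ℓ≤k

    size< : ∀ {S} → S ∈ᶠ minimal 𝓕 → ∣ S ∣ ℕ.< 2 ℕ.^ suc (suc j)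
    size< S∈ = ℕ.≤-<-trans (ℕ.≤-trans (∣minimal∣≤ℓ 𝓕 S∈) (ℕ.m≤m⊔n (ℓ 𝓕) 2)) <2^

    refute : ∀ ε → 0ℚ < ε → ∀ N → (∀ n → N ℕ.≤ n → seq bnd n + ε ≤ seq x n) → ⊥
    refute ε 0<ε N gap = ℚ.<-irrefl refl (ℚ.≤-<-trans
        (rainbow-likely k (suc j) 𝓕 size≤ size< (p m) dear)
        (∣-∣<⇒< {hit m} {½} (proj₂ hit-half m N₂≤m)))
      where
      open ℚ.≤-Reasoning
      y-steady = cauchy y (½ * θ ε) (half-pos (θ-pos 0<ε))
      -- The tolerance ¼ is the distance from ½ to the ¾ of `rainbow-likely`.
      hit-half = hit-close (½ * ½) (half-pos (ℚ.positive⁻¹ ½))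
      N₁ = proj₁ y-steady
      N₂ = proj₁ hit-half
      m = N ℕ.⊔ (N₁ ℕ.⊔ N₂)
      N₁≤m = ℕ.≤-trans (ℕ.m≤m⊔n N₁ N₂) (ℕ.m≤n⊔m N (N₁ ℕ.⊔ N₂))
      N₂≤m = ℕ.≤-trans (ℕ.m≤n⊔m N₁ N₂) (ℕ.m≤n⊔m N (N₁ ℕ.⊔ N₂))
      -- Freezing the index `m` makes the rate a rational constant: maximality applies to the
      -- constant real `fromℚ ρ`, and whether a cover is cheap at `ρ` is decidable. The form `r`
      -- certifies that `ρ` is a probability.
      r = unit 63 *ₚ (unit 191 *ₚ (unit (suc j) *ₚ (unit (suc j) *ₚ p m)))
      ρ = θ (value (p m))
      above : seq y m + θ ε ≤ ρ
      above = begin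
        seq y m + θ ε            ≡⟨ cong (_+ θ ε) (sym (q≡ m)) ⟩
        value (q m) + θ ε        ≤⟨ ℚ.+-monoˡ-≤ (θ ε) (≤θ-bnd m) ⟩
        θ (seq bnd m) + θ ε      ≡⟨ sym (θ-+ (seq bnd m) ε) ⟩
        θ (seq bnd m + ε)        ≤⟨ θ-mono (gap m (ℕ.m≤m⊔n N (N₁ ℕ.⊔ N₂))) ⟩
        θ (seq x m)              ≡⟨ cong θ (sym (p≡ m)) ⟩
        θ (value (p m))          ∎
      constant-≤ : ∀ {u v} → u ≤ v → fromℚ u ≤ℝ fromℚ v
      constant-≤ {u} {v} u≤v η 0<η = 0 , λ _ _ → ℚ.≤-<-trans u≤v (<-+-pos v 0<η)
      dear : ∀ 𝓖 → Covers 𝓖 𝓕 → ½ ≤ cost (ρ) 𝓖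
      dear 𝓖 cov = ℚ.≮⇒≥ (λ cheap → contra (maximal (fromℚ (ρ)) (constant-≤ (0≤p r) , constant-≤ (p≤1 r)) (isSmall cheap)
                                                (½ * θ ε) (half-pos (θ-pos 0<ε))))
        where
        isSmall : cost (ρ) 𝓖 < ½ → Small 𝓕 (fromℚ (ρ))
        isSmall cheap = 𝓖 , cov , λ η 0<η → 0 , λ i _ → subst (_< ½ + η) (sym (seq-cost 𝓖 (fromℚ (ρ)) i))
          (ℚ.<-trans cheap (<-+-pos ½ 0<η))
        contra : ∃[ M ] (∀ i → M ℕ.≤ i → ρ < seq y i + ½ * θ ε) → ⊥
        contra (M , below) = ℚ.<-irrefl refl (begin-strict
          ρ                                  <⟨ below i (ℕ.m≤m⊔n M m) ⟩
          seq y i + ½ * θ ε                        <⟨ ℚ.+-monoˡ-< (½ * θ ε) (∣-∣<⇒< {seq y i} {seq y m}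
                                                        (proj₂ y-steady i m (ℕ.≤-trans N₁≤m (ℕ.m≤n⊔m M m)) N₁≤m)) ⟩
          seq y m + ½ * θ ε + ½ * θ ε              ≡⟨ trans (ℚ.+-assoc (seq y m) (½ * θ ε) (½ * θ ε)) (cong (seq y m +_) (half+half (θ ε))) ⟩
          seq y m + θ ε                            ≤⟨ above ⟩
          ρ                                  ∎)
          where i = M ℕ.⊔ m

-- Existence of a colour and return to the original reals

null⇒≉½ : ∀ z → (∀ N → seq z N ≡ 0ℚ) → ¬ z ≈ℝ ½ℝ
null⇒≉½ z null z≈½ = ℚ.<-irrefl refl
  (subst (λ a → ℚ.∣ a - ½ ∣ < ½) (null N) (proj₂ (z≈½ ½ (ℚ.positive⁻¹ ½)) N ℕ.≤-refl))
  where N = proj₁ (z≈½ ½ (ℚ.positive⁻¹ ½))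

-- 𝓕 contains no empty set since a cover of it would cost 1, and it is not empty since the
-- rainbow family has positive measure; hence there is at least one colour.
colours-exist : ∀ {n} (𝓕 : Family n) k → ℓ 𝓕 ℕ.≤ k → ∀ y (q : ℕ → Probability) → (∀ N → value (q N) ≡ seq y N) → Small 𝓕 y →
  ∀ x → μᶠ n k x (rainbow 𝓕 k) ≈ℝ ½ℝ → ∃[ k′ ] k ≡ suc k′
colours-exist 𝓕 (suc k) _ y q q≡ small x half = k , refl
colours-exist {n} 𝓕 zero ℓ≤0 y q q≡ (𝓖 , cov , cheap) x half =
  ⊥-elim (null⇒≉½ (μᶠ n zero x (rainbow 𝓕 zero)) null half)
  where
  uncovered : ∀ {S} → S ∈ᶠ minimal 𝓕 → ∃[ T ] (T ∈ᶠ 𝓖 × T ⊆ S) →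
    ∃[ N ] (∀ m → N ℕ.≤ m → seq (∑ᶠ 𝓖 (λ S → y ^ℝ ∣ S ∣)) m < ½ + ½) → ⊥
  uncovered {S} S∈ (T , T∈ , T⊆S) (N , h) = ℚ.<-irrefl refl (ℚ.≤-<-trans (1≤cost (0≤p (q N)) 𝓖 T∈ ∣T∣≡0)
    (subst (_< 1ℚ) (trans (seq-cost 𝓖 y N) (cong (λ z → cost z 𝓖) (sym (q≡ N)))) (h N ℕ.≤-refl)))
    where
    ∣T∣≡0 : ∣ T ∣ ≡ 0
    ∣T∣≡0 = ℕ.n≤0⇒n≡0 (ℕ.≤-trans (p⊆q⇒∣p∣≤∣q∣ T⊆S) (ℕ.≤-trans (∣minimal∣≤ℓ 𝓕 S∈) ℓ≤0))
  empty : ∀ {S} → ¬ S ∈ᶠ minimal 𝓕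
  -- The tolerance ½ makes the cost of the cover eventually less than 1, which excludes the empty
  -- set from it.
  empty S∈ = uncovered S∈ (cov (proj₁ S∈)) (cheap ½ (ℚ.positive⁻¹ ½))
  null : ∀ N → seq (μᶠ n zero x (rainbow 𝓕 zero)) N ≡ 0ℚ
  null N = trans (seq-∑ᶠ (rainbow 𝓕 zero) (μ n zero x) N) (∫-≡0 (counting (n ℕ.* zero)) (λ S → trans
    (cong (_* seq (μ n zero x S) N) (⟦⟧-false (member? (rainbow 𝓕 zero) S) (λ (R , (_ , im∈ , _) , _) → empty im∈)))
    (ℚ.*-zeroˡ (seq (μ n zero x S) N))))

small-≈ : ∀ {n} (𝓕 : Family n) y q → y ≈ℝ q → Small 𝓕 q → Small 𝓕 y
small-≈ 𝓕 y q y≈q (𝓖 , cov , cheap) = 𝓖 , cov , ≤ℝ-trans {∑ᶠ 𝓖 (λ S → y ^ℝ ∣ S ∣)} {∑ᶠ 𝓖 (λ S → q ^ℝ ∣ S ∣)} {½ℝ}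
  (≈⇒≤ {∑ᶠ 𝓖 (λ S → y ^ℝ ∣ S ∣)} {∑ᶠ 𝓖 (λ S → q ^ℝ ∣ S ∣)}
    (sum-cong {f = λ S → y ^ℝ ∣ S ∣} {λ S → q ^ℝ ∣ S ∣} (λ S → ^-cong {y} {q} ∣ S ∣ y≈q) (members 𝓖))) cheap

module _ {n : ℕ} (𝓕 : Family n) (incr : Increasing 𝓕) (k : ℕ) (ℓ≤k : ℓ 𝓕 ℕ.≤ suc k) (q p : ℝ)
         (q-threshold : IsExpectationThreshold 𝓕 q) (p-threshold : IsRainbowThreshold 𝓕 (suc k) p) where

  private
    x = clampℝ {p} (proj₁ p-threshold)
    y = clampℝ {q} (proj₁ (proj₁ q-threshold))
    px qy : ℕ → Probability
    px N = clamp (seq p N)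
    qy N = clamp (seq q N)
    K = fromℚ K₀
    Λ = log (ℓ 𝓕 ℕ.⊔ 2) ^ℝ 2
    x≈p : x ≈ℝ p
    x≈p = clampℝ-≈ {p} (proj₁ p-threshold)
    y≈q : y ≈ℝ q
    y≈q = clampℝ-≈ {q} (proj₁ (proj₁ q-threshold))
    q≤y : q ≤ℝ y
    q≤y = ≈⇒≤ {q} {y} (≈-sym {y} {q} y≈q)
    half : μᶠ n (suc k) x (rainbow 𝓕 (suc k)) ≈ℝ ½ℝ
    half = ≈-trans {μᶠ n (suc k) x (rainbow 𝓕 (suc k))} {μᶠ n (suc k) p (rainbow 𝓕 (suc k))} {½ℝ}
      (sum-cong {f = μ n (suc k) x} {μ n (suc k) p} (μ-cong n (suc k) {x} {p} x≈p) (members (rainbow 𝓕 (suc k))))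
      (proj₂ p-threshold)

  threshold-lower : q ≤ℝ p
  threshold-lower = ≤ℝ-trans {q} {x} {p} (≤ℝ-trans {q} {y} {x} q≤y
    (lower-bound 𝓕 incr k ℓ≤k x y px qy (λ _ → refl) (λ _ → refl) half (small-≈ 𝓕 y q y≈q (proj₂ (proj₁ q-threshold)))))
    (≈⇒≤ {x} {p} x≈p)

  threshold-upper : p ≤ℝ K *ℝ q *ℝ Λ
  threshold-upper = ≤ℝ-trans {p} {x} {K *ℝ q *ℝ Λ} (≈⇒≤ {p} {x} (≈-sym {x} {p} x≈p))
    (≤ℝ-trans {x} {K *ℝ y *ℝ Λ} {K *ℝ q *ℝ Λ}
      (upper-bound 𝓕 incr k ℓ≤k x y px qy (λ _ → refl) (λ _ → refl) half
        (λ z pz small → ≤ℝ-trans {z} {q} {y} (proj₂ q-threshold z pz small) q≤y))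
      (≈⇒≤ {K *ℝ y *ℝ Λ} {K *ℝ q *ℝ Λ} (*-cong {K *ℝ y} {K *ℝ q} {Λ} {Λ}
        (*-cong {K} {K} {y} {q} (≈-refl {K}) y≈q) (≈-refl {Λ}))))

-- The `⊔ 2` keeps the logarithm positive. When `𝓕` is generated by one singleton, ℓ = 1 and log ℓ =
-- 0, while both thresholds equal ½.
mainTheorem2 : ∃[ K ] (∀ (n : ℕ) (𝓕 : Family n) → Increasing 𝓕 → (k : ℕ) → ℓ 𝓕 ℕ.≤ k →
    (q p : ℝ) → IsExpectationThreshold 𝓕 q → IsRainbowThreshold 𝓕 k p →
    q ≤ℝ p × p ≤ℝ K *ℝ q *ℝ log (ℓ 𝓕 ℕ.⊔ 2) ^ℝ 2)
mainTheorem2 = fromℚ K₀ , bounds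
  where
  bounds : ∀ n (𝓕 : Family n) → Increasing 𝓕 → ∀ k → ℓ 𝓕 ℕ.≤ k → ∀ q p →
    IsExpectationThreshold 𝓕 q → IsRainbowThreshold 𝓕 k p →
    q ≤ℝ p × p ≤ℝ fromℚ K₀ *ℝ q *ℝ log (ℓ 𝓕 ℕ.⊔ 2) ^ℝ 2
  bounds n 𝓕 incr k ℓ≤k q p q-threshold@((pq , small) , _) p-threshold@(_ , half)
    = by (colours-exist 𝓕 k ℓ≤k (clampℝ {q} pq) (λ N → clamp (seq q N)) (λ _ → refl)
            (small-≈ 𝓕 (clampℝ {q} pq) q (clampℝ-≈ {q} pq) small) p half)
    where
    by : ∃[ k′ ] k ≡ suc k′ → q ≤ℝ p × p ≤ℝ fromℚ K₀ *ℝ q *ℝ log (ℓ 𝓕 ℕ.⊔ 2) ^ℝ 2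
    by (k′ , refl) = threshold-lower 𝓕 incr k′ ℓ≤k q p q-threshold p-threshold ,
                     threshold-upper 𝓕 incr k′ ℓ≤k q p q-threshold p-threshold
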